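{- Let $G$ be an infinite definably connected definable group and let $(A,\gamma)$ be a definable $G$-module such that $A$ is definably compact and definably connected. Then $(A,\gamma)$ is trivial, i.e. $\gamma(g)(a)=a$ for all $g\in G$, $a\in A$.
   Context: $\mathcal N=(N,<,\dots)$ is an o-minimal structure and "definable" means definable in $\mathcal N$ with parameters. Definable groups carry their unique definable manifold topology making them topological groups. A definable group is definably connected if it has no proper definable subgroup of finite index; it is definably compact if for every definable continuous injective $\sigma:(a,b)\to G$ ($-\infty\le a<b\le +\infty$) both $\lim_{x\to a^+}\sigma(x)$ and $\lim_{x\to b^- }\sigma(x)$ exist in $G$. A definable $G$-module is a pair $(A,\gamma)$ with $A$ a definable abelian group and $\gamma:G\to\mathrm{Aut}(A)$ a homomorphism into the group of definable automorphisms of $A$ such that $(g,a)\mapsto\gamma(g)(a)$ is definable. -}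

module Defs where

open import Level using (Level; suc)
open import Algebra.Bundles using (Group)
open import Algebra.Definitions using (Commutative)
open import Algebra.Morphism.Structures using (module GroupMorphisms)
open import Algebra.Structures using (IsGroup)
open import Data.Empty.Polymorphic using (⊥)
open import Data.Fin.Base using (Fin)
open import Data.List.Base using (List)
open import Data.List.Relation.Unary.Any using (Any)
open import Data.List.Relation.Unary.Enumerates.Setoid using (IsEnumeration)
open import Data.Nat.Base using (ℕ; _+_)
open import Data.Product.Base using (Σ; ∃; ∃₂; _×_; _,_; proj₁; proj₂)
open import Data.Sum.Base using (_⊎_)
open import Data.Vec.Base using (Vec; []; _∷_; _++_; head; lookup; tabulate)
open import Data.Vec.Relation.Binary.Pointwise.Inductive using (Pointwise)
open import Function.Base using (_∘_)
open import Function.Bundles using (Func; _⇔_)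
open import Function.Definitions using (Bijective; Injective)
open import Relation.Binary.Bundles using (Setoid)
import Relation.Binary.Construct.Add.Extrema.Strict as Strict
import Relation.Binary.Construct.On as On
open import Relation.Binary.Core using (Rel)
open import Relation.Binary.PropositionalEquality.Core using (_≡_)
open import Relation.Binary.PropositionalEquality.Properties using (setoid)
open import Relation.Binary.Structures using (IsDenseLinearOrder)
open import Relation.Nullary.Construct.Add.Extrema using (_±; [_])
open import Relation.Nullary.Negation.Core using (¬_)
open import Relation.Unary using (Pred; _⊆_; _∈_)

-- The order symbol is not part of the signature: it is built into formulas.
record Signature (ℓ : Level) : Set (suc ℓ) where
  field
    Fun : ℕ → Set ℓ
    Rln : ℕ → Set ℓ

record Structure {ℓ : Level} (L : Signature ℓ) : Set (suc ℓ) where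
  open Signature L
  infix 4 _<_
  field
    Carrier : Set ℓ
    _<_     : Rel Carrier ℓ
    ⟦_⟧ᶠ    : ∀ {k} → Fun k → Vec Carrier k → Carrier
    ⟦_⟧ʳ    : ∀ {k} → Rln k → Pred (Vec Carrier k) ℓ

module _ {ℓ : Level} (L : Signature ℓ) where
  open Signature L

  data Term (n : ℕ) : Set ℓ where
    var : Fin n → Term n
    fun : ∀ {k} → Fun k → (Fin k → Term n) → Term n

  infix  6 _≐_ _≺_
  infixr 5 _∧̇_
  infixr 4 _∨̇_
  infixr 3 _⇒̇_

  data Formula (n : ℕ) : Set ℓ where
    _≐_ _≺_        : Term n → Term n → Formula n
    rel            : ∀ {k} → Rln k → (Fin k → Term n) → Formula n
    ⊥̇              : Formula n
    _∧̇_ _∨̇_ _⇒̇_    : Formula n → Formula n → Formula n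
    ∀̇_ ∃̇_          : Formula (ℕ.suc n) → Formula n

module _ {ℓ : Level} {L : Signature ℓ} (𝓝 : Structure L) where

  open Structure 𝓝 renaming (Carrier to N)
  open Strict _<_ using (_<±_)

  ⟦_⟧ₜ : ∀ {n} → Term L n → Vec N n → N
  ⟦ var i ⟧ₜ    v = lookup v i
  ⟦ fun f ts ⟧ₜ v = ⟦ f ⟧ᶠ (tabulate λ i → ⟦ ts i ⟧ₜ v)

  ⟦_⟧ : ∀ {n} → Formula L n → Pred (Vec N n) ℓ
  ⟦ s ≐ t ⟧    v = ⟦ s ⟧ₜ v ≡ ⟦ t ⟧ₜ v
  ⟦ s ≺ t ⟧    v = ⟦ s ⟧ₜ v < ⟦ t ⟧ₜ v
  ⟦ rel R ts ⟧ v = ⟦ R ⟧ʳ (tabulate λ i → ⟦ ts i ⟧ₜ v)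
  ⟦ ⊥̇ ⟧        v = ⊥
  ⟦ φ ∧̇ ψ ⟧    v = ⟦ φ ⟧ v × ⟦ ψ ⟧ v
  ⟦ φ ∨̇ ψ ⟧    v = ⟦ φ ⟧ v ⊎ ⟦ ψ ⟧ v
  ⟦ φ ⇒̇ ψ ⟧    v = ⟦ φ ⟧ v → ⟦ ψ ⟧ v
  ⟦ ∀̇ φ ⟧      v = ∀ a → ⟦ φ ⟧ (a ∷ v)
  ⟦ ∃̇ φ ⟧      v = ∃ λ a → ⟦ φ ⟧ (a ∷ v)

  -- The first k variables are evaluated at parameters from N.
  Definable : ∀ {n} → Pred (Vec N n) ℓ → Set ℓ
  Definable {n} P =
    ∃ λ k → Σ (Formula L (k + n)) λ φ → Σ (Vec N k) λ p →
      ∀ x → P x ⇔ ⟦ φ ⟧ (p ++ x)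

  Interval : N ± → N ± → Pred N ℓ
  Interval a b x = a <± [ x ] × [ x ] <± b

  data Piece : Set ℓ where
    point    : N → Piece
    interval : N ± → N ± → Piece

  _∈ᵖ_ : N → Piece → Set ℓ
  x ∈ᵖ point c      = x ≡ c
  x ∈ᵖ interval a b = Interval a b x

  record IsOMinimal : Set (suc ℓ) where
    field
      isDenseLinearOrder : IsDenseLinearOrder _≡_ _<_
      noLeast            : ∀ x → ∃ λ y → y < x
      noGreatest         : ∀ x → ∃ λ y → x < y
      oMinimal           : ∀ (P : Pred N ℓ) → Definable {1} (P ∘ head) →
                           Σ (List Piece) λ ps → ∀ x → P x ⇔ Any (x ∈ᵖ_) ps

  -- A subset of Nᵐ as a setoid; membership proofs are ignored by the equality.
  Sub : ∀ {m} → Pred (Vec N m) ℓ → Setoid ℓ ℓ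
  Sub {m} X = On.setoid {B = ∃ X} (setoid (Vec N m)) proj₁

  infix 4 _≋_
  _≋_ : ∀ {m} {X : Pred (Vec N m) ℓ} → Rel (∃ X) ℓ
  _≋_ {X = X} = Setoid._≈_ (Sub X)

  Graph : ∀ {m k} {X : Pred (Vec N m) ℓ} →
          (∃ X → Vec N k) → Pred (Vec N (m + k)) ℓ
  Graph f v = ∃ λ x → v ≡ proj₁ x ++ f x

  Graph₂ : ∀ {m n k} {X : Pred (Vec N m) ℓ} {Y : Pred (Vec N n) ℓ} →
           (∃ X → ∃ Y → Vec N k) → Pred (Vec N (m + (n + k))) ℓ
  Graph₂ f v = ∃₂ λ x y → v ≡ proj₁ x ++ (proj₁ y ++ f x y)

  -- Definability of the graph implies that of the domain X.
  record DefinableMap {m n} (X : Pred (Vec N m) ℓ) (Y : Pred (Vec N n) ℓ) : Set ℓ where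
    field
      func      : Func (Sub X) (Sub Y)
      definable : Definable (Graph (proj₁ ∘ Func.to func))
    open Func func public

  preimage : ∀ {m n} {X : Pred (Vec N m) ℓ} {Y : Pred (Vec N n) ℓ} →
             DefinableMap X Y → Pred (Vec N n) ℓ → Pred (Vec N m) ℓ
  preimage {X = X} f W v = Σ (X v) λ p → W (proj₁ (DefinableMap.to f (v , p)))

  -- W need not be contained in X: this is the image of W ∩ X.
  image : ∀ {m n} {X : Pred (Vec N m) ℓ} {Y : Pred (Vec N n) ℓ} →
          DefinableMap X Y → Pred (Vec N m) ℓ → Pred (Vec N n) ℓ
  image f W y = ∃ λ x → W (proj₁ x) × y ≡ proj₁ (DefinableMap.to f x)

  -- The product of the order topologies on Nᵈ, with open boxes as basis.
  IsOpen : ∀ {d} → Pred (Vec N d) ℓ → Set ℓ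
  IsOpen {d} V = ∀ v → V v → Σ (Vec N d) λ lo → Σ (Vec N d) λ hi →
    Pointwise _<_ lo v × Pointwise _<_ v hi ×
    (∀ w → Pointwise _<_ lo w → Pointwise _<_ w hi → V w)

  record DefinableGroup : Set (suc ℓ) where
    infixl 7 _∙_
    infix  8 _⁻¹
    field
      {dim}       : ℕ
      Mem         : Pred (Vec N dim) ℓ
      definable   : Definable Mem
      _∙_         : ∃ Mem → ∃ Mem → ∃ Mem
      ε           : ∃ Mem
      _⁻¹         : ∃ Mem → ∃ Mem
      isGroup     : IsGroup _≋_ _∙_ ε _⁻¹
      ∙-definable : Definable (Graph₂ λ x y → proj₁ (x ∙ y))

    group : Group ℓ ℓ
    group = record { isGroup = isGroup }

  Infinite : DefinableGroup → Set ℓ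
  Infinite G = ¬ ∃ (IsEnumeration (Sub (DefinableGroup.Mem G)))

  module _ (G : DefinableGroup) where
    open DefinableGroup G

    record IsDefinableSubgroup (H : Pred (Vec N dim) ℓ) : Set ℓ where
      field
        subset      : H ⊆ Mem
        H-definable : Definable H
        ε-closed    : proj₁ ε ∈ H
        ∙-closed    : ∀ x y → proj₁ x ∈ H → proj₁ y ∈ H → proj₁ (x ∙ y) ∈ H
        ⁻¹-closed   : ∀ x → proj₁ x ∈ H → proj₁ (x ⁻¹) ∈ H

    -- Finitely many left cosets r H cover the group.
    FiniteIndex : Pred (Vec N dim) ℓ → Set ℓ
    FiniteIndex H = Σ (List (∃ Mem)) λ rs →
      ∀ g → Any (λ r → proj₁ (r ⁻¹ ∙ g) ∈ H) rs

    DefinablyConnected : Set (suc ℓ)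
    DefinablyConnected =
      ∀ H → IsDefinableSubgroup H → FiniteIndex H → Mem ⊆ H

  record Chart {n} (X : Pred (Vec N n) ℓ) (d : ℕ) : Set (suc ℓ) where
    field
      U         : Pred (Vec N n) ℓ
      U⊆X       : U ⊆ X
      V         : Pred (Vec N d) ℓ
      V-open    : IsOpen V
      φ         : DefinableMap U V
      bijective : Bijective _≋_ _≋_ (DefinableMap.to φ)

  record DefinableManifold {n} (X : Pred (Vec N n) ℓ) : Set (suc ℓ) where
    field
      d      : ℕ
      size   : ℕ
      chart  : Fin size → Chart X d
    module C i = Chart (chart i)
    field
      covers       : ∀ {x} → X x → ∃ λ i → C.U i x
      overlap-open : ∀ i j → IsOpen (image (C.φ i) (C.U j))
      -- Continuity of φⱼ ∘ φᵢ⁻¹, whose domain is open by the previous field.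
      transition   : ∀ i j W → IsOpen W →
                     IsOpen (image (C.φ i) (preimage (C.φ j) W))

    -- Openness of W ∩ X in the manifold topology.
    Open : Pred (Vec N n) ℓ → Set ℓ
    Open W = ∀ i → IsOpen (image (C.φ i) W)

  -- By Pillay's theorem such a structure exists on every group definable in
  -- an o-minimal structure, and its topology is unique.
  record GroupManifold (G : DefinableGroup) : Set (suc ℓ) where
    open DefinableGroup G
    field
      manifold : DefinableManifold Mem
    open DefinableManifold manifold public
    field
      ∙-continuous  : ∀ x y W → Open W → proj₁ (x ∙ y) ∈ W →
                      ∃₂ λ W₁ W₂ → Open W₁ × Open W₂ × proj₁ x ∈ W₁ × proj₁ y ∈ W₂ ×
                        (∀ x′ y′ → proj₁ x′ ∈ W₁ → proj₁ y′ ∈ W₂ → proj₁ (x′ ∙ y′) ∈ W)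
      ⁻¹-continuous : ∀ W → Open W → Open λ v → Σ (Mem v) λ p → proj₁ ((v , p) ⁻¹) ∈ W

  module _ {G : DefinableGroup} (τ : GroupManifold G) where
    open DefinableGroup G
    open GroupManifold τ

    module _ {a b : N ±} (σ : DefinableMap {1} (Interval a b ∘ head) Mem) where
      open DefinableMap σ using (to)

      -- (a , b) is open in N, so its open subsets are those open in N.
      CurveContinuous : Set (suc ℓ)
      CurveContinuous = ∀ W → Open W → IsOpen (preimage σ W)

      LeftLimit : ∃ Mem → Set (suc ℓ)
      LeftLimit c = ∀ W → Open W → proj₁ c ∈ W → ∃ λ t → Interval a b t ×
        (∀ x p → x < t → proj₁ (to (x ∷ [] , p)) ∈ W)

      RightLimit : ∃ Mem → Set (suc ℓ)
      RightLimit c = ∀ W → Open W → proj₁ c ∈ W → ∃ λ t → Interval a b t ×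
        (∀ x p → t < x → proj₁ (to (x ∷ [] , p)) ∈ W)

    DefinablyCompact : Set (suc ℓ)
    DefinablyCompact =
      ∀ {a b} → a <± b → (σ : DefinableMap {1} (Interval a b ∘ head) Mem) →
      CurveContinuous σ → Injective _≋_ _≋_ (DefinableMap.to σ) →
      ∃ (LeftLimit σ) × ∃ (RightLimit σ)

  record DefinableAut (A : DefinableGroup) : Set ℓ where
    open DefinableGroup A
    open GroupMorphisms (Group.rawGroup group) (Group.rawGroup group)
    field
      map                : DefinableMap Mem Mem
      isGroupIsomorphism : IsGroupIsomorphism (DefinableMap.to map)
    open DefinableMap map public

  record DefinableModule (G : DefinableGroup) : Set (suc ℓ) where
    module G = DefinableGroup G
    field
      A    : DefinableGroup
    module A = DefinableGroup A
    field
      comm : Commutative _≋_ A._∙_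
      γ    : ∃ G.Mem → DefinableAut A

    infixr 6 _▷_
    _▷_ : ∃ G.Mem → ∃ A.Mem → ∃ A.Mem
    g ▷ a = DefinableAut.to (γ g) a

    -- γ is a homomorphism into the automorphism group, whose operation is
    -- composition and whose equality is pointwise.
    field
      γ-cong      : ∀ g h → g ≋ h → ∀ a → g ▷ a ≋ h ▷ a
      γ-homo      : ∀ g h a → (g G.∙ h) ▷ a ≋ g ▷ h ▷ a
      ▷-definable : Definable (Graph₂ λ g a → proj₁ (g ▷ a))

  IsTrivial : ∀ {G} → DefinableModule G → Set ℓ
  IsTrivial M = ∀ g a → g ▷ a ≋ a
    where open DefinableModule M

{-# OPTIONS --safe #-}
module Submission where

-- If a₀ is moved, its orbit is infinite and contains a definable curve σ. Taking limits of g ▷ x over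
-- all g with g ▷ a₀ = σ t, and subtracting the limit in t, gives a definable family f_t of nonzero
-- endomorphisms of A that tends to 0 pointwise. For each neighbourhood V of 0, A is the increasing union of
-- the sets { x : f_s x ∈ V for all s ≤ t }, so one of them has interior; hence the family is equicontinuous
-- at 0, and by compactness f_t → 0 uniformly. Thus A has arbitrarily small nonzero images f_t(A). Given a
-- small subgroup W of dimension k made of such images, first fix t and then take W so small that it does not
-- contain f_t(A). The preimage of W under f_t is a proper subgroup of the connected group A, so it has
-- smaller dimension than A, and W + f_t(A) is a small subgroup of dimension greater than k. This is absurd.

open import Axiom.ExcludedMiddle using (ExcludedMiddle)
open import Defs

open import Algebra.Bundles using (Group)
open import Algebra.Structures using (IsGroup)
open import Data.Bool.Properties using (T-irrelevant)
open import Data.Empty using (⊥; ⊥-elim)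
open import Data.Fin.Base using (Fin; zero; suc; _↑ˡ_; _↑ʳ_; splitAt)
open import Data.List.Base using (List; []; _∷_; map) renaming (_++_ to _++ˡ_)
open import Data.List.Relation.Unary.Any using (Any; here; there) renaming (map to Any-map)
open import Data.List.Relation.Unary.Any.Properties using (map⁺; ++⁺ˡ; ++⁺ʳ)
open import Data.Nat.Base using (ℕ; zero; suc; _+_; _∸_; _≤_; ≤′-reflexive; ≤′-step)
open import Data.Nat.Properties
  using (≤⇒≤′; ≤′⇒≤; _≤?_; m≤n⇒m∸n≡0; ≰⇒>; 0∸n≡0; +-suc; m+n∸n≡m; +-∸-assoc; <⇒≤; +-identityʳ; +-comm)
open import Data.Product.Base using (Σ; ∃; _×_; _,_; proj₁; proj₂; map₂)
open import Data.Sum.Base using (_⊎_; inj₁; inj₂; [_,_]′)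
open import Data.Unit.Base using (⊤; tt)
open import Data.Vec.Base using (Vec; []; _∷_; _++_; head; tail; lookup; tabulate)
open import Data.Vec.Properties
  using (lookup-++ˡ; lookup-++ʳ; lookup∘tabulate; tabulate∘lookup; tabulate-cong; lookup-splitAt; ++-injective; ∷-injective)
open import Data.Vec.Relation.Binary.Pointwise.Inductive using (Pointwise; []; _∷_)
open import Function.Base using (_∘_; id; case_of_)
open import Function.Bundles using (_⇔_; Equivalence; mk⇔)
import Level
open import Level using (Level; Lift; lift; lower)
open import Relation.Binary.PropositionalEquality using (_≡_; refl; sym; trans; cong; cong₂; subst; subst₂)
open import Relation.Nullary using (¬_; yes; no)
open import Relation.Nullary.Construct.Add.Extrema using (_±; ⊥±; ⊤±) renaming ([_] to ⟨_⟩)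
open import Relation.Nullary.Decidable using (True; toWitness; fromWitness)


-- Definable choice may fail in an o-minimal structure, so no `g` with `g ▷ a₀ = σ t` can be picked
-- definably in `t`. The limit over all such `g`, taken along a canonical complete type, replaces
-- the pick. Limits of automorphisms stay additive but may lose injectivity, which is why the later
-- argument is about endomorphisms. Subtracting the limit in `t` makes the pointwise limit zero,
-- while injectivity of `σ` keeps the difference nonzero at `a₀` for all but at most one `t`.
-- Dimension counts quantifiers of the form "for an interval of values". Its behaviour under maps
-- rests on exchanging two such quantifiers, and this exchange is where the monotonicity theorem is
-- spent; no cell decomposition is used. The final contradiction is with the bound of the dimension
-- by the number of ambient coordinates. Connectedness of `A` says that proper definable subgroups
-- have infinite index, and compactness turns this into smaller dimension.

module _ (em : ∀ {a} → ExcludedMiddle a) {ℓ : Level} {L : Signature ℓ} (𝓝 : Structure L)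
         (om : IsOMinimal 𝓝) (pt : Structure.Carrier 𝓝) where

  open Structure 𝓝 using (_<_) renaming (Carrier to N)
  open Equivalence using (to; from)

  -- First-order definability

  ⇔-trans : ∀ {a b c} {P : Set a} {Q : Set b} {R : Set c} → P ⇔ Q → Q ⇔ R → P ⇔ R
  ⇔-trans f g = mk⇔ (λ p → to g (to f p)) (λ r → from f (from g r))

  ⇔-sym : ∀ {a b} {P : Set a} {Q : Set b} → P ⇔ Q → Q ⇔ P
  ⇔-sym f = mk⇔ (from f) (to f)

  ⇔-subst : ∀ {a b} {A : Set a} (P : A → Set b) {x y : A} → x ≡ y → P x ⇔ P y
  ⇔-subst P refl = mk⇔ id id

  renₜ : ∀ {m n} → (Fin m → Fin n) → Term L m → Term L n
  renₜ σ (var i)    = var (σ i)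
  renₜ σ (fun f ts) = fun f λ i → renₜ σ (ts i)

  renₜ-sem : ∀ {m n} (σ : Fin m → Fin n) t v →
             ⟦_⟧ₜ 𝓝 (renₜ σ t) v ≡ ⟦_⟧ₜ 𝓝 t (tabulate λ i → lookup v (σ i))
  renₜ-sem σ (var i)    v = sym (lookup∘tabulate _ i)
  renₜ-sem σ (fun f ts) v = cong (Structure.⟦_⟧ᶠ 𝓝 f) (tabulate-cong λ i → renₜ-sem σ (ts i) v)

  lift↑ : ∀ {m n} → (Fin m → Fin n) → Fin (suc m) → Fin (suc n)
  lift↑ σ zero    = zero
  lift↑ σ (suc i) = suc (σ i)

  ren : ∀ {m n} → (Fin m → Fin n) → Formula L m → Formula L n
  ren σ (s ≐ t)    = renₜ σ s ≐ renₜ σ t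
  ren σ (s ≺ t)    = renₜ σ s ≺ renₜ σ t
  ren σ (rel R ts) = rel R λ i → renₜ σ (ts i)
  ren σ ⊥̇          = ⊥̇
  ren σ (φ ∧̇ ψ)    = ren σ φ ∧̇ ren σ ψ
  ren σ (φ ∨̇ ψ)    = ren σ φ ∨̇ ren σ ψ
  ren σ (φ ⇒̇ ψ)    = ren σ φ ⇒̇ ren σ ψ
  ren σ (∀̇ φ)      = ∀̇ ren (lift↑ σ) φ
  ren σ (∃̇ φ)      = ∃̇ ren (lift↑ σ) φ

  ren-sem : ∀ {m n} (σ : Fin m → Fin n) φ v →
            ⟦_⟧ 𝓝 (ren σ φ) v ⇔ ⟦_⟧ 𝓝 φ (tabulate λ i → lookup v (σ i))
  ren-sem σ (s ≐ t) v rewrite renₜ-sem σ s v | renₜ-sem σ t v = mk⇔ id id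
  ren-sem σ (s ≺ t) v rewrite renₜ-sem σ s v | renₜ-sem σ t v = mk⇔ id id
  ren-sem σ (rel R ts) v =
    ⇔-subst (Structure.⟦_⟧ʳ 𝓝 R) (tabulate-cong λ i → renₜ-sem σ (ts i) v)
  ren-sem σ ⊥̇ v = mk⇔ id id
  ren-sem σ (φ ∧̇ ψ) v = mk⇔
    (λ (a , b) → to (ren-sem σ φ v) a , to (ren-sem σ ψ v) b)
    (λ (a , b) → from (ren-sem σ φ v) a , from (ren-sem σ ψ v) b)
  ren-sem σ (φ ∨̇ ψ) v = mk⇔
    [ inj₁ ∘ to (ren-sem σ φ v) , inj₂ ∘ to (ren-sem σ ψ v) ]′
    [ inj₁ ∘ from (ren-sem σ φ v) , inj₂ ∘ from (ren-sem σ ψ v) ]′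
  ren-sem σ (φ ⇒̇ ψ) v = mk⇔
    (λ f a → to (ren-sem σ ψ v) (f (from (ren-sem σ φ v) a)))
    (λ f a → from (ren-sem σ ψ v) (f (to (ren-sem σ φ v) a)))
  ren-sem σ (∀̇ φ) v = mk⇔
    (λ f a → to (ren-sem (lift↑ σ) φ (a ∷ v)) (f a))
    (λ f a → from (ren-sem (lift↑ σ) φ (a ∷ v)) (f a))
  ren-sem σ (∃̇ φ) v = mk⇔
    (λ (a , p) → a , to (ren-sem (lift↑ σ) φ (a ∷ v)) p)
    (λ (a , p) → a , from (ren-sem (lift↑ σ) φ (a ∷ v)) p)

  -- A variable of the formula stands for a parameter or for a coordinate, so
  -- that reindexing coordinates does not touch the formula.
  Slot : ℕ → Set ℓ
  Slot n = N ⊎ Fin n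

  value : ∀ {n} → Vec N n → Slot n → N
  value x (inj₁ c) = c
  value x (inj₂ i) = lookup x i

  record Def {n} (P : Vec N n → Set ℓ) : Set ℓ where
    constructor mkDef
    field
      {arity} : ℕ
      formula : Formula L arity
      slot    : Fin arity → Slot n
      meaning : ∀ x → P x ⇔ ⟦_⟧ 𝓝 formula (tabulate λ i → value x (slot i))

  Definable⇒Def : ∀ {n} {P : Vec N n → Set ℓ} → Definable 𝓝 P → Def P
  Definable⇒Def {n} {P} (k , φ , p , e) = mkDef φ (λ i → slot (splitAt k i)) λ x →
    ⇔-trans (e x) (⇔-subst (⟦_⟧ 𝓝 φ) (trans (sym (tabulate∘lookup (p ++ x))) (tabulate-cong (lk p x))))
    where
      slot : ∀ {k} → {p : Vec N k} → Fin k ⊎ Fin n → Slot n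
      slot {p = p} (inj₁ i) = inj₁ (lookup p i)
      slot (inj₂ j) = inj₂ j
      lk : ∀ {k} (p : Vec N k) x i → lookup (p ++ x) i ≡ value x (slot {p = p} (splitAt k i))
      lk []      x i       = refl
      lk (c ∷ p) x zero    = refl
      lk {suc k} (c ∷ p) x (suc i) with splitAt k i | lk p x i
      ... | inj₁ _ | eq = eq
      ... | inj₂ _ | eq = eq

  -- Every variable of the formula receives a parameter, with `pt` as a filler where it stands for a
  -- coordinate. The renaming then sends each variable either into the parameter block or to its
  -- coordinate, so the fillers are never read.
  Def⇒Definable : ∀ {n} {P : Vec N n → Set ℓ} → Def P → Definable 𝓝 P
  Def⇒Definable {n} (mkDef {k} φ s e) = k , ren (σ ∘ s′) φ , tabulate (π ∘ s) , λ x →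
    ⇔-trans (e x) (⇔-trans (⇔-subst (⟦_⟧ 𝓝 φ) (tabulate-cong (lk x)))
                            (⇔-sym (ren-sem (σ ∘ s′) φ (tabulate (π ∘ s) ++ x))))
    where
      π : Slot n → N
      π (inj₁ c) = c
      π (inj₂ _) = pt
      s′ : Fin k → Fin k ⊎ Fin n
      s′ i = [ (λ _ → inj₁ i) , inj₂ ]′ (s i)
      σ : Fin k ⊎ Fin n → Fin (k + n)
      σ = [ _↑ˡ n , k ↑ʳ_ ]′
      lk : ∀ x i → value x (s i) ≡ lookup (tabulate (π ∘ s) ++ x) (σ (s′ i))
      lk x i with s i in eq
      ... | inj₁ c = sym (trans (lookup-++ˡ (tabulate (π ∘ s)) x i)
                           (trans (lookup∘tabulate (π ∘ s) i) (cong π eq)))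
      ... | inj₂ j = sym (lookup-++ʳ (tabulate (π ∘ s)) x j)

  Def-resp : ∀ {n} {P Q : Vec N n → Set ℓ} → (∀ x → P x → Q x) → (∀ x → Q x → P x) → Def P → Def Q
  Def-resp f g (mkDef φ s e) = mkDef φ s λ x → ⇔-trans (mk⇔ (g x) (f x)) (e x)

  bind-slot : ∀ {m n} → (Fin m → Slot n) → Slot m → Slot n
  bind-slot σ (inj₁ c) = inj₁ c
  bind-slot σ (inj₂ i) = σ i

  value-bind : ∀ {m n} (σ : Fin m → Slot n) x j →
               value (tabulate λ i → value x (σ i)) j ≡ value x (bind-slot σ j)
  value-bind σ x (inj₁ c) = refl
  value-bind σ x (inj₂ i) = lookup∘tabulate _ i

  Def-reindex : ∀ {m n} {P : Vec N m → Set ℓ} (σ : Fin m → Slot n) → Def P →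
                Def (λ x → P (tabulate λ i → value x (σ i)))
  Def-reindex σ (mkDef φ s e) = mkDef φ (bind-slot σ ∘ s) λ x →
    ⇔-trans (e _) (⇔-subst (⟦_⟧ 𝓝 φ) (tabulate-cong λ i → value-bind σ x (s i)))

  -- Both formulas are renamed into the disjoint union of their variables, so that a connective can
  -- be applied over one common environment.
  module _ {n} {P Q : Vec N n → Set ℓ} (dP : Def P) (dQ : Def Q) where
    private
      k₁ = Def.arity dP
      k₂ = Def.arity dQ
      φ  = ren (_↑ˡ k₂) (Def.formula dP)
      ψ  = ren (k₁ ↑ʳ_) (Def.formula dQ)
      s  : Fin (k₁ + k₂) → Slot n
      s i = [ Def.slot dP , Def.slot dQ ]′ (splitAt k₁ i)
      env-eq : ∀ k₁ {k₂} (f : Fin k₁ → Slot n) (g : Fin k₂ → Slot n) x →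
               tabulate (λ i → value x (f i)) ++ tabulate (λ i → value x (g i))
               ≡ tabulate (λ i → value x ([ f , g ]′ (splitAt k₁ i)))
      env-eq zero f g x = refl
      env-eq (suc k₁) f g x = cong (value x (f zero) ∷_)
        (trans (env-eq k₁ (f ∘ suc) g x) (tabulate-cong λ i → cong (value x) (lem (splitAt k₁ i))))
        where
          lem : ∀ j → [ f ∘ suc , g ]′ j ≡ [ f , g ]′ ([ inj₁ ∘ suc , inj₂ ]′ j)
          lem (inj₁ _) = refl
          lem (inj₂ _) = refl
      left : ∀ x → P x ⇔ ⟦_⟧ 𝓝 φ (tabulate λ i → value x (s i))
      left x = ⇔-trans (Def.meaning dP x) (⇔-trans
        (⇔-subst (⟦_⟧ 𝓝 (Def.formula dP)) (sym
          (tabulate-cong λ i → trans (cong (λ e → lookup e (i ↑ˡ k₂)) (sym (env-eq k₁ _ _ x)))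
            (trans (lookup-++ˡ (tabulate (λ i → value x (Def.slot dP i))) _ i) (lookup∘tabulate _ i)))))
        (⇔-sym (ren-sem (_↑ˡ k₂) (Def.formula dP) _)))
      right : ∀ x → Q x ⇔ ⟦_⟧ 𝓝 ψ (tabulate λ i → value x (s i))
      right x = ⇔-trans (Def.meaning dQ x) (⇔-trans
        (⇔-subst (⟦_⟧ 𝓝 (Def.formula dQ)) (sym
          (tabulate-cong λ i → trans (cong (λ e → lookup e (k₁ ↑ʳ i)) (sym (env-eq k₁ _ _ x)))
            (trans (lookup-++ʳ (tabulate (λ i → value x (Def.slot dP i))) _ i) (lookup∘tabulate _ i)))))
        (⇔-sym (ren-sem (k₁ ↑ʳ_) (Def.formula dQ) _)))

    Def-× : Def (λ x → P x × Q x)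
    Def-× = mkDef (φ ∧̇ ψ) s λ x → mk⇔
      (λ (p , q) → to (left x) p , to (right x) q) (λ (p , q) → from (left x) p , from (right x) q)

    Def-⊎ : Def (λ x → P x ⊎ Q x)
    Def-⊎ = mkDef (φ ∨̇ ψ) s λ x → mk⇔
      [ inj₁ ∘ to (left x) , inj₂ ∘ to (right x) ]′ [ inj₁ ∘ from (left x) , inj₂ ∘ from (right x) ]′

    Def-→ : Def (λ x → P x → Q x)
    Def-→ = mkDef (φ ⇒̇ ψ) s λ x → mk⇔
      (λ f p → to (right x) (f (from (left x) p))) (λ f p → from (right x) (f (to (left x) p)))

  module _ {n} {P : Vec N (suc n) → Set ℓ} (dP : Def P) where
    private
      k = Def.arity dP
      bind : Slot (suc n) → Fin k → Fin (suc k)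
      bind (inj₂ zero) i = zero
      bind _           i = suc i
      unbind : Slot (suc n) → Slot n
      unbind (inj₁ c)       = inj₁ c
      -- `bind` sends this variable to the quantified one. Its old position remains in the
      -- environment and is filled with `pt`, which is never read.
      unbind (inj₂ zero)    = inj₁ pt
      unbind (inj₂ (suc j)) = inj₂ j
      s : Fin k → Slot n
      s i = unbind (Def.slot dP i)
      σ : Fin k → Fin (suc k)
      σ i = bind (Def.slot dP i) i
      lk : ∀ a x i (j : Slot (suc n)) (t : Fin k → N) → t i ≡ value x (unbind j) →
           lookup (a ∷ tabulate t) (bind j i) ≡ value (a ∷ x) j
      lk a x i (inj₁ c)       t eq = trans (lookup∘tabulate t i) eq
      lk a x i (inj₂ zero)    t eq = refl
      lk a x i (inj₂ (suc j)) t eq = trans (lookup∘tabulate t i) eq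
      body : ∀ a x → P (a ∷ x) ⇔ ⟦_⟧ 𝓝 (ren σ (Def.formula dP)) (a ∷ tabulate λ i → value x (s i))
      body a x = ⇔-trans (Def.meaning dP (a ∷ x)) (⇔-trans
        (⇔-subst (⟦_⟧ 𝓝 (Def.formula dP))
          (sym (tabulate-cong λ i → lk a x i (Def.slot dP i) (λ i → value x (s i)) refl)))
        (⇔-sym (ren-sem σ (Def.formula dP) _)))

    Def-∃ : Def (λ x → ∃ λ a → P (a ∷ x))
    Def-∃ = mkDef (∃̇ ren σ (Def.formula dP)) s λ x → mk⇔
      (λ (a , p) → a , to (body a x) p) (λ (a , p) → a , from (body a x) p)

    Def-∀ : Def (λ x → ∀ a → P (a ∷ x))
    Def-∀ = mkDef (∀̇ ren σ (Def.formula dP)) s λ x → mk⇔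
      (λ f a → to (body a x) (f a)) (λ f a → from (body a x) (f a))

  Def-∃ⁿ : ∀ m {n} {P : Vec N (m + n) → Set ℓ} → Def P → Def (λ x → ∃ λ (y : Vec N m) → P (y ++ x))
  Def-∃ⁿ zero    dP = Def-resp (λ _ p → [] , p) (λ { _ ([] , p) → p }) dP
  Def-∃ⁿ (suc m) dP = Def-resp (λ { _ (y , a , p) → (a ∷ y) , p }) (λ { _ ((a ∷ y) , p) → y , a , p })
    (Def-∃ⁿ m (Def-∃ dP))

  Def-∀ⁿ : ∀ m {n} {P : Vec N (m + n) → Set ℓ} → Def P → Def (λ x → ∀ (y : Vec N m) → P (y ++ x))
  Def-∀ⁿ zero    dP = Def-resp (λ { _ p [] → p }) (λ _ f → f []) dP
  Def-∀ⁿ (suc m) dP = Def-resp (λ { _ f (a ∷ y) → f y a }) (λ _ f y a → f (a ∷ y))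
    (Def-∀ⁿ m (Def-∀ dP))

  Def-≐ : ∀ {n} (a b : Slot n) → Def (λ x → value x a ≡ value x b)
  Def-≐ a b = mkDef {arity = 2} (var zero ≐ var (suc zero)) (λ { zero → a ; (suc zero) → b }) λ _ → mk⇔ id id

  Def-≺ : ∀ {n} (a b : Slot n) → Def (λ x → value x a < value x b)
  Def-≺ a b = mkDef {arity = 2} (var zero ≺ var (suc zero)) (λ { zero → a ; (suc zero) → b }) λ _ → mk⇔ id id

  Def-⊤ : ∀ {n} → Def {n} (λ _ → Lift ℓ ⊤)
  Def-⊤ = mkDef {arity = 0} (⊥̇ ⇒̇ ⊥̇) (λ ()) λ _ → mk⇔ (λ _ p → p) (λ _ → lift tt)

  Def-⊥ : ∀ {n} → Def {n} (λ _ → Lift ℓ ⊥)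
  Def-⊥ = mkDef {arity = 0} ⊥̇ (λ ()) λ _ → mk⇔ (λ ()) (λ ())

  Def-tabulate-≡ : ∀ {m n} (f g : Fin m → Slot n) →
                   Def (λ x → tabulate (λ i → value x (f i)) ≡ tabulate (λ i → value x (g i)))
  Def-tabulate-≡ {zero}  f g = Def-resp (λ _ _ → refl) (λ _ _ → lift tt) Def-⊤
  Def-tabulate-≡ {suc m} f g = Def-resp (λ { _ (p , q) → cong₂ _∷_ p q }) (λ _ → ∷-injective)
    (Def-× (Def-≐ (f zero) (g zero)) (Def-tabulate-≡ (f ∘ suc) (g ∘ suc)))

  -- Points of a definable set are kept behind an injective encoding, so that
  -- products and subsets can be used as ordinary types with propositional equality.
  record Encoded : Set (Level.suc ℓ) where
    no-eta-equality
    field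
      C     : Set ℓ
      {dim} : ℕ
      enc   : C → Vec N dim
      enc-injective : ∀ {a b} → enc a ≡ enc b → a ≡ b
      im    : Def (λ v → Σ C λ c → enc c ≡ v)

  infixl 6 _⊗_
  data Sort : Set (Level.suc ℓ) where
    Nₛ 𝟙ₛ : Sort
    Vₛ    : ℕ → Sort
    _⊗_   : Sort → Sort → Sort
    base  : Encoded → Sort

  C : Sort → Set ℓ
  C Nₛ       = N
  C 𝟙ₛ       = Lift ℓ ⊤
  C (Vₛ n)   = Vec N n
  C (S ⊗ T)  = C S × C T
  C (base E) = Encoded.C E

  dim : Sort → ℕ
  dim Nₛ       = 1
  dim 𝟙ₛ       = 0
  dim (Vₛ n)   = n
  dim (S ⊗ T)  = dim S + dim T
  dim (base E) = Encoded.dim E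

  enc : (S : Sort) → C S → Vec N (dim S)
  enc Nₛ       a       = a ∷ []
  enc 𝟙ₛ       _       = []
  enc (Vₛ n)   v       = v
  enc (S ⊗ T)  (s , t) = enc S s ++ enc T t
  enc (base E) c       = Encoded.enc E c

  enc-injective : (S : Sort) {a b : C S} → enc S a ≡ enc S b → a ≡ b
  enc-injective Nₛ       refl = refl
  enc-injective 𝟙ₛ       _    = refl
  enc-injective (Vₛ n)   e    = e
  enc-injective (S ⊗ T)  {a , a′} {b , b′} e =
    let (p , q) = ++-injective (enc S a) (enc S b) e in cong₂ _,_ (enc-injective S p) (enc-injective T q)
  enc-injective (base E) e    = Encoded.enc-injective E e

  im : (S : Sort) → Def (λ v → Σ (C S) λ c → enc S c ≡ v)
  im Nₛ       = Def-resp (λ { (a ∷ []) _ → a , refl }) (λ _ _ → lift tt) Def-⊤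
  im 𝟙ₛ       = Def-resp (λ { [] _ → lift tt , refl }) (λ _ _ → lift tt) Def-⊤
  im (Vₛ n)   = Def-resp (λ v _ → v , refl) (λ _ _ → lift tt) Def-⊤
  im (base E) = Encoded.im E
  im (S ⊗ T)  = Def-resp
    (λ { v ((s , p) , (t , q)) → (s , t) , trans (cong₂ _++_ p q) (split-++ m v) })
    (λ { v ((s , t) , refl) → (s , sym (left _ (enc T t))) , (t , sym (right (enc S s) _)) })
    (Def-× (Def-reindex (λ i → inj₂ (i ↑ˡ n)) (im S)) (Def-reindex (λ i → inj₂ (m ↑ʳ i)) (im T)))
    where
      m = dim S
      n = dim T
      left : ∀ {m n} (x : Vec N m) (y : Vec N n) → tabulate (λ i → lookup (x ++ y) (i ↑ˡ n)) ≡ x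
      left x y = trans (tabulate-cong (lookup-++ˡ x y)) (tabulate∘lookup x)
      right : ∀ {m n} (x : Vec N m) (y : Vec N n) → tabulate (λ i → lookup (x ++ y) (m ↑ʳ i)) ≡ y
      right x y = trans (tabulate-cong (lookup-++ʳ x y)) (tabulate∘lookup y)
      split-++ : ∀ m {n} (v : Vec N (m + n)) →
                 tabulate (λ i → lookup v (i ↑ˡ n)) ++ tabulate (λ i → lookup v (m ↑ʳ i)) ≡ v
      split-++ zero    v       = tabulate∘lookup v
      split-++ (suc m) (a ∷ v) = cong (a ∷_) (split-++ m v)

  -- Calculus of definable predicates and maps

  record DefP (S : Sort) (P : C S → Set ℓ) : Set ℓ where
    constructor defP
    field get : Def (λ v → Σ (C S) λ c → enc S c ≡ v × P c)
  open DefP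

  module _ {S : Sort} where
    opaque
      DefP-resp : ∀ {P Q : C S → Set ℓ} → (∀ s → P s → Q s) → (∀ s → Q s → P s) → DefP S P → DefP S Q
      DefP-resp f g (defP d) = defP (Def-resp (λ _ (c , e , p) → c , e , f c p) (λ _ (c , e , p) → c , e , g c p) d)

    opaque
      def-⊤ : DefP S (λ _ → Lift ℓ ⊤)
      def-⊤ = defP (Def-resp (λ _ (c , e) → c , e , lift tt) (λ _ (c , e , _) → c , e) (im S))

    opaque
      def-⊥ : DefP S (λ _ → Lift ℓ ⊥)
      def-⊥ = defP (Def-resp (λ _ ()) (λ { _ (_ , _ , ()) }) Def-⊥)

    module _ {P Q : C S → Set ℓ} where
      opaque
        def-× : DefP S P → DefP S Q → DefP S (λ s → P s × Q s)
        def-× (defP p) (defP q) = defP (Def-resp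
          (λ _ ((c , e , p) , (c′ , e′ , q)) → c , e , p , subst Q (enc-injective S (trans e′ (sym e))) q)
          (λ _ (c , e , p , q) → (c , e , p) , (c , e , q)) (Def-× p q))

      opaque
        def-⊎ : DefP S P → DefP S Q → DefP S (λ s → P s ⊎ Q s)
        def-⊎ (defP p) (defP q) = defP (Def-resp
          (λ { _ (inj₁ (c , e , p)) → c , e , inj₁ p ; _ (inj₂ (c , e , q)) → c , e , inj₂ q })
          (λ { _ (c , e , inj₁ p) → inj₁ (c , e , p) ; _ (c , e , inj₂ q) → inj₂ (c , e , q) }) (Def-⊎ p q))

      opaque
        def-→ : DefP S P → DefP S Q → DefP S (λ s → P s → Q s)
        def-→ (defP p) (defP q) = defP (Def-resp
          (λ { _ ((c , e) , f) → c , e , λ p → transp c e (f (c , e , p)) })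
          (λ { _ (c , e , f) → (c , e) , λ { (c′ , e′ , p) →
                 c , e , f (subst P (enc-injective S (trans e′ (sym e))) p) } })
          -- The bare implication also holds, vacuously, at vectors that encode no point; the image
          -- of the encoding excludes them.
          (Def-× (im S) (Def-→ p q)))
          where
            transp : ∀ {v} c → enc S c ≡ v → (Σ (C S) λ c → enc S c ≡ v × Q c) → Q c
            transp c e (c′ , e′ , q) = subst Q (enc-injective S (trans e′ (sym e))) q

    opaque
      def-¬ : ∀ {P : C S → Set ℓ} → DefP S P → DefP S (λ s → ¬ P s)
      def-¬ p = DefP-resp (λ _ f p → lower (f p)) (λ _ f p → ⊥-elim (f p)) (def-→ p def-⊥)

  module _ {S : Sort} (T : Sort) {P : C S → C T → Set ℓ} where
    -- Def-∃ⁿ and Def-∀ⁿ bind an initial segment, so the two factors are exchanged first.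
    private
      swap-slot : Fin (dim S + dim T) → Slot (dim T + dim S)
      swap-slot i = inj₂ ([ dim T ↑ʳ_ , _↑ˡ dim S ]′ (splitAt (dim S) i))
      swapped : ∀ m {n} (x : Vec N n) (y : Vec N m) →
                tabulate (λ i → value (y ++ x) (inj₂ ([ m ↑ʳ_ , _↑ˡ n ]′ (splitAt n i)))) ≡ x ++ y
      swapped m {n} x y = trans (tabulate-cong λ i → lem i) (tabulate∘lookup (x ++ y))
        where
          open import Data.Vec.Properties using (lookup-splitAt)
          aux : ∀ j → lookup (y ++ x) ([ m ↑ʳ_ , _↑ˡ n ]′ j) ≡ [ lookup x , lookup y ]′ j
          aux (inj₁ i) = lookup-++ʳ y x i
          aux (inj₂ i) = lookup-++ˡ y x i
          lem : ∀ i → lookup (y ++ x) ([ m ↑ʳ_ , _↑ˡ n ]′ (splitAt n i)) ≡ lookup (x ++ y) i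
          lem i = trans (aux (splitAt n i)) (sym (lookup-splitAt n x y i))

      Graph-P : Vec N (dim S + dim T) → Set ℓ
      Graph-P v = Σ (C S × C T) λ st → enc S (proj₁ st) ++ enc T (proj₂ st) ≡ v × P (proj₁ st) (proj₂ st)
      swapped-P : Vec N (dim T + dim S) → Set ℓ
      swapped-P w = Graph-P (tabulate λ i → value w (swap-slot i))
      exchange : Def Graph-P → Def swapped-P
      exchange = Def-reindex swap-slot

    opaque
      def-∃ : DefP (S ⊗ T) (λ st → P (proj₁ st) (proj₂ st)) → DefP S (λ s → Σ (C T) (P s))
      def-∃ (defP d) = defP (Def-resp
        (λ { v (y , (s , t) , e , p) →
               s , proj₁ (++-injective (enc S s) v (trans e (swapped (dim T) v y))) , t , p })
        (λ { v (s , refl , t , p) → enc T t , (s , t) , sym (swapped (dim T) v (enc T t)) , p })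
        (Def-∃ⁿ (dim T) {dim S} {swapped-P} (exchange d)))

    opaque
      def-∀ : DefP (S ⊗ T) (λ st → P (proj₁ st) (proj₂ st)) → DefP S (λ s → ∀ t → P s t)
      def-∀ (defP d) = defP (Def-resp
        (λ { v ((s , refl) , f) → s , refl , λ t → transp s t (f (enc T t) (t , sym (right v (enc T t)))) })
        (λ { v (s , refl , f) → (s , refl) , λ { y (t , e) → (s , t) ,
               trans (cong (enc S s ++_) (trans e (right v y))) (sym (swapped (dim T) v y)) , f t } })
        (Def-× (im S) (Def-∀ⁿ (dim T) {dim S} (Def-→ (Def-reindex (λ i → inj₂ (i ↑ˡ dim S)) (im T)) (exchange d)))))
        where
          right : ∀ (v : Vec N (dim S)) (y : Vec N (dim T)) → tabulate (λ i → lookup (y ++ v) (i ↑ˡ dim S)) ≡ y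
          right v y = trans (tabulate-cong (lookup-++ˡ y v)) (tabulate∘lookup y)
          transp : ∀ s t → (Σ (C S × C T) λ st → (enc S (proj₁ st) ++ enc T (proj₂ st)
                     ≡ tabulate λ i → value (enc T t ++ enc S s) (swap-slot i)) × P (proj₁ st) (proj₂ st)) → P s t
          transp s t ((s′ , t′) , e , p) = subst₂ P (enc-injective S (proj₁ es)) (enc-injective T (proj₂ es)) p
            where es : enc S s′ ≡ enc S s × enc T t′ ≡ enc T t
                  es = ++-injective (enc S s′) (enc S s) (trans e (swapped (dim T) (enc S s) (enc T t)))

  DefM : (S T : Sort) → (C S → C T) → Set ℓ
  DefM S T f = DefP (S ⊗ T) (λ st → f (proj₁ st) ≡ proj₂ st)

  -- Maps that only select coordinates and insert parameters.
  record Simple (S T : Sort) (f : C S → C T) : Set ℓ where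
    constructor simple
    field
      sl : Fin (dim T) → Slot (dim S)
      eq : ∀ s → enc T (f s) ≡ tabulate λ i → value (enc S s) (sl i)

  opaque
    pull : ∀ {S T f} {P : C T → Set ℓ} → Simple S T f → DefP T P → DefP S (λ s → P (f s))
    pull {S} {T} {f} {P} (simple sl eq) (defP d) = defP (Def-resp
      (λ { v ((s , refl) , (t , e , p)) → s , refl , subst P (enc-injective T (trans e (sym (eq s)))) p })
      (λ { v (s , refl , p) → (s , refl) , (f s , eq s , p) })
      (Def-× (im S) (Def-reindex {P = λ w → Σ (C T) λ t → enc T t ≡ w × P t} sl d)))

  module _ {S T U : Sort} where
    opaque
      s-∘ : ∀ {f g} → Simple T U g → Simple S T f → Simple S U (λ s → g (f s))
      s-∘ (simple s₁ e₁) (simple s₂ e₂) = simple (λ i → bind-slot s₂ (s₁ i)) λ s → trans (e₁ _)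
        (tabulate-cong λ i → trans (cong (λ w → value w (s₁ i)) (e₂ s)) (value-bind s₂ _ (s₁ i)))

    opaque
      s-, : ∀ {f g} → Simple S T f → Simple S U g → Simple S (T ⊗ U) (λ s → f s , g s)
      s-, (simple s₁ e₁) (simple s₂ e₂) = simple (λ i → [ s₁ , s₂ ]′ (splitAt (dim T) i)) λ s →
        trans (cong₂ _++_ (e₁ s) (e₂ s)) (lem (enc S s) _ s₁ s₂)
        where
          lem : ∀ (x : Vec N (dim S)) m {n} (f : Fin m → Slot (dim S)) (g : Fin n → Slot (dim S)) →
                tabulate (λ i → value x (f i)) ++ tabulate (λ i → value x (g i))
                ≡ tabulate (λ i → value x ([ f , g ]′ (splitAt m i)))
          lem x zero    f g = refl
          lem x (suc m) f g = cong (value x (f zero) ∷_) (trans (lem x m (f ∘ suc) g)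
            (tabulate-cong λ i → cong (value x) (aux (splitAt m i))))
            where
              aux : ∀ j → [ f ∘ suc , g ]′ j ≡ [ f , g ]′ ([ inj₁ ∘ suc , inj₂ ]′ j)
              aux (inj₁ _) = refl
              aux (inj₂ _) = refl

  module _ {S T : Sort} where
    opaque
      s-proj₁ : Simple (S ⊗ T) S proj₁
      s-proj₁ = simple (λ i → inj₂ (i ↑ˡ _)) λ (s , t) →
        sym (trans (tabulate-cong (lookup-++ˡ (enc S s) (enc T t))) (tabulate∘lookup _))

    opaque
      s-proj₂ : Simple (S ⊗ T) T proj₂
      s-proj₂ = simple (λ i → inj₂ (dim S ↑ʳ i)) λ (s , t) →
        sym (trans (tabulate-cong (lookup-++ʳ (enc S s) (enc T t))) (tabulate∘lookup _))

  opaque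
    s-const : ∀ {S T} c → Simple S T (λ _ → c)
    s-const {T = T} c = simple (λ i → inj₁ (lookup (enc T c) i)) λ _ → sym (tabulate∘lookup _)

  opaque
    def-≡ˢ : ∀ {S U f g} → Simple S U f → Simple S U g → DefP S (λ s → f s ≡ g s)
    def-≡ˢ {S} {U} (simple s₁ e₁) (simple s₂ e₂) = defP (Def-resp
      (λ { v ((s , refl) , e) → s , refl , enc-injective U (trans (e₁ s) (trans e (sym (e₂ s)))) })
      (λ { v (s , refl , e) → (s , refl) , trans (sym (e₁ s)) (trans (cong (enc U) e) (e₂ s)) })
      (Def-× (im S) (Def-tabulate-≡ s₁ s₂)))

  opaque
    s-id : ∀ {S} → Simple S S id
    s-id = simple inj₂ λ _ → sym (tabulate∘lookup _)

  opaque
    s→M : ∀ {S T f} → Simple S T f → DefM S T f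
    s→M s = def-≡ˢ (s-∘ s s-proj₁) s-proj₂

  module _ {S T : Sort} where
    opaque
      def-app : ∀ {P f} → DefP T P → DefM S T f → DefP S (λ s → P (f s))
      def-app {P} {f} p m = DefP-resp (λ { s (t , refl , p) → p }) (λ s p → f s , refl , p)
        (def-∃ T (def-× m (pull s-proj₂ p)))

    opaque
      m-const : ∀ c → DefM S T (λ _ → c)
      m-const c = s→M (s-const c)

    opaque
      m-∘ : ∀ {U f g} → DefM T U g → DefM S T f → DefM S U (λ s → g (f s))
      m-∘ {U} {f} {g} dg df = DefP-resp (λ { s (t , refl , p) → p }) (λ (s , u) p → f s , refl , p)
        (def-∃ T (def-× (pull (s-, (s-∘ s-proj₁ s-proj₁) s-proj₂) df) (pull (s-, s-proj₂ (s-∘ s-proj₂ s-proj₁)) dg)))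

    opaque
      m-, : ∀ {U f g} → DefM S T f → DefM S U g → DefM S (T ⊗ U) (λ s → f s , g s)
      m-, df dg = DefP-resp (λ { s (p , q) → cong₂ _,_ p q }) (λ { s refl → refl , refl })
        (def-× (pull (s-, s-proj₁ (s-∘ s-proj₁ s-proj₂)) df) (pull (s-, s-proj₁ (s-∘ s-proj₂ s-proj₂)) dg))

  opaque
    v0 : ∀ {S T} → DefM (S ⊗ T) T proj₂
    v0 = s→M s-proj₂

  opaque
    wk : ∀ {S T U f} → DefM S U f → DefM (S ⊗ T) U (λ st → f (proj₁ st))
    wk m = m-∘ m (s→M s-proj₁)

  opaque
    v1 : ∀ {S T U} → DefM (S ⊗ T ⊗ U) T (λ s → proj₂ (proj₁ s))
    v1 = wk v0

  opaque
    v2 : ∀ {S T U V} → DefM (S ⊗ T ⊗ U ⊗ V) T (λ s → proj₂ (proj₁ (proj₁ s)))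
    v2 = wk v1

  opaque
    v3 : ∀ {S T U V W} → DefM (S ⊗ T ⊗ U ⊗ V ⊗ W) T (λ s → proj₂ (proj₁ (proj₁ (proj₁ s))))
    v3 = wk v2

  opaque
    v4 : ∀ {S T U V W X} → DefM (S ⊗ T ⊗ U ⊗ V ⊗ W ⊗ X) T (λ s → proj₂ (proj₁ (proj₁ (proj₁ (proj₁ s)))))
    v4 = wk v3

  m-id : ∀ {S} → DefM S S id
  m-id = s→M s-id

  u1 : ∀ {S T} → DefM (S ⊗ T) S proj₁
  u1 = s→M s-proj₁

  u2 : ∀ {S T U} → DefM (S ⊗ T ⊗ U) S (λ s → proj₁ (proj₁ s))
  u2 = wk u1

  u3 : ∀ {S T U V} → DefM (S ⊗ T ⊗ U ⊗ V) S (λ s → proj₁ (proj₁ (proj₁ s)))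
  u3 = wk u2

  u4 : ∀ {S T U V W} → DefM (S ⊗ T ⊗ U ⊗ V ⊗ W) S (λ s → proj₁ (proj₁ (proj₁ (proj₁ s))))
  u4 = wk u3

  opaque
    def-≡ : ∀ {S T f g} → DefM S T f → DefM S T g → DefP S (λ s → f s ≡ g s)
    def-≡ {T = T} df dg = def-app {T = T ⊗ T} (def-≡ˢ {U = T} s-proj₁ s-proj₂) (m-, df dg)

  opaque
    m-app₂ : ∀ {S T U V f g} {h : C T → C U → C V} → DefM (T ⊗ U) V (λ tu → h (proj₁ tu) (proj₂ tu)) →
             DefM S T f → DefM S U g → DefM S V (λ s → h (f s) (g s))
    m-app₂ dh df dg = m-∘ dh (m-, df dg)

  opaque
    def-app₂ : ∀ {S T U f g} {R : C T → C U → Set ℓ} → DefP (T ⊗ U) (λ tu → R (proj₁ tu) (proj₂ tu)) →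
               DefM S T f → DefM S U g → DefP S (λ s → R (f s) (g s))
    def-app₂ dR df dg = def-app dR (m-, df dg)

  opaque
    s-∷ : ∀ {n} → Simple (Nₛ ⊗ Vₛ n) (Vₛ (suc n)) (λ av → proj₁ av ∷ proj₂ av)
    s-∷ = simple inj₂ λ _ → sym (tabulate∘lookup _)

  opaque
    s-head : ∀ {n} → Simple (Vₛ (suc n)) Nₛ head
    s-head = simple (λ _ → inj₂ zero) λ { (a ∷ v) → refl }

  opaque
    s-tail : ∀ {n} → Simple (Vₛ (suc n)) (Vₛ n) tail
    s-tail = simple (λ i → inj₂ (suc i)) λ { (a ∷ v) → sym (tabulate∘lookup v) }

  opaque
    s-lookup : ∀ {n} i → Simple (Vₛ n) Nₛ (λ v → lookup v i)
    s-lookup i = simple (λ _ → inj₂ i) λ _ → refl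

  opaque
    s-enc : ∀ {S} → Simple S (Vₛ (dim S)) (enc S)
    s-enc = simple inj₂ λ _ → sym (tabulate∘lookup _)

  opaque
    m-∷ : ∀ {S n f g} → DefM S Nₛ f → DefM S (Vₛ n) g → DefM S (Vₛ (suc n)) (λ s → f s ∷ g s)
    m-∷ df dg = m-∘ (s→M s-∷) (m-, df dg)

  opaque
    m-enc : ∀ {S T f} → DefM S T f → DefM S (Vₛ (dim T)) (λ s → enc T (f s))
    m-enc {T = T} = m-∘ (s→M (s-enc {T}))

  opaque
    def-< : ∀ {S f g} → DefM S Nₛ f → DefM S Nₛ g → DefP S (λ s → f s < g s)
    def-< df dg = def-app {T = Nₛ ⊗ Nₛ}
      (defP (Def-resp (λ { (a ∷ b ∷ []) p → (a , b) , refl , p }) (λ { _ (_ , refl , p) → p })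
        (Def-≺ (inj₂ zero) (inj₂ (suc zero)))))
      (m-, df dg)

  -- Membership is squashed so that the points of a subset are determined by their first component.
  Subₛ : (S : Sort) (P : C S → Set ℓ) → DefP S P → Sort
  Subₛ S P (defP d) = base record
    { C             = Σ (C S) λ s → True (em {P = P s})
    ; enc           = λ s → enc S (proj₁ s)
    ; enc-injective = λ {a} {b} e → lem (enc-injective S e)
    ; im            = Def-resp (λ { v (s , e , p) → (s , fromWitness p) , e }) (λ { v ((s , p) , e) → s , e , toWitness p }) d
    }
    where
      lem : {a b : Σ (C S) λ s → True (em {P = P s})} → proj₁ a ≡ proj₁ b → a ≡ b
      lem {a , p} {.a , q} refl = cong (a ,_) (T-irrelevant p q)

  module _ {S : Sort} {P : C S → Set ℓ} {dP : DefP S P} where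
    sub-≡ : {a b : C (Subₛ S P dP)} → proj₁ a ≡ proj₁ b → a ≡ b
    sub-≡ e = enc-injective (Subₛ S P dP) (cong (enc S) e)

    opaque
      s-incl : Simple (Subₛ S P dP) S proj₁
      s-incl = simple inj₂ λ _ → sym (tabulate∘lookup _)

  opaque
    Def→DefP : ∀ {n} {P : Vec N n → Set ℓ} → Def P → DefP (Vₛ n) P
    Def→DefP d = defP (Def-resp (λ _ p → _ , refl , p) (λ { _ (_ , refl , p) → p }) d)

  -- The unique solution of R s, and t₀ where there is none.
  module Description {S T : Sort} (R : C S → C T → Set ℓ)
                     (dR : DefP (S ⊗ T) (λ st → R (proj₁ st) (proj₂ st))) (t₀ : C T) where
    IsThe : C S → C T → Set ℓ
    IsThe s t = R s t × (∀ t′ → R s t′ → t′ ≡ t)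

    opaque
      the : C S → C T
      the s with em {P = Σ (C T) (IsThe s)}
      ... | yes (t , _) = t
      ... | no  _       = t₀

      the-sat : ∀ s t → R s t → (∀ t′ → R s t′ → t′ ≡ t) → R s (the s)
      the-sat s t r u with em {P = Σ (C T) (IsThe s)}
      ... | yes (t , r , _) = r
      ... | no  f           = ⊥-elim (f (t , r , u))

      the-unique : ∀ s t → R s t → (∀ t′ → R s t′ → t′ ≡ t) → the s ≡ t
      the-unique s t r u = u _ (the-sat s t r u)

      the-def : DefM S T the
      the-def = DefP-resp fwd bwd (def-⊎ (dIs) (def-× (def-¬ (def-∃ T (pull (s-, (s-∘ s-proj₁ s-proj₁) s-proj₂) dIs)))
                                                     (def-≡ (v0 {S} {T}) (m-const t₀))))
        where
          dIs : DefP (S ⊗ T) (λ st → IsThe (proj₁ st) (proj₂ st))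
          dIs = def-× dR (def-∀ T (def-→ (pull (s-, (s-∘ s-proj₁ s-proj₁) s-proj₂) dR) (def-≡ v0 v1)))
          fwd : ∀ st → IsThe (proj₁ st) (proj₂ st) ⊎ (¬ Σ (C T) (IsThe (proj₁ st)) × proj₂ st ≡ t₀) → the (proj₁ st) ≡ proj₂ st
          fwd (s , t) p with em {P = Σ (C T) (IsThe s)} | p
          ... | yes (t′ , r , u) | inj₁ (r′ , u′) = u′ _ r
          ... | yes e | inj₂ (f , _) = ⊥-elim (f e)
          ... | no f | inj₁ q = ⊥-elim (f (t , q))
          ... | no f | inj₂ (_ , e) = sym e
          bwd : ∀ st → the (proj₁ st) ≡ proj₂ st → IsThe (proj₁ st) (proj₂ st) ⊎ (¬ Σ (C T) (IsThe (proj₁ st)) × proj₂ st ≡ t₀)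
          bwd (s , t) p with em {P = Σ (C T) (IsThe s)} | p
          ... | yes (t′ , q) | refl = inj₁ q
          ... | no f | refl = inj₂ (f , refl)

  -- O-minimality in one variable

  by-contra : ∀ {a} {P : Set a} → ¬ ¬ P → P
  by-contra {P = P} f with em {P = P}
  ... | yes p = p
  ... | no ¬p = ⊥-elim (f ¬p)

  -- P holds for all small elements of D; when D has a least element this only concerns that element.
  Initially : (N → N → Set ℓ) → (N → Set ℓ) → (N → Set ℓ) → Set ℓ
  Initially _⊏_ D P = Σ N λ e → D e × (∀ x → D x → ¬ (e ⊏ x) → P x)

  -- The consequences of o-minimality are collected for an abstract order, so that every argument
  -- applies to the reversed order as well. `initially` and `finally` say that definable germs at
  -- the ends of a set are decided, `cut` is definable Dedekind completeness, and `discrete` is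
  -- finiteness of definable sets that contain no interval.
  record LineLaws (_⊏_ : N → N → Set ℓ) : Set (Level.suc ℓ) where
    no-eta-equality
    field
      ⊏-def    : ∀ {S f g} → DefM S Nₛ f → DefM S Nₛ g → DefP S (λ s → f s ⊏ g s)
      ⊏-trans  : ∀ {x y z} → x ⊏ y → y ⊏ z → x ⊏ z
      ⊏-irrefl : ∀ {x} → ¬ (x ⊏ x)
      tri      : ∀ x y → x ⊏ y ⊎ x ≡ y ⊎ y ⊏ x
      dense    : ∀ {x y} → x ⊏ y → Σ N λ z → x ⊏ z × z ⊏ y
      lower-exists : ∀ x → Σ N λ y → y ⊏ x
      upper-exists : ∀ x → Σ N λ y → x ⊏ y
      initially : ∀ {D P} → DefP Nₛ D → DefP Nₛ P → Σ N D → Initially _⊏_ D P ⊎ Initially _⊏_ D (λ x → ¬ P x)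
      finally   : ∀ {D P} → DefP Nₛ D → DefP Nₛ P → Σ N D →
                  Initially (λ x y → y ⊏ x) D P ⊎ Initially (λ x y → y ⊏ x) D (λ x → ¬ P x)
      cut       : ∀ {I} → DefP Nₛ I → (∀ {x y} → x ⊏ y → I y → I x) → Σ N I → Σ N (λ x → ¬ I x) →
                  Σ N λ b → (∀ x → x ⊏ b → I x) × (∀ x → b ⊏ x → ¬ I x)
      discrete  : ∀ {P} → DefP Nₛ P → (∀ a b → a ⊏ b → ¬ (∀ x → a ⊏ x → x ⊏ b → P x)) →
                  Σ (List N) λ xs → ∀ x → P x → Any (x ≡_) xs

  record Line : Set (Level.suc ℓ) where
    infix 4 _⊏_
    field
      _⊏_  : N → N → Set ℓ
      laws : LineLaws _⊏_
    open LineLaws laws public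

  opaque
    flip-laws : ∀ {_⊏_} → LineLaws _⊏_ → LineLaws (λ x y → y ⊏ x)
    flip-laws {_⊏_} O = record
      { ⊏-def = λ f g → ⊏-def g f ; ⊏-trans = λ p q → ⊏-trans q p
      ; ⊏-irrefl = ⊏-irrefl ; tri = tri′ ; dense = λ p → let (z , q , r) = dense p in z , r , q
      ; lower-exists = upper-exists ; upper-exists = lower-exists ; initially = finally ; finally = initially
      -- A set closed downwards in the reversed order is the complement of one closed downwards in
      -- the original order.
      ; cut = λ {I} dI down (x , i) (y , ¬i) →
          let (b , lo , hi) = cut (def-¬ dI) (λ {x} {y} p ¬iy ix → ¬iy (down p ix)) (y , ¬i) (x , λ ¬ix → ¬ix i) in
          b , (λ x p → by-contra (hi x p)) , (λ x p → lo x p)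
      ; discrete = λ dP h → discrete dP (λ a b p f → h b a p (λ x q r → f x r q)) }
      where
        open LineLaws O
        tri′ : ∀ x y → y ⊏ x ⊎ x ≡ y ⊎ x ⊏ y
        tri′ x y with tri x y
        ... | inj₁ p        = inj₂ (inj₂ p)
        ... | inj₂ (inj₁ p) = inj₂ (inj₁ p)
        ... | inj₂ (inj₂ p) = inj₁ p

  flip : Line → Line
  flip O = record { _⊏_ = λ x y → Line._⊏_ O y x ; laws = flip-laws (Line.laws O) }

  module _ where
    open import Relation.Binary.Structures using (IsDenseLinearOrder)
    open import Relation.Binary.Definitions using (tri<; tri≈; tri>)
    import Relation.Binary.Construct.Add.Extrema.Strict as Strict
    import Relation.Binary.Construct.Add.Supremum.Strict as Sup
    open Strict (_<_) using (_<±_; <±-trans) public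
    open IsOMinimal om
    open IsDenseLinearOrder isDenseLinearOrder using (compare) renaming (trans to <-trans; irrefl to <-irr; dense to <-dense)

    [_]<± : ∀ {a b} → a < b → ⟨ a ⟩ <± ⟨ b ⟩
    [ p ]<± = Strict.[ p ]

    un<± : ∀ {a b} → ⟨ a ⟩ <± ⟨ b ⟩ → a < b
    un<± = Strict.[<]-injective _<_

    left± : ∀ a {x} → a <± ⟨ x ⟩ → Σ N λ y → a <± ⟨ y ⟩ × y < x
    left± ⊥± {x} _ = let (y , p) = noLeast x in y , Strict.⊥±<[ y ] , p
    left± ⟨ b ⟩ p = let (y , q , r) = <-dense (un<± p) in y , [ q ]<± , r
    left± ⊤± ()

    above±-def : ∀ a → DefP Nₛ (λ x → a <± ⟨ x ⟩)
    above±-def ⊥± = DefP-resp (λ _ _ → Strict.⊥±<[ _ ]) (λ _ _ → lift tt) def-⊤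
    above±-def ⟨ b ⟩ = DefP-resp (λ _ → [_]<±) (λ _ → un<±) (def-< (m-const b) m-id)
    above±-def ⊤± = DefP-resp (λ _ ()) (λ { _ () }) def-⊥

    <±-<-trans : ∀ {a x y} → a <± ⟨ x ⟩ → x < y → a <± ⟨ y ⟩
    <±-<-trans p q = <±-trans <-trans p [ q ]<±

    private
      cmp< : ∀ x y → x < y ⊎ x ≡ y ⊎ y < x
      cmp< x y with compare x y
      ... | tri< a _ _ = inj₁ a
      ... | tri≈ _ a _ = inj₂ (inj₁ a)
      ... | tri> _ _ a = inj₂ (inj₂ a)

      cmp> : ∀ x y → y < x ⊎ x ≡ y ⊎ x < y
      cmp> x y with compare x y
      ... | tri< a _ _ = inj₂ (inj₂ a)
      ... | tri≈ _ a _ = inj₂ (inj₁ a)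
      ... | tri> _ _ a = inj₁ a

      trans± : ∀ {a b c} → a <± b → b <± c → a <± c
      trans± = <±-trans <-trans

      ≤-trans± : ∀ {a x y} → a <± ⟨ x ⟩ → ¬ (y < x) → a <± ⟨ y ⟩
      ≤-trans± {a} {x} {y} p q with cmp< x y
      ... | inj₁ r           = trans± p [ r ]<±
      ... | inj₂ (inj₁ refl) = p
      ... | inj₂ (inj₂ r)    = ⊥-elim (q r)

      ≤-trans±′ : ∀ {b x y} → ⟨ x ⟩ <± b → ¬ (x < y) → ⟨ y ⟩ <± b
      ≤-trans±′ {a} {x} {y} p q with cmp< x y
      ... | inj₁ r           = ⊥-elim (q r)
      ... | inj₂ (inj₁ refl) = p
      ... | inj₂ (inj₂ r)    = trans± [ r ]<± p

      convex : ∀ p {x y z} → _∈ᵖ_ 𝓝 x p → _∈ᵖ_ 𝓝 y p → ¬ (z < x) → ¬ (y < z) → _∈ᵖ_ 𝓝 z p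
      convex (point c) {x} {y} {z} refl refl p q with cmp< z x
      ... | inj₁ r = ⊥-elim (p r)
      ... | inj₂ (inj₁ e) = e
      ... | inj₂ (inj₂ r) = ⊥-elim (q r)
      convex (interval a b) (p , _) (_ , q) r s = ≤-trans± p r , ≤-trans±′ q s

      opaque
        pieces : ∀ {P} → DefP Nₛ P → Σ (List (Piece 𝓝)) λ ps → ∀ x → P x ⇔ Any (_∈ᵖ_ 𝓝 x) ps
        pieces {P} (defP d) = oMinimal P (Def⇒Definable (Def-resp (λ { _ (_ , refl , p) → p }) (λ { (a ∷ []) p → a , refl , p }) d))

      module Coinitial (_⊏_ : N → N → Set ℓ) (tr : ∀ {x y z} → x ⊏ y → y ⊏ z → x ⊏ z) (irr : ∀ {x} → ¬ (x ⊏ x))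
                       (tri : ∀ x y → x ⊏ y ⊎ x ≡ y ⊎ y ⊏ x)
                       (conv : ∀ p {x y z} → _∈ᵖ_ 𝓝 x p → _∈ᵖ_ 𝓝 y p → ¬ (z ⊏ x) → ¬ (y ⊏ z) → _∈ᵖ_ 𝓝 z p)
                       (D : N → Set ℓ) where
        Coinit : (N → Set ℓ) → Set ℓ
        Coinit Z = ∀ e → D e → Σ N λ x → ¬ (e ⊏ x) × Z x

        ⊑-trans : ∀ {x y z} → ¬ (y ⊏ x) → ¬ (z ⊏ y) → ¬ (z ⊏ x)
        ⊑-trans {x} {y} {z} p q r with tri x y
        ... | inj₁ s           = q (tr r s)
        ... | inj₂ (inj₁ refl) = q r
        ... | inj₂ (inj₂ s)    = p s

        -- If the first piece is not coinitial, it is missed below some point of `D`, and below that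
        -- point the remaining pieces have to do all the work.
        coinitial-piece : ∀ ps → Σ N D → Coinit (λ x → Any (_∈ᵖ_ 𝓝 x) ps) →
                          Σ (Piece 𝓝) λ p → (∀ x → _∈ᵖ_ 𝓝 x p → Any (_∈ᵖ_ 𝓝 x) ps) × Coinit (λ x → _∈ᵖ_ 𝓝 x p)
        coinitial-piece [] (d , Dd) c with () ← proj₂ (proj₂ (c d Dd))
        coinitial-piece (p ∷ ps) d c with em {P = Coinit (λ x → _∈ᵖ_ 𝓝 x p)}
        ... | yes q = p , (λ _ → here) , q
        ... | no nq with coinitial-piece ps d c′
          where
            bad : Σ N λ e → D e × (∀ x → ¬ (e ⊏ x) → ¬ _∈ᵖ_ 𝓝 x p)
            bad = by-contra λ f → nq λ e De → by-contra λ g → f (e , De , λ x q z → g (x , q , z))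
            least : ∀ e → D e → Σ N λ m → D m × ¬ (e ⊏ m) × ¬ (proj₁ bad ⊏ m)
            least e De with em {P = proj₁ bad ⊏ e}
            ... | no r  = e , De , irr , r
            ... | yes r = proj₁ bad , proj₁ (proj₂ bad) , (λ q → irr (tr q r)) , irr
            c′ : Coinit (λ x → Any (_∈ᵖ_ 𝓝 x) ps)
            c′ e De with least e De
            ... | m , Dm , m⊑e , m⊑b with c m Dm
            ... | x , x⊑m , here z  = ⊥-elim (proj₂ (proj₂ bad) x (⊑-trans x⊑m m⊑b) z)
            ... | x , x⊑m , there z = x , ⊑-trans x⊑m m⊑e , z
        ... | p′ , sub , q = p′ , (λ x → there ∘ sub x) , q

        initial-part : ∀ {P} → DefP Nₛ P → Σ N D → Coinit P →
                       Σ (Piece 𝓝) λ p → (∀ x → _∈ᵖ_ 𝓝 x p → P x) × Coinit (λ x → _∈ᵖ_ 𝓝 x p)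
        initial-part dP d c with pieces dP
        ... | ps , e with coinitial-piece ps d (λ e′ De → map₂ (map₂ (to (e _))) (c e′ De))
        ... | p , sub , q = p , (λ x z → from (e x) (sub x z)) , q

        -- A coinitial piece inside `D` and `P` is convex, hence it swallows every point of `D`
        -- below any one of its own points.
        initially′ : ∀ {P} → DefP Nₛ D → DefP Nₛ P → Σ N D → Initially _⊏_ D P ⊎ Initially _⊏_ D (λ x → ¬ P x)
        initially′ {P} dD dP d with em {P = Coinit (λ x → D x × P x)}
        ... | no n = inj₂ (by-contra λ f → n λ e De → by-contra λ g → f (e , De , λ x Dx q Px → g (x , q , Dx , Px)))
        ... | yes c with initial-part (def-× dD dP) d c
        ... | p , sub , q with q (proj₁ d) (proj₂ d)
        ... | x₀ , _ , z₀ = inj₁ (x₀ , proj₁ (sub x₀ z₀) , λ x Dx r →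
                let (y , y⊑x , z) = q x Dx in proj₂ (sub x (conv p z z₀ y⊑x r)))

      module Down = Coinitial _<_ <-trans (<-irr refl) cmp< convex
      module Up   = Coinitial (λ x y → y < x) (λ p q → <-trans q p) (<-irr refl)
                      cmp> (λ p a b q r → convex p b a r q)

      interval-empty : ∀ {P : N → Set ℓ} {a b} → (∀ u v → u < v → ¬ (∀ x → u < x → x < v → P x)) →
                       (∀ x → Interval 𝓝 a b x → P x) → ∀ x → ¬ Interval 𝓝 a b x
      interval-empty {b = b} h sub x (p , q) with above b q
        where
          above : ∀ b → ⟨ x ⟩ <± b → Σ N λ y → x < y × ⟨ y ⟩ <± b
          above ⊤± _ = let (y , r) = noGreatest x in y , r , Sup.[ _ ]<⊤⁺
          above ⟨ b ⟩ q = let (y , r , s) = <-dense (un<± q) in y , r , [ s ]<±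
          above ⊥± Sup.[ () ]
      ... | y , r , s = h x y r λ z u v → sub z (trans± p [ u ]<± , trans± [ v ]<± s)

      discrete′ : ∀ {P : N → Set ℓ} ps → (∀ u v → u < v → ¬ (∀ x → u < x → x < v → P x)) → (∀ x → Any (_∈ᵖ_ 𝓝 x) ps → P x) →
                  Σ (List N) λ xs → ∀ x → Any (_∈ᵖ_ 𝓝 x) ps → Any (x ≡_) xs
      discrete′ [] h sub = [] , λ _ ()
      discrete′ {P} (point c ∷ ps) h sub with discrete′ {P} ps h (λ x → sub x ∘ there)
      ... | xs , g = c ∷ xs , λ { x (here e) → here e ; x (there z) → there (g x z) }
      discrete′ {P} (interval a b ∷ ps) h sub with discrete′ {P} ps h (λ x → sub x ∘ there)
      ... | xs , g = xs , λ { x (here i) → ⊥-elim (interval-empty {P} {a} {b} h (λ y → sub y ∘ here) x i) ; x (there z) → g x z }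

      -- The cut is the right end of a piece that is cofinal in `I`. This end is a point of `N`,
      -- since an interval reaching `⊤±` would leave no room for a point outside of `I`.
      cut′ : ∀ {I} → DefP Nₛ I → (∀ {x y} → x < y → I y → I x) → Σ N I → Σ N (λ x → ¬ I x) →
             Σ N λ b → (∀ x → x < b → I x) × (∀ x → b < x → ¬ I x)
      cut′ {I} dI down i₀ (y , ¬Iy) with Up.initial-part I dI i₀ (λ e Ie → e , <-irr refl , Ie)
      ... | point c , sub , co = c , (λ x p → down p (sub c refl)) , λ x p Ix → lem (co x Ix) p
        where lem : ∀ {x} → (Σ N λ z → ¬ (z < x) × z ≡ c) → ¬ (c < x)
              lem (z , q , refl) = q
      ... | interval a b , sub , co with co (proj₁ i₀) (proj₂ i₀)
      ... | x₀ , _ , (ax₀ , x₀b) = lem b x₀b sub co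
        where
          lem : ∀ b → ⟨ x₀ ⟩ <± b → (∀ x → Interval 𝓝 a b x → I x) → Up.Coinit I (Interval 𝓝 a b) →
                Σ N λ b → (∀ x → x < b → I x) × (∀ x → b < x → ¬ I x)
          lem ⊥± Sup.[ () ]
          lem ⊤± _ sub _ with em {P = x₀ < y}
          ... | yes p = ⊥-elim (¬Iy (sub y (trans± ax₀ [ p ]<± , Sup.[ _ ]<⊤⁺)))
          ... | no p with cmp< y x₀
          ...   | inj₁ q = ⊥-elim (¬Iy (down q (sub x₀ (ax₀ , Sup.[ _ ]<⊤⁺))))
          ...   | inj₂ (inj₁ refl) = ⊥-elim (¬Iy (sub x₀ (ax₀ , Sup.[ _ ]<⊤⁺)))
          ...   | inj₂ (inj₂ q) = ⊥-elim (p q)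
          lem ⟨ β ⟩ x₀β sub co = β , low , λ x p Ix → high x p (co x Ix)
            where
              low : ∀ x → x < β → I x
              low x p with cmp< x x₀
              ... | inj₁ q = down q (sub x₀ (ax₀ , x₀β))
              ... | inj₂ (inj₁ refl) = sub x₀ (ax₀ , x₀β)
              ... | inj₂ (inj₂ q) = sub x (trans± ax₀ [ q ]<± , [ p ]<±)
              high : ∀ x → β < x → ¬ (Σ N λ z → ¬ (z < x) × Interval 𝓝 a ⟨ β ⟩ z)
              high x p (z , q , _ , r) = q (<-trans (un<± r) p)

    opaque
      <-laws : LineLaws _<_
      <-laws = record
        { ⊏-def = def-< ; ⊏-trans = <-trans ; ⊏-irrefl = <-irr refl ; tri = cmp< ; dense = <-dense
        ; lower-exists = noLeast ; upper-exists = noGreatest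
        ; initially = Down.initially′ _ ; finally = Up.initially′ _ ; cut = cut′
        ; discrete = λ {P} dP h → let (ps , e) = pieces dP ; (xs , g) = discrete′ {P} ps h (λ x → from (e x)) in
                                  xs , λ x p → g x (to (e x) p) }

    line : Line
    line = record { _⊏_ = _<_ ; laws = <-laws }

    -- The two possible shapes of the coinitial piece of `D`. The end `a` may be infinite, which is
    -- why it lives in `N ±`; curves will be parametrised by such intervals.
    initial-interval : ∀ {D} → DefP Nₛ D → Σ N D →
      (Σ N λ m → D m × (∀ x → D x → ¬ (x < m))) ⊎
      (Σ (N ±) λ a → Σ N λ e → a <± ⟨ e ⟩ × D e × (∀ x → a <± ⟨ x ⟩ → ¬ (e < x) → D x) × (∀ x → D x → a <± ⟨ x ⟩))
    initial-interval {D} dD d with Down.initial-part D dD d (λ e De → e , <-irr refl , De)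
    ... | point c , sub , co = inj₁ (c , sub c refl , λ x Dx p → lem (co x Dx) p)
      where lem : ∀ {x} → (Σ N λ z → ¬ (x < z) × z ≡ c) → ¬ (x < c)
            lem (z , q , refl) = q
    ... | interval a b , sub , co with co (proj₁ d) (proj₂ d)
    ... | e , _ , (ae , eb) = inj₂ (a , e , ae , sub e (ae , eb) , (λ x p q → sub x (p , ≤-trans±′ eb q)) ,
            λ x Dx → let (z , q , (r , _)) = co x Dx in ≤-trans± r q)

  -- Monotonicity

  module LineLemmas (O : Line) where
    open Line O

    Ioo : N → N → N → Set ℓ
    Ioo a b x = a ⊏ x × x ⊏ b

    ioo-def : ∀ {S f g h} → DefM S Nₛ f → DefM S Nₛ g → DefM S Nₛ h → DefP S (λ s → Ioo (f s) (g s) (h s))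
    ioo-def a b x = def-× (⊏-def a x) (⊏-def x b)

    ⊑⊏ : ∀ {x y z} → ¬ (y ⊏ x) → y ⊏ z → x ⊏ z
    ⊑⊏ {x} {y} p q with tri x y
    ... | inj₁ r           = ⊏-trans r q
    ... | inj₂ (inj₁ refl) = q
    ... | inj₂ (inj₂ r)    = ⊥-elim (p r)

    ⊏⊑ : ∀ {x y z} → x ⊏ y → ¬ (z ⊏ y) → x ⊏ z
    ⊏⊑ {x} {y} {z} p q with tri y z
    ... | inj₁ r           = ⊏-trans p r
    ... | inj₂ (inj₁ refl) = p
    ... | inj₂ (inj₂ r)    = ⊥-elim (q r)

    asym : ∀ {x y} → x ⊏ y → ¬ (y ⊏ x)
    asym p q = ⊏-irrefl (⊏-trans p q)

    opaque
      between₂ : ∀ {x y z} → x ⊏ z → y ⊏ z → Σ N λ m → x ⊏ m × y ⊏ m × m ⊏ z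
      between₂ {x} {y} p q with tri x y
      ... | inj₁ r           = let (m , s , t) = dense q in m , ⊏-trans r s , s , t
      ... | inj₂ (inj₁ refl) = let (m , s , t) = dense q in m , s , s , t
      ... | inj₂ (inj₂ r)    = let (m , s , t) = dense p in m , s , ⊏-trans r s , t

    Onʳ : N → N → (N → Set ℓ) → Set ℓ
    Onʳ a b P = ∀ x → a ⊏ x → x ⊏ b → P x

    opaque
      germʳ : ∀ {P a b} → DefP Nₛ P → a ⊏ b → Σ N λ c → a ⊏ c × c ⊏ b × (Onʳ a c P ⊎ Onʳ a c (λ x → ¬ P x))
      germʳ {P} {a} {b} dP p with initially (ioo-def (m-const a) (m-const b) m-id) dP (dense p)
      ... | inj₁ (c , (q , r) , h) = c , q , r , inj₁ λ x s t → h x (s , ⊏-trans t r) (asym t)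
      ... | inj₂ (c , (q , r) , h) = c , q , r , inj₂ λ x s t → h x (s , ⊏-trans t r) (asym t)

    opaque
      germˡ : ∀ {P a b} → DefP Nₛ P → a ⊏ b → Σ N λ c → a ⊏ c × c ⊏ b × (Onʳ c b P ⊎ Onʳ c b (λ x → ¬ P x))
      germˡ {P} {a} {b} dP p with finally (ioo-def (m-const a) (m-const b) m-id) dP (dense p)
      ... | inj₁ (c , (q , r) , h) = c , q , r , inj₁ λ x s t → h x (⊏-trans q s , t) (asym s)
      ... | inj₂ (c , (q , r) , h) = c , q , r , inj₂ λ x s t → h x (⊏-trans q s , t) (asym s)

    opaque
      pigeonʳ : ∀ {P Q a b} → DefP Nₛ P → a ⊏ b → Onʳ a b (λ x → P x ⊎ Q x) →
                Σ N λ c → a ⊏ c × c ⊏ b × (Onʳ a c P ⊎ Onʳ a c Q)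
      pigeonʳ dP p h with germʳ dP p
      ... | c , q , r , inj₁ f = c , q , r , inj₁ f
      ... | c , q , r , inj₂ f = c , q , r , inj₂ λ x s t →
              [ (λ z → ⊥-elim (f x s t z)) , id ]′ (h x s (⊏-trans t r))

    Loc : (N → N → Set ℓ) → N → Set ℓ
    Loc R x = Σ N λ l → Σ N λ r → l ⊏ x × x ⊏ r × Onʳ l x (λ y → R y x) × Onʳ x r (R x)

    loc-def : ∀ {R : N → N → Set ℓ} → DefP (Nₛ ⊗ Nₛ) (λ xy → R (proj₁ xy) (proj₂ xy)) → DefP Nₛ (Loc R)
    loc-def {R} dR = def-∃ Nₛ (def-∃ Nₛ (def-× (⊏-def v1 u2) (def-× (⊏-def u2 v0) (def-×
      (def-∀ Nₛ (def-→ (⊏-def v2 v0) (def-→ (⊏-def v0 u3) (def-app₂ {R = R} dR v0 u3))))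
      (def-∀ Nₛ (def-→ (⊏-def u3 v0) (def-→ (⊏-def v0 v1) (def-app₂ {R = R} dR u3 v0))))))))

    opaque
      -- Continuous induction: let `β` be the supremum of the points up to which `R x` holds. The
      -- local relation on the left of `β` gives `R x β`, the one on the right carries `R x` beyond
      -- `β`, against the choice of `β`.
      local→global : ∀ {R : N → N → Set ℓ} → DefP (Nₛ ⊗ Nₛ) (λ xy → R (proj₁ xy) (proj₂ xy)) →
                     (∀ {x y z} → R x y → R y z → R x z) → ∀ {a b} → Onʳ a b (Loc R) →
                     ∀ x z → a ⊏ x → x ⊏ z → z ⊏ b → R x z
      local→global {R} dR R-trans {a} {b} loc x z ax xz zb = by-contra λ ¬Rxz → contradiction (cutI ¬Rxz)
        where
          I : N → Set ℓ
          I y = ∀ w → x ⊏ w → ¬ (y ⊏ w) → R x w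
          dI : DefP Nₛ I
          dI = def-∀ Nₛ (def-→ (⊏-def (m-const x) v0) (def-→ (def-¬ (⊏-def u1 v0)) (def-app₂ {R = R} dR (m-const x) v0)))
          cutI : ¬ R x z → Σ N λ β → (∀ y → y ⊏ β → I y) × (∀ y → β ⊏ y → ¬ I y) × ¬ I z
          cutI n = let (β , p , q) = cut dI (λ p Iy w xw q → Iy w xw λ r → q (⊏-trans p r))
                                       (x , λ w p q → ⊥-elim (q p)) (z , λ Iz → n (Iz z xz ⊏-irrefl))
                   in β , p , q , λ Iz → n (Iz z xz ⊏-irrefl)
          contradiction : ¬ (Σ N λ β → (∀ y → y ⊏ β → I y) × (∀ y → β ⊏ y → ¬ I y) × ¬ I z)
          contradiction (β , low , high , ¬Iz) with loc x ax (⊏-trans xz zb)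
          ... | _ , r , _ , xr , _ , right = high t βt λ w xw t⊏w → caseof w xw t⊏w (tri w β)
            where
              xβ : x ⊏ β
              xβ = ⊏⊑ xr λ βr → let (y , p , q) = dense βr in
                     high y p λ w xw ¬yw → right w xw (⊑⊏ ¬yw q)
              β⊑z : ¬ (z ⊏ β)
              β⊑z zβ = ¬Iz (low z zβ)
              locβ : Loc R β
              locβ = loc β (⊏-trans ax xβ) (⊑⊏ β⊑z zb)
              l′ r′ : N
              l′ = proj₁ locβ
              r′ = proj₁ (proj₂ locβ)
              l′β : l′ ⊏ β
              l′β = proj₁ (proj₂ (proj₂ locβ))
              βr′ : β ⊏ r′
              βr′ = proj₁ (proj₂ (proj₂ (proj₂ locβ)))
              leftβ : Onʳ l′ β (λ y → R y β)
              leftβ = proj₁ (proj₂ (proj₂ (proj₂ (proj₂ locβ))))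
              rightβ : Onʳ β r′ (R β)
              rightβ = proj₂ (proj₂ (proj₂ (proj₂ (proj₂ locβ))))
              Rxβ : R x β
              Rxβ = let (y , p , q , s) = between₂ xβ l′β in R-trans (low y s y p ⊏-irrefl) (leftβ y q s)
              t : N
              t = proj₁ (dense βr′)
              βt : β ⊏ t
              βt = proj₁ (proj₂ (dense βr′))
              tr′ : t ⊏ r′
              tr′ = proj₂ (proj₂ (dense βr′))
              caseof : ∀ w → x ⊏ w → ¬ (t ⊏ w) → w ⊏ β ⊎ w ≡ β ⊎ β ⊏ w → R x w
              caseof w xw tw (inj₁ p) = low w p w xw ⊏-irrefl
              caseof w xw tw (inj₂ (inj₁ refl)) = Rxβ
              caseof w xw tw (inj₂ (inj₂ p)) = R-trans Rxβ (rightβ w p (⊑⊏ tw tr′))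

  module Extremum (O O′ : Line) (f : N → N) (df : DefM Nₛ Nₛ f) where
    open Line O
    open LineLemmas O
    open Line O′ using () renaming (_⊏_ to _⊏′_)
    private
      module O′ = Line O′
      module O′L = LineLemmas O′

    LocMin : N → Set ℓ
    LocMin x = Σ N λ l → Σ N λ r → l ⊏ x × x ⊏ r × Onʳ l x (λ y → f x ⊏′ f y) × Onʳ x r (λ y → f x ⊏′ f y)

    Drop : N → Set ℓ
    Drop z = Σ N λ l → Σ N λ r → l ⊏ z × z ⊏ r × (∀ y w → l ⊏ y → y ⊏ z → z ⊏ w → w ⊏ r → f w ⊏′ f y)

    opaque
      drop-def : DefP Nₛ Drop
      drop-def = def-∃ Nₛ (def-∃ Nₛ (def-× (⊏-def v1 u2) (def-× (⊏-def u2 v0) (def-∀ Nₛ (def-∀ Nₛ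
        (def-→ (⊏-def v3 v1) (def-→ (⊏-def v1 u4) (def-→ (⊏-def u4 v0) (def-→ (⊏-def v0 v2)
          (O′.⊏-def (m-∘ df v0) (m-∘ df v1))))))))))) 

    opaque
      -- Near `b` no value `f c` lies below all later values, since otherwise `f` would increase
      -- there and have no local minima. Fix such a `c`. If values near `b` exceeded `f c`, then at
      -- the infimum `d` of the points after which this holds, either `f d` would lie below all
      -- later values or the local minimum at `d` would push the infimum further left. So values
      -- near `b` do not exceed `f c`, whereas those just right of `c` do, and the last change is a
      -- drop.
      drop-exists : ∀ {a b} → a ⊏ b → Onʳ a b LocMin → Σ N λ z → a ⊏ z × z ⊏ b × Drop z
      drop-exists {a} {b} ab min = main (germˡ dB ab)
        where
          B : N → Set ℓ
          B c = Onʳ c b λ y → f c ⊏′ f y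
          dB : DefP Nₛ B
          dB = def-∀ Nₛ (def-→ (⊏-def u1 v0) (def-→ (⊏-def v0 (m-const b)) (O′.⊏-def (m-∘ df u1) (m-∘ df v0))))
          module At (a′ : N) (aa′ : a ⊏ a′) (a′b : a′ ⊏ b) (¬B : Onʳ a′ b (λ x → ¬ B x)) where
            c : N
            c = proj₁ (dense a′b)
            a′c : a′ ⊏ c
            a′c = proj₁ (proj₂ (dense a′b))
            cb : c ⊏ b
            cb = proj₂ (proj₂ (dense a′b))
            R : N → Set ℓ
            R y = f c ⊏′ f y
            dR : DefP Nₛ R
            dR = O′.⊏-def (m-const (f c)) df
            -- Both cases cut at the infimum `d` of the points after which `Z` holds up to `b`. The
            -- clause `c ⊏ y` in `All` disregards everything left of `c`, and `start` keeps `d` from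
            -- falling below `c`.
            module Tail (Z : N → Set ℓ) (dZ : DefP Nₛ Z) (e : N) (ce : c ⊏ e) (eb : e ⊏ b) (ev : Onʳ e b Z)
                        (start : ¬ (∀ y → c ⊏ y → y ⊏ b → Z y)) where
              All : N → Set ℓ
              All d = ∀ y → d ⊏ y → y ⊏ b → c ⊏ y → Z y
              dAll : DefP Nₛ All
              dAll = def-∀ Nₛ (def-→ (⊏-def u1 v0) (def-→ (⊏-def v0 (m-const b)) (def-→ (⊏-def (m-const c) v0) (def-app dZ v0))))
              theCut : Σ N λ d → (∀ x → x ⊏ d → ¬ All x) × (∀ x → d ⊏ x → ¬ ¬ All x)
              theCut = cut (def-¬ dAll) (λ p n A → n λ y q → A y (⊏-trans p q))
                           (c , λ A → start λ y p q → A y p q p) (e , λ n → n λ y p q _ → ev y p q)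
              d : N
              d = proj₁ theCut
              below : ∀ x → x ⊏ d → ¬ All x
              below = proj₁ (proj₂ theCut)
              alld : All d
              alld y dy yb cy = let (w , p , q) = dense dy in by-contra λ n → proj₂ (proj₂ theCut) w p λ A → n (A y q yb cy)
              c⊑d : ¬ (d ⊏ c)
              c⊑d p = proj₂ (proj₂ theCut) c p λ A → start λ y p q → A y p q p
              db : d ⊏ b
              db = ⊑⊏ (λ ed → below e ed λ y p q _ → ev y p q) eb

            case-R : ∀ e → c ⊏ e → e ⊏ b → Onʳ e b R → ⊥
            case-R e ce eb ev = final (tri c d)
              where
                open Tail R dR e ce eb ev (¬B c a′c cb)
                final : c ⊏ d ⊎ c ≡ d ⊎ d ⊏ c → ⊥
                final (inj₂ (inj₂ p)) = c⊑d p
                final (inj₂ (inj₁ c≡d)) = ¬B c a′c cb λ y p q → alld y (subst (_⊏ y) c≡d p) q p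
                final (inj₁ cd) with em {P = R d}
                ... | no n = ¬B d (⊏-trans a′c cd) db λ y p q → O′L.⊑⊏ n (alld y p q (⊏-trans cd p))
                ... | yes Rd with min d (⊏-trans aa′ (⊏-trans a′c cd)) db
                ... | l , r , ld , dr , left , right =
                  let (y , p , q , s) = between₂ ld cd in
                  below y s λ w yw wb cw → sub y p w yw wb cw (tri w d)
                  where
                    sub : ∀ y → l ⊏ y → ∀ w → y ⊏ w → w ⊏ b → c ⊏ w → w ⊏ d ⊎ w ≡ d ⊎ d ⊏ w → R w
                    sub y p w yw wb cw (inj₁ q) = O′.⊏-trans Rd (left w (⊏-trans p yw) q)
                    sub y p w yw wb cw (inj₂ (inj₁ refl)) = Rd
                    sub y p w yw wb cw (inj₂ (inj₂ q)) = alld w q wb cw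

            case-¬R : ∀ e → c ⊏ e → e ⊏ b → Onʳ e b (λ x → ¬ R x) → Σ N λ z → a ⊏ z × z ⊏ b × Drop z
            case-¬R e ce eb ev with min c (⊏-trans aa′ a′c) cb
            ... | _ , r , _ , cr , _ , right = d , ad , db , drop (germˡ dR cd)
              where
                w : Σ N λ w → c ⊏ w × w ⊏ r × w ⊏ b
                w with tri r b
                ... | inj₁ p = let (w , q , s) = dense cr in w , q , s , ⊏-trans s p
                ... | inj₂ (inj₁ refl) = let (w , q , s) = dense cr in w , q , s , s
                ... | inj₂ (inj₂ p) = let (w , q , s) = dense cb in w , q , ⊏-trans s p , s
                w₁ : N
                w₁ = proj₁ w
                cw : c ⊏ w₁
                cw = proj₁ (proj₂ w)
                wr : w₁ ⊏ r
                wr = proj₁ (proj₂ (proj₂ w))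
                wb : w₁ ⊏ b
                wb = proj₂ (proj₂ (proj₂ w))
                open Tail (λ x → ¬ R x) (def-¬ dR) e ce eb ev (λ h → h w₁ cw wb (right w₁ cw wr))
                cd : c ⊏ d
                cd = let (m , p , q) = dense cw in ⊏⊑ p λ dm →
                       proj₂ (proj₂ theCut) m dm λ A → A w₁ q wb cw (right w₁ cw wr)
                ad : a ⊏ d
                ad = ⊏-trans aa′ (⊏-trans a′c cd)
                drop : (Σ N λ g → c ⊏ g × g ⊏ d × (Onʳ g d R ⊎ Onʳ g d (λ x → ¬ R x))) → Drop d
                drop (g , cg , gd , inj₁ h) = g , b , gd , db , λ y w p q s t →
                  O′L.⊑⊏ (alld w s t (⊏-trans cd s)) (h y p q)
                drop (g , cg , gd , inj₂ h) = ⊥-elim (below g gd λ y p q s → sub y p q s (tri y d))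
                  where
                    ¬Rd : ¬ R d
                    ¬Rd Rd with min d ad db
                    ... | _ , r , _ , dr , _ , right with between₂′ dr db
                      where
                        between₂′ : ∀ {x y z} → z ⊏ x → z ⊏ y → Σ N λ m → z ⊏ m × m ⊏ x × m ⊏ y
                        between₂′ {x} {y} p q with tri x y
                        ... | inj₁ s           = let (m , t , u) = dense p in m , t , u , ⊏-trans u s
                        ... | inj₂ (inj₁ refl) = let (m , t , u) = dense p in m , t , u , u
                        ... | inj₂ (inj₂ s)    = let (m , t , u) = dense q in m , t , ⊏-trans u s , u
                    ... | m , p , q , s = alld m p s (⊏-trans cd p) (O′.⊏-trans Rd (right m p q))
                    sub : ∀ y → g ⊏ y → y ⊏ b → c ⊏ y → y ⊏ d ⊎ y ≡ d ⊎ d ⊏ y → ¬ R y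
                    sub y p q s (inj₁ t) = h y p t
                    sub y p q s (inj₂ (inj₁ refl)) = ¬Rd
                    sub y p q s (inj₂ (inj₂ t)) = alld y t q s

            result : Σ N λ z → a ⊏ z × z ⊏ b × Drop z
            result with germˡ dR cb
            ... | e , ce , eb , inj₁ h = ⊥-elim (case-R e ce eb h)
            ... | e , ce , eb , inj₂ h = case-¬R e ce eb h

          main : (Σ N λ c → a ⊏ c × c ⊏ b × (Onʳ c b B ⊎ Onʳ c b (λ x → ¬ B x))) → Σ N λ z → a ⊏ z × z ⊏ b × Drop z
          main (a′ , aa′ , a′b , inj₂ h) = At.result a′ aa′ a′b h
          main (a′ , aa′ , a′b , inj₁ h) =
            let (c , a′c , cb) = dense a′b
                (l , r , lc , cr , left , right) = min c (⊏-trans aa′ a′c) cb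
                (y , p , q , s) = between₂ lc a′c
            in ⊥-elim (O′L.asym (left y p s) (h y q (⊏-trans s cb) c s cb))

  -- Points with a drop and points with a rise would both be dense.
  opaque
    no-local-minima : ∀ (O O′ : Line) f (df : DefM Nₛ Nₛ f) → let open Line O in
                      ∀ {a b} → a ⊏ b → ¬ (∀ x → a ⊏ x → x ⊏ b → Extremum.LocMin O O′ f df x)
    no-local-minima O O′ f df {a} {b} ab min with LineLemmas.germʳ O (Extremum.drop-def O O′ f df) ab
    ... | c , ac , cb , inj₂ h =
          let open Line O
              (z , p , q , d) = Extremum.drop-exists O O′ f df ac (λ x p q → min x p (⊏-trans q cb))
          in h z p q d
    ... | c , ac , cb , inj₁ h =
          let open Line O
              open LineLemmas O
              (z , p , q , (r , l , zr , lz , rise)) = Extremum.drop-exists (flip O) O′ f df ac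
                (λ x p q → let (l , r , lx , xr , left , right) = min x q (⊏-trans p cb) in
                           r , l , xr , lx , (λ y s t → right y t s) , (λ y s t → left y t s))
              (l′ , r′ , l′z , zr′ , drop) = h z q p
              (y , s , t , u) = between₂ lz l′z
              (w , s′ , t′ , u′) = LineLemmas.between₂ (flip O) zr zr′
          in LineLemmas.asym O′ (rise w y s′ u′ u s) (drop y w t u u′ t′)

  module Continuity (O O′ : Line) (f : N → N) (df : DefM Nₛ Nₛ f) where
    open Line O
    open LineLemmas O
    open Line O′ using () renaming (_⊏_ to _⊏′_)
    private
      module O′ = Line O′
      module O′L = LineLemmas O′

    Cont : N → Set ℓ
    Cont x = ∀ lo hi → lo ⊏′ f x → f x ⊏′ hi →
             Σ N λ l → Σ N λ r → l ⊏ x × x ⊏ r × (∀ y → l ⊏ y → y ⊏ r → lo ⊏′ f y × f y ⊏′ hi)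

    opaque
      cont-def : DefP Nₛ Cont
      cont-def = def-∀ Nₛ (def-∀ Nₛ (def-→ (O′.⊏-def v1 (m-∘ df u2)) (def-→ (O′.⊏-def (m-∘ df u2) v0)
        (def-∃ Nₛ (def-∃ Nₛ (def-× (⊏-def v1 u4) (def-× (⊏-def u4 v0) (def-∀ Nₛ
          (def-→ (⊏-def v2 v0) (def-→ (⊏-def v0 v1) (def-× (O′.⊏-def v4 (m-∘ df v0)) (O′.⊏-def (m-∘ df v0) v3))))))))))))

    opaque
      finite-image : ∀ xs {a b} → a ⊏ b → (∀ x y → a ⊏ x → x ⊏ y → y ⊏ b → ¬ f x ≡ f y) →
                     ¬ (∀ x → a ⊏ x → x ⊏ b → Any (f x ≡_) xs)
      finite-image [] ab inj h with dense ab
      ... | x , p , q with () ← h x p q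
      finite-image (v ∷ xs) {a} {b} ab inj h with em {P = Σ N λ x → a ⊏ x × x ⊏ b × f x ≡ v}
      ... | yes (x₀ , p , q , e) = finite-image xs q (λ x y s t u → inj x y (⊏-trans p s) t u) λ x s t → lem x s t (h x (⊏-trans p s) t)
        where lem : ∀ x → x₀ ⊏ x → x ⊏ b → Any (f x ≡_) (v ∷ xs) → Any (f x ≡_) xs
              lem x s t (here e′) = ⊥-elim (inj x₀ x p s t (trans e (sym e′)))
              lem x s t (there z) = z
      ... | no n = finite-image xs ab inj λ x s t → lem x s t (h x s t)
        where lem : ∀ x → a ⊏ x → x ⊏ b → Any (f x ≡_) (v ∷ xs) → Any (f x ≡_) xs
              lem x s t (here e′) = ⊥-elim (n (x , s , t , e′))
              lem x s t (there z) = z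

    opaque
      -- An image that contains no interval is finite by `discrete`, and an injective map has no
      -- finite image on an interval.
      image-interval : ∀ {a b} → a ⊏ b → (∀ x y → a ⊏ x → x ⊏ y → y ⊏ b → ¬ f x ≡ f y) →
                       Σ N λ u → Σ N λ v → u ⊏′ v × (∀ w → u ⊏′ w → w ⊏′ v → Σ N λ x → a ⊏ x × x ⊏ b × f x ≡ w)
      image-interval {a} {b} ab inj = by-contra λ n →
        let (xs , h) = O′.discrete {P = Im} dIm (λ u v p q → n (u , v , p , q)) in
        finite-image xs ab inj λ x p q → h (f x) (x , p , q , refl)
        where
          Im : N → Set ℓ
          Im w = Σ N λ x → a ⊏ x × x ⊏ b × f x ≡ w
          dIm : DefP Nₛ Im
          dIm = def-∃ Nₛ (def-× (⊏-def (m-const a) v0) (def-× (⊏-def v0 (m-const b)) (def-≡ (m-∘ df v0) u1)))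

    opaque
      -- The image contains an interval. Between the preimages `x₁` and `x₂` of two of its points,
      -- all values around `f x` are attained, so the prescribed bounds can be tightened to attained
      -- values, whose preimages delimit the neighbourhood of `x`.
      increasing⇒continuous : ∀ {a b} → a ⊏ b → (∀ x y → a ⊏ x → x ⊏ y → y ⊏ b → f x ⊏′ f y) →
                              Σ N λ a′ → Σ N λ b′ → a′ ⊏ b′ × a ⊏ a′ × b′ ⊏ b × Onʳ a′ b′ Cont
      increasing⇒continuous {a} {b} ab inc
        with image-interval ab (λ x y p q r e → O′.⊏-irrefl (subst (_⊏′ f y) e (inc x y p q r)))
      ... | u , v , uv , im-uv with O′.dense uv
      ... | v₁ , uv₁ , v₁v with O′.dense uv₁
      ... | u₁ , uu₁ , u₁v₁ with im-uv u₁ uu₁ (O′.⊏-trans u₁v₁ v₁v) | im-uv v₁ uv₁ v₁v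
      ... | x₁ , ax₁ , x₁b , refl | x₂ , ax₂ , x₂b , refl = x₁ , x₂ , reflect x₁ x₂ x₁b ax₂ u₁v₁ , ax₁ , x₂b , cont
        where
          reflect : ∀ x y → x ⊏ b → a ⊏ y → f x ⊏′ f y → x ⊏ y
          reflect x y xb ay p with tri x y
          ... | inj₁ q = q
          ... | inj₂ (inj₁ refl) = ⊥-elim (O′.⊏-irrefl p)
          ... | inj₂ (inj₂ q) = ⊥-elim (O′L.asym p (inc y x ay q xb))
          cont : Onʳ x₁ x₂ Cont
          cont x p q lo hi lofx fxhi = squeeze (O′L.between₂ lofx (inc x₁ x ax₁ p (⊏-trans q x₂b)))
                                             (LineLemmas.between₂ (flip O′) fxhi (inc x x₂ (⊏-trans ax₁ p) q x₂b))
            where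
              squeeze : (Σ N λ m → lo ⊏′ m × f x₁ ⊏′ m × m ⊏′ f x) → (Σ N λ m → m ⊏′ hi × m ⊏′ f x₂ × f x ⊏′ m) →
                      Σ N λ l → Σ N λ r → l ⊏ x × x ⊏ r × (∀ y → l ⊏ y → y ⊏ r → lo ⊏′ f y × f y ⊏′ hi)
              squeeze (m , s , t , t′) (n , s′ , w , w′)
                with im-uv m (O′.⊏-trans uu₁ t) (O′.⊏-trans t′ (O′.⊏-trans w′ (O′.⊏-trans w v₁v)))
                   | im-uv n (O′.⊏-trans uu₁ (O′.⊏-trans t (O′.⊏-trans t′ w′))) (O′.⊏-trans w v₁v)
              ... | l , al , lb , refl | r , ar , rb , refl =
                l , r , reflect l x lb (⊏-trans ax₁ p) t′ , reflect x r (⊏-trans q x₂b) ar w′ ,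
                λ y ly yr → O′.⊏-trans s (inc l y al ly (⊏-trans yr rb)) , O′.⊏-trans (inc y r (⊏-trans al ly) yr rb) s′

  open Line line using (tri; dense; lower-exists; upper-exists) renaming (⊏-trans to <-trans; ⊏-irrefl to <-irrefl)
  open LineLemmas line

  data Kind : Set where
    con inc dec : Kind

  Rel : Kind → N → N → Set ℓ
  Rel con u v = u ≡ v
  Rel inc u v = u < v
  Rel dec u v = v < u

  Rel-trans : ∀ k {u v w} → Rel k u v → Rel k v w → Rel k u w
  Rel-trans con = trans
  Rel-trans inc = <-trans
  Rel-trans dec p q = <-trans q p

  Rel-def : ∀ k {S f g} → DefM S Nₛ f → DefM S Nₛ g → DefP S (λ s → Rel k (f s) (g s))
  Rel-def con f g = def-≡ f g
  Rel-def inc f g = def-< f g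
  Rel-def dec f g = def-< g f

  _⊂_ : N × N → N × N → Set ℓ
  (a′ , b′) ⊂ (a , b) = a′ < b′ × (∀ x → a′ < x → x < b′ → a < x × x < b)

  opaque
    pigeon-kind : ∀ {P : Kind → N → Set ℓ} → (∀ k → DefP Nₛ (P k)) → ∀ {a b} → a < b →
                  Onʳ a b (λ x → Σ Kind λ k → P k x) → Σ N λ c → Σ Kind λ k → a < c × c < b × Onʳ a c (P k)
    pigeon-kind {P} dP {a} {b} ab h with germʳ (dP con) ab
    ... | c , ac , cb , inj₁ q = c , con , ac , cb , q
    ... | c , ac , cb , inj₂ n with germʳ (dP inc) ac
    ... | d , ad , dc , inj₁ q = d , inc , ad , <-trans dc cb , q
    ... | d , ad , dc , inj₂ m = d , dec , ad , <-trans dc cb , λ x p q → lem x p q (h x p (<-trans q (<-trans dc cb)))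
      where
        lem : ∀ x → a < x → x < d → (Σ Kind λ k → P k x) → P dec x
        lem x p q (con , r) = ⊥-elim (n x p (<-trans q dc) r)
        lem x p q (inc , r) = ⊥-elim (m x p q r)
        lem x p q (dec , r) = r

  module Monotone (f : N → N) (df : DefM Nₛ Nₛ f) where
    open Continuity line line f df using (Cont; cont-def; increasing⇒continuous) public

    RelF : Kind → N → N → Set ℓ
    RelF k x y = Rel k (f x) (f y)

    RelF-def : ∀ k → DefP (Nₛ ⊗ Nₛ) (λ xy → RelF k (proj₁ xy) (proj₂ xy))
    RelF-def k = Rel-def k (m-∘ df u1) (m-∘ df v0)

    Good : Kind → N → Set ℓ
    Good k x = Loc (RelF k) x × Cont x

    good-def : ∀ k → DefP Nₛ (Good k)
    good-def k = def-× (loc-def (RelF-def k)) cont-def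

    private
      RG LG : Kind → N → Set ℓ
      RG k x = Σ N λ r → x < r × Onʳ x r (λ y → RelF k x y)
      LG k x = Σ N λ l → l < x × Onʳ l x (λ y → RelF k y x)

      opaque
        RG-def : ∀ k → DefP Nₛ (RG k)
        RG-def k = def-∃ Nₛ (def-× (def-< u1 v0) (def-∀ Nₛ (def-→ (def-< u2 v0) (def-→ (def-< v0 v1)
                     (Rel-def k (m-∘ df u2) (m-∘ df v0))))))

        LG-def : ∀ k → DefP Nₛ (LG k)
        LG-def k = def-∃ Nₛ (def-× (def-< v0 u1) (def-∀ Nₛ (def-→ (def-< v1 v0) (def-→ (def-< v0 u2)
                     (Rel-def k (m-∘ df v0) (m-∘ df u2))))))

      kind-of : ∀ u v → Σ Kind λ k → Rel k u v
      kind-of u v with tri u v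
      ... | inj₁ p        = inc , p
      ... | inj₂ (inj₁ p) = con , p
      ... | inj₂ (inj₂ p) = dec , p

      opaque
        right-kind : ∀ x → Σ Kind λ k → RG k x
        right-kind x with upper-exists x
        ... | b , xb with pigeon-kind (λ k → Rel-def k (m-const (f x)) df) xb (λ y _ _ → kind-of (f x) (f y))
        ... | c , k , xc , _ , h = k , c , xc , h

      opaque
        left-kind : ∀ x → Σ Kind λ k → LG k x
        left-kind x with lower-exists x
        ... | a , ax with germˡ (Rel-def con df (m-const (f x))) ax
        ... | c , ac , cx , inj₁ h = con , c , cx , h
        ... | c , ac , cx , inj₂ n with germˡ (Rel-def inc df (m-const (f x))) cx
        ... | d , cd , dx , inj₁ h = inc , d , dx , h
        ... | d , cd , dx , inj₂ m = dec , d , dx , λ y p q → lem y p q (kind-of (f y) (f x))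
          where
            lem : ∀ y → d < y → y < x → (Σ Kind λ k → Rel k (f y) (f x)) → f x < f y
            lem y p q (con , r) = ⊥-elim (n y (<-trans cd p) q r)
            lem y p q (inc , r) = ⊥-elim (m y p q r)
            lem y p q (dec , r) = r

      Result : N → N → Set ℓ
      Result a b = Σ N λ a′ → Σ N λ b′ → Σ Kind λ k → (a′ , b′) ⊂ (a , b) × Onʳ a′ b′ (Good k)

      enlarge : ∀ {a b c d} → (c , d) ⊂ (a , b) → Result c d → Result a b
      enlarge (_ , s) (a′ , b′ , k , (p , t) , g) = a′ , b′ , k , (p , λ x u v → let (w , z) = t x u v in s x w z) , g

      opaque
        constant : ∀ {a b} u → a < b → Onʳ a b (λ y → u ≡ f y) → Result a b
        constant {a} {b} u ab h = a , b , con , (ab , λ x p q → p , q) , λ x p q →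
          (a , b , p , q , (λ y s t → trans (sym (h y s (<-trans t q))) (h x p q))
                         , (λ y s t → trans (sym (h x p q)) (h y (<-trans p s) t))) ,
          λ lo hi lofx fxhi → a , b , p , q , λ y s t →
            subst (lo <_) (trans (sym (h x p q)) (h y s t)) lofx , subst (_< hi) (trans (sym (h x p q)) (h y s t)) fxhi

      opaque
        restrict-global : ∀ {k a b} → Onʳ a b (Loc (RelF k)) → ∀ x y → a < x → x < y → y < b → RelF k x y
        restrict-global {k} h x y = local→global (RelF-def k) (Rel-trans k) h x y

      opaque
        increasing : ∀ {a b} → a < b → Onʳ a b (Loc (RelF inc)) → Result a b
        increasing {a} {b} ab h with increasing⇒continuous ab (restrict-global {inc} h)
        ... | a′ , b′ , p , q , r , c = a′ , b′ , inc , (p , s) , λ x u v → h x (proj₁ (s x u v)) (proj₂ (s x u v)) , c x u v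
          where
            s : ∀ x → a′ < x → x < b′ → a < x × x < b
            s x u v = <-trans q u , <-trans v r

      opaque
        decreasing : ∀ {a b} → a < b → Onʳ a b (Loc (RelF dec)) → Result a b
        decreasing {a} {b} ab h with Continuity.increasing⇒continuous line (flip line) f df ab (restrict-global {dec} h)
        ... | a′ , b′ , p , q , r , c = a′ , b′ , dec , (p , s) ,
              λ x u v → h x (proj₁ (s x u v)) (proj₂ (s x u v)) , unflip x (c x u v)
          where
            s : ∀ x → a′ < x → x < b′ → a < x × x < b
            s x u v = <-trans q u , <-trans v r
            unflip : ∀ x → Continuity.Cont line (flip line) f df x → Cont x
            unflip x c lo hi p q with c hi lo q p
            ... | l , e , lx , xe , g = l , e , lx , xe , λ y y₁ y₂ → proj₂ (g y y₁ y₂) , proj₁ (g y y₁ y₂)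

      opaque
        left-constant : ∀ {a b} → a < b → Onʳ a b (LG con) → Result a b
        left-constant {a} {b} ab lg with dense ab
        ... | x , ax , xb with lg x ax xb
        ... | l , lx , h with tri l a
        ... | inj₁ la = enlarge (ax , λ y p q → p , <-trans q xb) (constant (f x) ax λ y p q → sym (h y (<-trans la p) q))
        ... | inj₂ (inj₁ refl) = enlarge (ax , λ y p q → p , <-trans q xb) (constant (f x) ax λ y p q → sym (h y p q))
        ... | inj₂ (inj₂ al) = enlarge (lx , λ y p q → <-trans al p , <-trans q xb) (constant (f x) lx λ y p q → sym (h y p q))

      opaque
        -- Equal strict kinds on both sides amount to local monotonicity, which `local→global` makes
        -- global. Opposite strict kinds make every point a strict local minimum, in one of the two
        -- orders on values, and this is excluded by `no-local-minima`. A constant side at a single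
        -- point already gives an interval of constancy.
        combine : ∀ kl kr {a b} → a < b → Onʳ a b (LG kl) → Onʳ a b (RG kr) → Result a b
        combine kl con {a} {b} ab lg rg with dense ab
        ... | x , ax , xb with rg x ax xb
        ... | r , xr , h with tri r b
        ... | inj₁ rb = enlarge (xr , λ y p q → <-trans ax p , <-trans q rb) (constant (f x) xr h)
        ... | inj₂ (inj₁ refl) = enlarge (xr , λ y p q → <-trans ax p , q) (constant (f x) xr h)
        ... | inj₂ (inj₂ br) = enlarge (xb , λ y p q → <-trans ax p , q) (constant (f x) xb λ y p q → h y p (<-trans q br))
        combine con inc ab lg rg = left-constant ab lg
        combine con dec ab lg rg = left-constant ab lg
        combine inc inc ab lg rg = increasing ab (λ x p q → let (l , lx , h) = lg x p q ; (r , xr , g) = rg x p q in l , r , lx , xr , h , g)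
        combine dec dec ab lg rg = decreasing ab (λ x p q → let (l , lx , h) = lg x p q ; (r , xr , g) = rg x p q in l , r , lx , xr , h , g)
        combine dec inc ab lg rg = ⊥-elim (no-local-minima line line f df ab
          (λ x p q → let (l , lx , h) = lg x p q ; (r , xr , g) = rg x p q in l , r , lx , xr , h , g))
        combine inc dec ab lg rg = ⊥-elim (no-local-minima line (flip line) f df ab
          (λ x p q → let (l , lx , h) = lg x p q ; (r , xr , g) = rg x p q in l , r , lx , xr , h , g))

    opaque
      -- The left and right kinds at a point vary with the point; two pigeonhole steps make them
      -- uniform. Only a subinterval is produced rather than a finite partition of `(a , b)`, and
      -- all later uses tolerate shrinking.
      monotonicity : ∀ {a b} → a < b → Σ N λ a′ → Σ N λ b′ → Σ Kind λ k → (a′ , b′) ⊂ (a , b) × Onʳ a′ b′ (Good k)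
      monotonicity ab with pigeon-kind LG-def ab (λ x _ _ → left-kind x)
      ... | c , kl , ac , cb , lg with pigeon-kind RG-def ac (λ x _ _ → right-kind x)
      ... | d , kr , ad , dc , rg =
        enlarge (ad , λ x p q → p , <-trans q (<-trans dc cb)) (combine kl kr ad (λ x p q → lg x p (<-trans q dc)) rg)

  -- Dimension

  -- By o-minimality, a definable P with infinitely many solutions contains an interval.
  ∃∞ : (N → Set ℓ) → Set ℓ
  ∃∞ P = Σ N λ a → Σ N λ b → a < b × (∀ x → a < x → x < b → P x)

  opaque
    ∃∞-def : ∀ {S} {P : C S → N → Set ℓ} → DefP (S ⊗ Nₛ) (λ sx → P (proj₁ sx) (proj₂ sx)) → DefP S (λ s → ∃∞ (P s))
    ∃∞-def {P = P} dP = def-∃ Nₛ (def-∃ Nₛ (def-× (def-< v1 v0) (def-∀ Nₛ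
      (def-→ (def-< v2 v0) (def-→ (def-< v0 v1) (def-app₂ {R = P} dP u3 v0))))))

  ∃∞-mono : ∀ {P Q : N → Set ℓ} → (∀ x → P x → Q x) → ∃∞ P → ∃∞ Q
  ∃∞-mono f (a , b , p , h) = a , b , p , λ x q r → f x (h x q r)

  opaque
    ∃∞-pick : ∀ {P : N → Set ℓ} → ∃∞ P → Σ N P
    ∃∞-pick (a , b , p , h) with dense p
    ... | x , q , r = x , h x q r

  opaque
    ∃∞-⊎ : ∀ {P Q : N → Set ℓ} → DefP Nₛ P → ∃∞ (λ x → P x ⊎ Q x) → ∃∞ P ⊎ ∃∞ Q
    ∃∞-⊎ dP (a , b , p , h) with pigeonʳ dP p h
    ... | c , ac , cb , inj₁ f = inj₁ (a , c , ac , f)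
    ... | c , ac , cb , inj₂ f = inj₂ (a , c , ac , f)

  fix₁ : ∀ {S T : Sort} {P : C S → C T → Set ℓ} → DefP (S ⊗ T) (λ st → P (proj₁ st) (proj₂ st)) → ∀ s → DefP T (P s)
  fix₁ {P = P} dP s = def-app₂ {R = P} dP (m-const s) m-id

  fix₂ : ∀ {S T : Sort} {P : C S → C T → Set ℓ} → DefP (S ⊗ T) (λ st → P (proj₁ st) (proj₂ st)) → ∀ t → DefP S (λ s → P s t)
  fix₂ {P = P} dP t = def-app₂ {R = P} dP m-id (m-const t)

  opaque
    min₂ : ∀ {x y z} → z < x → z < y → Σ N λ m → z < m × m < x × m < y
    min₂ p q with LineLemmas.between₂ (flip line) p q
    ... | m , s , t , u = m , u , s , t

  PiecewiseContinuous : Line → Set ℓ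
  PiecewiseContinuous O = ∀ f → DefM Nₛ Nₛ f → ∀ {a b} → a < b → Σ N λ a′ → Σ N λ b′ → Σ (DefM Nₛ Nₛ f) λ df →
    (a′ , b′) ⊂ (a , b) × (∀ x → a′ < x → x < b′ → Continuity.Cont line O f df x)

  opaque
    piecewise-continuous : PiecewiseContinuous line
    piecewise-continuous f df ab with Monotone.monotonicity f df ab
    ... | a , b , _ , s , g = a , b , df , s , λ x p q → proj₂ (g x p q)

    piecewise-continuous-flip : PiecewiseContinuous (flip line)
    piecewise-continuous-flip f df ab with Monotone.monotonicity f df ab
    ... | a , b , _ , s , g = a , b , df , s , λ x p q → unflip x (proj₂ (g x p q))
      where
        unflip : ∀ x → Continuity.Cont line line f df x → Continuity.Cont line (flip line) f df x
        unflip x c lo hi p q with c hi lo q p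
        ... | l , e , lx , xe , g = l , e , lx , xe , λ y y₁ y₂ → proj₂ (g y y₁ y₂) , proj₁ (g y y₁ y₂)

  -- The left ends p x and right ends q x of intervals in the fibres of P are continuous on a subinterval.
  module Rectangle (O : Line)
    (cont : PiecewiseContinuous O)
    (P : N → N → Set ℓ) (dP : DefP (Nₛ ⊗ Nₛ) (λ xy → P (proj₁ xy) (proj₂ xy))) (c : N) where
    open Line O hiding (tri; dense)
    private
      module O = Line O
      module OL = LineLemmas O

    -- The bound `c` keeps the entries of a fibre bounded below, so that their infimum `p x` exists.
    Entry : N → N → Set ℓ
    Entry x w = ¬ (w ⊏ c) × Σ N λ r → w ⊏ r × (∀ y → w ⊏ y → y ⊏ r → P x y)

    private
      LB : N → N → Set ℓ
      LB x y = ∀ w → Entry x w → ¬ (w ⊏ y)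
      IsInf : N → N → Set ℓ
      IsInf x β = (∀ y → y ⊏ β → LB x y) × (∀ y → β ⊏ y → ¬ LB x y)
      opaque
        entry-def : DefP (Nₛ ⊗ Nₛ) (λ xw → Entry (proj₁ xw) (proj₂ xw))
        entry-def = def-× (def-¬ (⊏-def v0 (m-const c))) (def-∃ Nₛ (def-× (⊏-def v1 v0) (def-∀ Nₛ
          (def-→ (⊏-def v2 v0) (def-→ (⊏-def v0 v1) (def-app₂ {R = P} dP u3 v0))))))
        LB-def : DefP (Nₛ ⊗ Nₛ) (λ xy → LB (proj₁ xy) (proj₂ xy))
        LB-def = def-∀ Nₛ (def-→ (def-app₂ {R = Entry} entry-def u2 v0) (def-¬ (⊏-def v0 v1)))
        IsInf-def : DefP (Nₛ ⊗ Nₛ) (λ xy → IsInf (proj₁ xy) (proj₂ xy))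
        IsInf-def = def-× (def-∀ Nₛ (def-→ (⊏-def v0 v1) (def-app₂ {R = LB} LB-def u2 v0)))
                          (def-∀ Nₛ (def-→ (⊏-def v1 v0) (def-¬ (def-app₂ {R = LB} LB-def u2 v0))))
      module Inf = Description {Nₛ} {Nₛ} IsInf IsInf-def c

      cut-unique : ∀ {I : N → Set ℓ} {β β′} → (∀ y → y ⊏ β → I y) × (∀ y → β ⊏ y → ¬ I y) →
                   (∀ y → y ⊏ β′ → I y) × (∀ y → β′ ⊏ y → ¬ I y) → β′ ≡ β
      cut-unique {β = β} {β′} (l , h) (l′ , h′) with O.tri β β′
      ... | inj₁ p = let (y , q , r) = O.dense p in ⊥-elim (h y q (l′ y r))
      ... | inj₂ (inj₁ e) = sym e
      ... | inj₂ (inj₂ p) = let (y , q , r) = O.dense p in ⊥-elim (h′ y q (l y r))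

    p : N → N
    p = Inf.the

    private
      opaque
        p-inf : ∀ x → Σ N (Entry x) → IsInf x (p x)
        p-inf x (w , e) with cut (fix₁ {P = LB} LB-def x) (λ yz lb v ev vy → lb v ev (⊏-trans vy yz))
                                 (c , λ v ev → proj₁ ev) (let (y , wy) = O.upper-exists w in y , λ lb → lb w e wy)
        ... | β , q = Inf.the-sat x β q (λ β′ → cut-unique q)

      opaque
        -- Just right of `p x` the fibre either holds or fails on an interval. If it failed, no
        -- entry could come close to `p x`, which would then not be the infimum.
        p-entry : ∀ x → Σ N (Entry x) → Σ N λ r → p x ⊏ r × (∀ y → p x ⊏ y → y ⊏ r → P x y)
        p-entry x e with O.upper-exists (p x)
        ... | b , pb with OL.germʳ (fix₁ {P = P} dP x) pb
        ... | r , pr , _ , inj₁ h = r , pr , h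
        ... | r , pr , _ , inj₂ h with O.dense pr
        ... | r′ , pr′ , r′r = ⊥-elim (proj₂ (p-inf x e) r′ pr′ λ w ew wr′ → bad w ew wr′)
          where
            bad : ∀ w → Entry x w → ¬ (w ⊏ r′)
            bad w ew@(_ , s , ws , g) wr′ with LineLemmas.between₂ (flip O) ws (⊏-trans wr′ r′r)
            ... | m , ms , mr , wm = h m (OL.⊑⊏ (λ wp → let (y , t , u) = O.dense wp in proj₁ (p-inf x e) y u w ew t) wm) mr (g m wm ms)

    -- The interval that begins at `p x` may be unbounded; the cap `c′` gives it a right end in `N`.
    -- It is chosen above one value of `p`, and by continuity above the neighbouring ones.
    module Cap (c′ : N) where
      private
        J : N → N → Set ℓ
        J x r = ¬ (c′ ⊏ r) × (∀ y → p x ⊏ y → y ⊏ r → P x y)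
        IsSup : N → N → Set ℓ
        IsSup x β = (∀ y → y ⊏ β → J x y) × (∀ y → β ⊏ y → ¬ J x y)
        opaque
          J-def : DefP (Nₛ ⊗ Nₛ) (λ xy → J (proj₁ xy) (proj₂ xy))
          J-def = def-× (def-¬ (⊏-def (m-const c′) v0)) (def-∀ Nₛ (def-→ (⊏-def (m-∘ Inf.the-def u2) v0)
                    (def-→ (⊏-def v0 v1) (def-app₂ {R = P} dP u2 v0))))
          IsSup-def : DefP (Nₛ ⊗ Nₛ) (λ xy → IsSup (proj₁ xy) (proj₂ xy))
          IsSup-def = def-× (def-∀ Nₛ (def-→ (⊏-def v0 v1) (def-app₂ {R = J} J-def u2 v0)))
                            (def-∀ Nₛ (def-→ (⊏-def v1 v0) (def-¬ (def-app₂ {R = J} J-def u2 v0))))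
        module Sup = Description {Nₛ} {Nₛ} IsSup IsSup-def c

      q : N → N
      q = Sup.the

      q-def : DefM Nₛ Nₛ q
      q-def = Sup.the-def

      opaque
        q-sup : ∀ x → Σ N (Entry x) → p x ⊏ c′ → p x ⊏ q x × (∀ r → r ⊏ q x → ∀ y → p x ⊏ y → y ⊏ r → P x y)
        q-sup x e pc′ with p-entry x e
        ... | r , pr , h with LineLemmas.between₂ (flip O) pr pc′
        ... | r′ , r′r , r′c′ , pr′ with cut (fix₁ {P = J} J-def x)
              (λ s (n , g) → (λ t → n (⊏-trans t s)) , λ y t u → g y t (⊏-trans u s))
              (r′ , OL.asym r′c′ , λ y t u → h y t (⊏-trans u r′r))
              (let (z , s) = O.upper-exists c′ in z , λ j → proj₁ j s)
        ... | β , is = OL.⊏⊑ pr′ (λ s → proj₂ (sat) r′ s (OL.asym r′c′ , λ y t u → h y t (⊏-trans u r′r))) ,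
                       λ s t → proj₂ (proj₁ sat s t)
          where sat : IsSup x (q x)
                sat = Sup.the-sat x β is (λ β′ → cut-unique is)

    opaque
      -- After shrinking, both ends are continuous at a point `x₁`. Two points `w` and `w′` strictly
      -- between `p x₁` and `q x₁` then remain between the ends for all `x` slightly right of `x₁`.
      rectangle : ∀ {a b} → a < b → (∀ x → a < x → x < b → Σ N (Entry x)) →
                  Σ N λ w → Σ N λ w′ → w ⊏ w′ × (∃∞ λ x → ∀ y → w ⊏ y → y ⊏ w′ → P x y)
      rectangle {a} {b} ab ent with cont p Inf.the-def ab
      ... | a₁ , b₁ , _ , (a₁b₁ , sub₁) , cont-p with dense a₁b₁
      ... | x₀ , a₁x₀ , x₀b₁ with O.upper-exists (p x₀) | O.lower-exists (p x₀)
      ... | c′ , pc′ | c″ , c″p with cont-p x₀ a₁x₀ x₀b₁ c″ c′ c″p pc′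
      ... | l , r , lx₀ , x₀r , near with min₂ x₀r x₀b₁
      ... | m , x₀m , mr , mb₁ with cont (Cap.q c′) (Cap.q-def c′) x₀m
      ... | a₂ , b₂ , _ , (a₂b₂ , sub₂) , cont-q with dense a₂b₂
      ... | x₁ , a₂x₁ , x₁b₂ = finish
        where
          open Cap c′
          in₂ : ∀ x → a₂ < x → x < b₂ → a₁ < x × x < b₁
          in₂ x s t = <-trans a₁x₀ (proj₁ (sub₂ x s t)) , <-trans (proj₂ (sub₂ x s t)) mb₁
          p<c′ : ∀ x → a₂ < x → x < b₂ → p x ⊏ c′
          p<c′ x s t = proj₂ (near x (<-trans lx₀ (proj₁ (sub₂ x s t))) (<-trans (proj₂ (sub₂ x s t)) mr))
          sup : ∀ x → a₂ < x → x < b₂ → p x ⊏ q x × (∀ r → r ⊏ q x → ∀ y → p x ⊏ y → y ⊏ r → P x y)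
          sup x s t = q-sup x (ent x (proj₁ (sub₁ x (proj₁ (in₂ x s t)) (proj₂ (in₂ x s t))))
                                     (proj₂ (sub₁ x (proj₁ (in₂ x s t)) (proj₂ (in₂ x s t))))) (p<c′ x s t)
          finish : Σ N λ w → Σ N λ w′ → w ⊏ w′ × (∃∞ λ x → ∀ y → w ⊏ y → y ⊏ w′ → P x y)
          finish with O.dense (proj₁ (sup x₁ a₂x₁ x₁b₂))
          ... | w , pw , wq with O.dense wq
          ... | w′ , ww′ , w′q with O.lower-exists (p x₁) | O.upper-exists (q x₁)
          ... | lo , lop | hi , qhi with cont-p x₁ (proj₁ (in₂ x₁ a₂x₁ x₁b₂)) (proj₂ (in₂ x₁ a₂x₁ x₁b₂)) lo w lop pw
                                       | cont-q x₁ a₂x₁ x₁b₂ w′ hi w′q qhi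
          ... | l₁ , r₁ , l₁x₁ , x₁r₁ , near₁ | l₂ , r₂ , l₂x₁ , x₁r₂ , near₂ with min₂ x₁r₁ x₁r₂
          ... | m₁ , x₁m₁ , m₁r₁ , m₁r₂ with min₂ x₁m₁ x₁b₂
          ... | m₂ , x₁m₂ , m₂m₁ , m₂b₂ = w , w′ , ww′ , x₁ , m₂ , x₁m₂ , λ x s t y u v →
            proj₂ (sup x (<-trans a₂x₁ s) (<-trans t m₂b₂)) w′
              (proj₁ (near₂ x (<-trans l₂x₁ s) (<-trans t (<-trans m₂m₁ m₁r₂)))) y
              (⊏-trans (proj₂ (near₁ x (<-trans l₁x₁ s) (<-trans t (<-trans m₂m₁ m₁r₁)))) u) v

  opaque
    -- A fibre interval has a part above `pt` or a part below it, and one of the two occurs for an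
    -- interval of `x`. On that side `pt` is the bound that `Rectangle` requires, with the order
    -- reversed for the lower side. What results is a whole rectangle inside `P`.
    ∃∞-swap : ∀ {P : N → N → Set ℓ} → DefP (Nₛ ⊗ Nₛ) (λ xy → P (proj₁ xy) (proj₂ xy)) →
              (∃∞ λ x → ∃∞ λ y → P x y) → (∃∞ λ y → ∃∞ λ x → P x y)
    ∃∞-swap {P} dP (a , b , ab , h) with ∃∞-⊎ {P = Up} dUp (a , b , ab , λ x p q → side x (h x p q))
      where
        Up Down′ : N → Set ℓ
        Up x = ∃∞ λ y → pt < y × P x y
        Down′ x = ∃∞ λ y → y < pt × P x y
        dUp : DefP Nₛ Up
        dUp = ∃∞-def (def-× (def-< (m-const pt) v0) (def-app₂ {R = P} dP u1 v0))
        side : ∀ x → (∃∞ λ y → P x y) → Up x ⊎ Down′ x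
        side x (u , v , uv , g) with tri v pt
        ... | inj₁ vp = inj₂ (u , v , uv , λ y s t → <-trans t vp , g y s t)
        ... | inj₂ (inj₁ refl) = inj₂ (u , v , uv , λ y s t → t , g y s t)
        ... | inj₂ (inj₂ pv) with between₂ uv pv
        ... | m , um , pm , mv = inj₁ (m , v , mv , λ y s t → <-trans pm s , g y (<-trans um s) t)
    ... | inj₁ (a′ , b′ , a′b′ , g) = result
      where
        open Rectangle line piecewise-continuous P dP pt
        entry : ∀ x → (∃∞ λ y → pt < y × P x y) → Σ N (Entry x)
        entry x (u , v , uv , g) with dense uv
        ... | w , uw , wv = w , asym (proj₁ (g w uw wv)) , v , wv , λ y s t → proj₂ (g y (<-trans uw s) t)
        result : ∃∞ λ y → ∃∞ λ x → P x y
        result with rectangle a′b′ (λ x s t → entry x (g x s t))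
        ... | w , w′ , ww′ , e = w , w′ , ww′ , λ y s t → ∃∞-mono (λ x f → f y s t) e
    ... | inj₂ (a′ , b′ , a′b′ , g) = result
      where
        open Rectangle (flip line) piecewise-continuous-flip P dP pt
        entry : ∀ x → (∃∞ λ y → y < pt × P x y) → Σ N (Entry x)
        entry x (u , v , uv , g) with dense uv
        ... | w , uw , wv = w , asym (proj₁ (g w uw wv)) , u , uw , λ y s t → proj₂ (g y t (<-trans s wv))
        result : ∃∞ λ y → ∃∞ λ x → P x y
        result with rectangle a′b′ (λ x s t → entry x (g x s t))
        ... | w , w′ , ww′ , e = w′ , w , ww′ , λ y s t → ∃∞-mono (λ x f → f y t s) e

  opaque
    -- If the occurring `y` contain no interval they are finitely many, and by the pigeonhole
    -- principle one of them serves an interval of `x`.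
    ∃∞∃-spread : ∀ {P : N → N → Set ℓ} → DefP (Nₛ ⊗ Nₛ) (λ xy → P (proj₁ xy) (proj₂ xy)) →
                 (∃∞ λ x → Σ N λ y → P x y) → (Σ N λ y → ∃∞ λ x → P x y) ⊎ (∃∞ λ y → Σ N λ x → P x y)
    ∃∞∃-spread {P} dP (a , b , ab , h) with em {P = ∃∞ λ y → Σ N λ x → P x y}
    ... | yes p = inj₂ p
    ... | no n with LineLaws.discrete <-laws {P = λ y → Σ N λ x → P x y} (def-∃ Nₛ (def-app₂ {R = P} dP v0 u1)) (λ u v p q → n (u , v , p , q))
    ... | ys , all = inj₁ (pigeon-list ys ab λ x p q → let (y , Pxy) = h x p q in transport x y Pxy (all y (x , Pxy)))
      where
        transport : ∀ x y → P x y → ∀ {ys} → Any (y ≡_) ys → Any (P x) ys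
        transport x y p (here refl) = here p
        transport x y p (there z) = there (transport x y p z)
        pigeon-list : ∀ ys {a b} → a < b → (∀ x → a < x → x < b → Any (P x) ys) → Σ N λ y → ∃∞ λ x → P x y
        pigeon-list [] ab h with dense ab
        ... | x , p , q with () ← h x p q
        pigeon-list (y ∷ ys) {a} {b} ab h with pigeonʳ (fix₂ {P = P} dP y) ab (λ x p q → split x (h x p q))
          where
            split : ∀ x → Any (P x) (y ∷ ys) → P x y ⊎ Any (P x) ys
            split x (here p) = inj₁ p
            split x (there p) = inj₂ p
        ... | c , ac , cb , inj₁ f = y , a , c , ac , f
        ... | c , ac , cb , inj₂ f = pigeon-list ys ac f

  -- The share of one coordinate in a dimension `l`; `R x l′` stands for dimension `l′` of the fibre
  -- over `x`.
  Q : ℕ → (N → ℕ → Set ℓ) → Set ℓ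
  Q zero    R = Σ N λ x → R x zero
  Q (suc l) R = (Σ N λ x → R x (suc l)) ⊎ (∃∞ λ x → R x l)

  -- X ⊆ Nⁿ has dimension at least l: each coordinate either is fixed or ranges over an interval, and then counts once.
  Dim : ∀ n → ℕ → (Vec N n → Set ℓ) → Set ℓ
  Dim zero    zero    X = X []
  Dim zero    (suc l) X = Lift ℓ ⊥
  Dim (suc n) l       X = Q l λ x l′ → Dim n l′ λ v → X (x ∷ v)

  Dim₂ : ∀ m n → ℕ → (Vec N m → Vec N n → Set ℓ) → Set ℓ
  Dim₂ zero    n l P = Dim n l (P [])
  Dim₂ (suc m) n l P = Q l λ x l′ → Dim₂ m n l′ λ v → P (x ∷ v)

  Q-mono : ∀ l {R R′ : N → ℕ → Set ℓ} → (∀ x l → R x l → R′ x l) → Q l R → Q l R′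
  Q-mono zero    f (x , r)        = x , f x _ r
  Q-mono (suc l) f (inj₁ (x , r)) = inj₁ (x , f x _ r)
  Q-mono (suc l) f (inj₂ r)       = inj₂ (∃∞-mono (λ x → f x _) r)

  Q-here : ∀ l {R : N → ℕ → Set ℓ} x → R x l → Q l R
  Q-here zero    x r = x , r
  Q-here (suc l) x r = inj₁ (x , r)

  Q-def : ∀ {S} l {R : C S → N → ℕ → Set ℓ} → (∀ l → DefP (S ⊗ Nₛ) (λ sx → R (proj₁ sx) (proj₂ sx) l)) →
          DefP S (λ s → Q l (R s))
  Q-def zero    dR = def-∃ Nₛ (dR zero)
  Q-def (suc l) {R} dR = def-⊎ (def-∃ Nₛ (dR (suc l))) (∃∞-def {P = λ s x → R s x l} (dR l))

  opaque
    -- Exchange of two coordinates. Two intervals are exchanged by `∃∞-swap`. The delicate case is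
    -- an interval of `x` with one `y` depending on each: by `∃∞∃-spread` either a single `y` serves
    -- an interval of `x`, or the `y` fill an interval themselves, and the count is the same.
    Q-swap : ∀ l {R : N → N → ℕ → Set ℓ} → (∀ l → DefP (Nₛ ⊗ Nₛ) (λ xy → R (proj₁ xy) (proj₂ xy) l)) →
             Q l (λ x l′ → Q l′ λ y → R x y) → Q l (λ y l′ → Q l′ λ x → R x y)
    Q-swap zero dR (x , y , r) = y , x , r
    Q-swap (suc l) dR (inj₁ (x , inj₁ (y , r))) = inj₁ (y , inj₁ (x , r))
    Q-swap (suc l) dR (inj₁ (x , inj₂ e)) = inj₂ (∃∞-mono (λ y r → Q-here l x r) e)
    Q-swap (suc zero) {R} dR (inj₂ e) with ∃∞∃-spread {λ x y → R x y zero} (dR zero) e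
    ... | inj₁ (y , e′) = inj₁ (y , inj₂ e′)
    ... | inj₂ e′       = inj₂ e′
    Q-swap (suc (suc l)) {R} dR (inj₂ e)
      with ∃∞-⊎ {P = λ x → Σ N λ y → R x y (suc l)} (def-∃ Nₛ (dR (suc l))) e
    ... | inj₂ e′ = inj₂ (∃∞-mono (λ y → inj₂) (∃∞-swap {λ x y → R x y l} (dR l) e′))
    ... | inj₁ e′ with ∃∞∃-spread {λ x y → R x y (suc l)} (dR (suc l)) e′
    ...   | inj₁ (y , e″) = inj₁ (y , inj₂ e″)
    ...   | inj₂ e″       = inj₂ (∃∞-mono (λ y → inj₁) e″)

  Dim-mono : ∀ n l {X Y : Vec N n → Set ℓ} → (∀ v → X v → Y v) → Dim n l X → Dim n l Y
  Dim-mono zero    zero f p = f [] p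
  Dim-mono (suc n) l    f p = Q-mono l (λ x l′ → Dim-mono n l′ λ v → f (x ∷ v)) p

  Dim₂-mono : ∀ m n l {P P′ : Vec N m → Vec N n → Set ℓ} → (∀ v w → P v w → P′ v w) → Dim₂ m n l P → Dim₂ m n l P′
  Dim₂-mono zero    n l f p = Dim-mono n l (f []) p
  Dim₂-mono (suc m) n l f p = Q-mono l (λ x l′ → Dim₂-mono m n l′ λ v → f (x ∷ v)) p

  opaque
    Dim-def : ∀ {S} n l {X : C S → Vec N n → Set ℓ} → DefP (S ⊗ Vₛ n) (λ sv → X (proj₁ sv) (proj₂ sv)) →
              DefP S (λ s → Dim n l (X s))
    Dim-def zero    zero    {X} dX = def-app₂ {R = X} dX m-id (m-const [])
    Dim-def zero    (suc l) dX = def-⊥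
    Dim-def (suc n) l       {X} dX = Q-def l λ l′ → Dim-def n l′ (def-app₂ {R = X} dX u2 (m-∷ v1 v0))

  opaque
    Dim₂-def : ∀ {S} m n l {P : C S → Vec N m → Vec N n → Set ℓ} →
               DefP (S ⊗ Vₛ m ⊗ Vₛ n) (λ s → P (proj₁ (proj₁ s)) (proj₂ (proj₁ s)) (proj₂ s)) →
               DefP S (λ s → Dim₂ m n l (P s))
    Dim₂-def zero    n l {P} dP = Dim-def n l (def-app dP (m-, (m-, u1 (m-const [])) v0))
    Dim₂-def (suc m) n l {P} dP = Q-def l λ l′ → Dim₂-def m n l′ (def-app dP (m-, (m-, u3 (m-∷ v2 v1)) v0))

  opaque
    Dim-weaken : ∀ n l {X : Vec N n → Set ℓ} → Dim n (suc l) X → Dim n l X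
    Dim-weaken (suc n) l (inj₁ (x , d)) = Q-here l x (Dim-weaken n l d)
    Dim-weaken (suc n) l (inj₂ e) with ∃∞-pick e
    ... | x , d = Q-here l x d

  opaque
    Dim-≤ : ∀ n {k l} {X : Vec N n → Set ℓ} → k ≤ l → Dim n l X → Dim n k X
    Dim-≤ n {k} {l} k≤l d with ≤⇒≤′ k≤l
    ... | ≤′-reflexive refl = d
    ... | ≤′-step k≤l′ = Dim-≤ n (≤′⇒≤ k≤l′) (Dim-weaken n _ d)

  opaque
    Dim-nonempty : ∀ n l {X : Vec N n → Set ℓ} → Dim n l X → Σ (Vec N n) X
    Dim-nonempty zero    zero p = [] , p
    Dim-nonempty (suc n) zero (x , d) with Dim-nonempty n zero d
    ... | v , p = x ∷ v , p
    Dim-nonempty (suc n) (suc l) (inj₁ (x , d)) with Dim-nonempty n (suc l) d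
    ... | v , p = x ∷ v , p
    Dim-nonempty (suc n) (suc l) (inj₂ e) with ∃∞-pick e
    ... | x , d with Dim-nonempty n l d
    ... | v , p = x ∷ v , p

  opaque
    Dim-point : ∀ {n} {X : Vec N n → Set ℓ} v → X v → Dim n 0 X
    Dim-point []      p = p
    Dim-point (x ∷ v) p = x , Dim-point v p

  opaque
    ¬Dim-suc : ∀ n {X : Vec N n → Set ℓ} → ¬ Dim n (suc n) X
    ¬Dim-suc (suc n) (inj₁ (x , d)) = ¬Dim-suc n (Dim-weaken n (suc n) d)
    ¬Dim-suc (suc n) (inj₂ e) = ¬Dim-suc n (proj₂ (∃∞-pick e))

  opaque
    ¬Dim-singleton : ∀ n {X : Vec N n → Set ℓ} → (∀ v w → X v → X w → v ≡ w) → ¬ Dim n 1 X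
    ¬Dim-singleton (suc n) h (inj₁ (x , d)) = ¬Dim-singleton n (λ v w p q → proj₂ (∷-injective (h _ _ p q))) d
    ¬Dim-singleton (suc n) h (inj₂ (a , b , ab , e)) with dense ab
    ... | x , ax , xb with dense xb
    ... | y , xy , yb with Dim-nonempty n 0 (e x ax xb) | Dim-nonempty n 0 (e y (<-trans ax xy) yb)
    ... | v , p | w , q = <-irrefl (subst (x <_) (sym (proj₁ (∷-injective (h _ _ p q)))) xy)

  private
    push : ∀ n m l {P : N → Vec N n → Vec N m → Set ℓ} →
           DefP (Nₛ ⊗ Vₛ n ⊗ Vₛ m) (λ s → P (proj₁ (proj₁ s)) (proj₂ (proj₁ s)) (proj₂ s)) →
           Q l (λ x l′ → Dim₂ n m l′ (P x)) → Dim₂ n (suc m) l (λ v w → P (head w) v (tail w))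
    push zero    m l dP q = q
    push (suc n) m l {P} dP q = Q-mono l (λ y l′ → push n m l′
        (def-app dP (m-, (m-, u2 (m-∷ (m-const y) v1)) v0)))
      (Q-swap l {λ x y l′ → Dim₂ n m l′ λ v w → P x (y ∷ v) w}
        (λ l′ → Dim₂-def n m l′ (def-app dP (m-, (m-, u3′ (m-∷ v2′ v1)) v0))) q)
      where
        u3′ : DefM (Nₛ ⊗ Nₛ ⊗ Vₛ n ⊗ Vₛ m) Nₛ (λ s → proj₁ (proj₁ (proj₁ s)))
        u3′ = u3
        v2′ : DefM (Nₛ ⊗ Nₛ ⊗ Vₛ n ⊗ Vₛ m) Nₛ (λ s → proj₂ (proj₁ (proj₁ s)))
        v2′ = v2

    Dim₂-empty : ∀ n l {X : Vec N n → Set ℓ} → Dim n l X → Dim₂ n 0 l (λ v _ → X v)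
    Dim₂-empty zero    zero p = p
    Dim₂-empty (suc n) l    d = Q-mono l (λ x l′ → Dim₂-empty n l′) d

  opaque
    -- Each coordinate of the first block is carried by `push` past the whole second block, with one
    -- `Q-swap` for every coordinate that it passes.
    Dim₂-commute : ∀ m n l {P : Vec N m → Vec N n → Set ℓ} → DefP (Vₛ m ⊗ Vₛ n) (λ vw → P (proj₁ vw) (proj₂ vw)) →
                   Dim₂ m n l P → Dim₂ n m l (λ w v → P v w)
    Dim₂-commute zero    n l dP d = Dim₂-mono n 0 l (λ { w [] p → p }) (Dim₂-empty n l d)
    Dim₂-commute (suc m) n l {P} dP d = Dim₂-mono n (suc m) l (λ { w (x ∷ v) p → p })
      (push n m l {λ x w v → P (x ∷ v) w} (def-app₂ {R = P} dP (m-∷ u2 v0) v1)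
        (Q-mono l (λ x l′ → Dim₂-commute m n l′ (def-app₂ {R = P} dP (m-∷ (m-const x) u1) v0)) d))

  opaque
    Dim₂-lower : ∀ m n j k {P : Vec N m → Vec N n → Set ℓ} → Dim m j (λ v → Dim n k (P v)) → Dim₂ m n (j + k) P
    Dim₂-lower zero    n zero    k d = d
    Dim₂-lower (suc m) n zero    k (x , d) = Q-here k x (Dim₂-lower m n zero k d)
    Dim₂-lower (suc m) n (suc j) k (inj₁ (x , d)) = inj₁ (x , Dim₂-lower m n (suc j) k d)
    Dim₂-lower (suc m) n (suc j) k (inj₂ e) = inj₂ (∃∞-mono (λ x → Dim₂-lower m n j k) e)

  opaque
    -- When `l ≤ k` the truncated difference is zero and only a point is asked for. Otherwise the
    -- second block can account for at most `k` of the intervals, so the rest must come from the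
    -- first block.
    Dim₂-upper : ∀ m n l k {P : Vec N m → Vec N n → Set ℓ} → (∀ v → ¬ Dim n (suc k) (P v)) →
                 Dim₂ m n l P → Dim m (l ∸ k) (λ v → Σ (Vec N n) (P v))
    Dim₂-upper zero n l k h d with l ≤? k
    ... | yes l≤k rewrite m≤n⇒m∸n≡0 l≤k = Dim-nonempty n l d
    ... | no  l≰k = ⊥-elim (h [] (Dim-≤ n (≰⇒> l≰k) d))
    Dim₂-upper (suc m) n zero k {P} h (x , d) =
      subst (λ j → Q j λ x l′ → Dim m l′ λ v → Σ (Vec N n) (P (x ∷ v))) (sym (0∸n≡0 k))
        (x , subst (λ j → Dim m j λ v → Σ (Vec N n) (P (x ∷ v))) (0∸n≡0 k) (Dim₂-upper m n zero k (λ v → h (x ∷ v)) d))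
    Dim₂-upper (suc m) n (suc l) k h (inj₁ (x , d)) = Q-here (suc l ∸ k) x (Dim₂-upper m n (suc l) k (λ v → h (x ∷ v)) d)
    Dim₂-upper (suc m) n (suc l) k {P} h (inj₂ e) with k ≤? l
    ... | yes k≤l = subst (λ j → Q j λ x l′ → Dim m l′ λ v → Σ (Vec N n) (P (x ∷ v))) (sym (+-∸-assoc 1 k≤l))
          (inj₂ (∃∞-mono (λ x → Dim₂-upper m n l k (λ v → h (x ∷ v))) e))
    ... | no k≰l with ∃∞-pick e
    ... | x , d = subst (λ j → Q j λ x l′ → Dim m l′ λ v → Σ (Vec N n) (P (x ∷ v))) (sym (m≤n⇒m∸n≡0 (≰⇒> k≰l)))
          (x , subst (λ j → Dim m j λ v → Σ (Vec N n) (P (x ∷ v))) (m≤n⇒m∸n≡0 (<⇒≤ (≰⇒> k≰l))) (Dim₂-upper m n l k (λ v → h (x ∷ v)) d))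

  opaque
    -- The graph has at least the dimension of `X`, because every point of `X` has a partner. After
    -- the exchange of the blocks it is fibred over the image, with fibres of dimension at most `k`.
    -- `R` may be multivalued.
    Dim-image : ∀ m n l k {X : Vec N m → Set ℓ} {R : Vec N m → Vec N n → Set ℓ} →
                DefP (Vₛ m) X → DefP (Vₛ m ⊗ Vₛ n) (λ vw → R (proj₁ vw) (proj₂ vw)) →
                (∀ v → X v → Σ (Vec N n) (R v)) → (∀ w → ¬ Dim m (suc k) (λ v → X v × R v w)) →
                Dim m l X → Dim n (l ∸ k) (λ w → Σ (Vec N m) λ v → X v × R v w)
    Dim-image m n l k {X} {R} dX dR total fibre d =
      Dim₂-upper n m l k fibre
        (Dim₂-commute m n l {λ v w → X v × R v w} (def-× (def-app dX u1) dR)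
          (subst (λ j → Dim₂ m n j λ v w → X v × R v w) (+-identityʳ l)
            (Dim₂-lower m n l 0 (Dim-mono m l (λ v p → let (w , r) = total v p in Dim-point w (p , r)) d))))

    Dim₂⇒Dim : ∀ m n l {P : Vec N m → Vec N n → Set ℓ} → Dim₂ m n l P →
               Dim (m + n) l (λ u → Σ (Vec N m) λ v → Σ (Vec N n) λ w → v ++ w ≡ u × P v w)
    Dim₂⇒Dim zero    n l δ = Dim-mono n l (λ w p → [] , w , refl , p) δ
    Dim₂⇒Dim (suc m) n l δ = Q-mono l (λ x l′ p → Dim-mono (m + n) l′
      (λ { u (v , w , refl , q) → x ∷ v , w , refl , q }) (Dim₂⇒Dim m n l′ p)) δ

  opaque
    -- The set of all pairs has dimension at least `k + 1`. Once `x` is moved to the front it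
    -- accounts for at most one of these, so some fibre over `x` keeps dimension `k`.
    Dim-∃∞ : ∀ n k {P : N → Vec N n → Set ℓ} → DefP (Nₛ ⊗ Vₛ n) (λ xv → P (proj₁ xv) (proj₂ xv)) →
             Dim n k (λ v → ∃∞ λ x → P x v) → Σ N λ x → Dim n k (P x)
    Dim-∃∞ n k {P} dP d = finish k (Dim₂-commute n 1 (k + 1) {λ v w → P (head w) v}
          (def-app₂ {R = P} dP (m-∘ (s→M s-head) v0) u1)
          (Dim₂-lower n 1 k 1 (Dim-mono n k (λ v → inj₂) d)))
      where
        finish : ∀ k → Q (k + 1) (λ x l → Dim n l (λ v → P x v)) → Σ N λ x → Dim n k (P x)
        finish k q = aux (subst (λ j → Q j λ x l → Dim n l (λ v → P x v)) (+-comm k 1) q)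
          where
            aux : Q (suc k) (λ x l → Dim n l (λ v → P x v)) → Σ N λ x → Dim n k (P x)
            aux (inj₁ (x , d)) = x , Dim-weaken n k d
            aux (inj₂ e) = ∃∞-pick e

  -- Sets of full dimension and boxes

  Full : ∀ n → (Vec N n → Set ℓ) → Set ℓ
  Full n = Dim n n

  Full-∷ : ∀ n {X : Vec N (suc n) → Set ℓ} → Full (suc n) X → ∃∞ λ x → Full n λ v → X (x ∷ v)
  Full-∷ n (inj₁ (x , d)) = ⊥-elim (¬Dim-suc n d)
  Full-∷ n (inj₂ e) = e

  opaque
    ∃∞-Full : ∀ n {P : N → Vec N n → Set ℓ} → DefP (Nₛ ⊗ Vₛ n) (λ xv → P (proj₁ xv) (proj₂ xv)) →
              (∃∞ λ x → Full n (P x)) → Full n (λ v → ∃∞ λ x → P x v)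
    ∃∞-Full zero    dP e = e
    ∃∞-Full (suc n) {P} dP e = inj₂ (∃∞-mono (λ y → ∃∞-Full n (def-app₂ {R = P} dP u1 (m-∷ (m-const y) v0)))
      (∃∞-swap {λ x y → Full n λ v → P x (y ∷ v)} (Dim-def n n (def-app₂ {R = P} dP u2 (m-∷ v1 v0)))
        (∃∞-mono (λ x → Full-∷ n {P x}) e)))

  opaque
    Full-∃∞ : ∀ n {P : N → Vec N n → Set ℓ} → DefP (Nₛ ⊗ Vₛ n) (λ xv → P (proj₁ xv) (proj₂ xv)) →
              Full n (λ v → ∃∞ λ x → P x v) → ∃∞ λ x → Full n (P x)
    Full-∃∞ zero    dP e = e
    Full-∃∞ (suc n) {P} dP e = ∃∞-mono (λ x → inj₂)
      (∃∞-swap {λ y x → Full n λ v → P x (y ∷ v)} (Dim-def n n (def-app₂ {R = P} dP v1 (m-∷ u2 v0)))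
        (∃∞-mono (λ y → Full-∃∞ n (def-app₂ {R = P} dP u1 (m-∷ (m-const y) v0))) (Full-∷ n {λ v → ∃∞ λ x → P x v} e)))

  -- The corners of a box, listed coordinate by coordinate.
  corners : ℕ → ℕ
  corners zero    = zero
  corners (suc n) = suc (suc (corners n))

  Proper : ∀ n → Vec N (corners n) → Set ℓ
  Proper zero    _           = Lift ℓ ⊤
  Proper (suc n) (a ∷ b ∷ p) = a < b × Proper n p

  InBox : ∀ n → Vec N (corners n) → Vec N n → Set ℓ
  InBox zero    _           _       = Lift ℓ ⊤
  InBox (suc n) (a ∷ b ∷ p) (x ∷ v) = (a < x × x < b) × InBox n p v

  private
    s-head₂ : ∀ {n} → DefM (Vₛ (suc (suc n))) Nₛ (λ p → head (tail p))
    s-head₂ = m-∘ (s→M s-head) (s→M s-tail)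

    s-tail₂ : ∀ {n} → DefM (Vₛ (suc (suc n))) (Vₛ n) (λ p → tail (tail p))
    s-tail₂ = m-∘ (s→M s-tail) (s→M s-tail)

  opaque
    Proper-def : ∀ n → DefP (Vₛ (corners n)) (Proper n)
    Proper-def zero    = def-⊤
    Proper-def (suc n) = DefP-resp (λ { (a ∷ b ∷ p) q → q }) (λ { (a ∷ b ∷ p) q → q })
      (def-× (def-< (s→M s-head) s-head₂) (def-app (Proper-def n) s-tail₂))

  opaque
    InBox-def : ∀ n → DefP (Vₛ (corners n) ⊗ Vₛ n) (λ pv → InBox n (proj₁ pv) (proj₂ pv))
    InBox-def zero    = def-⊤
    InBox-def (suc n) = DefP-resp (λ { ((a ∷ b ∷ p) , (x ∷ v)) q → q }) (λ { ((a ∷ b ∷ p) , (x ∷ v)) q → q })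
      (def-× (def-× (def-< (m-∘ (s→M s-head) u1) (m-∘ (s→M s-head) v0)) (def-< (m-∘ (s→M s-head) v0) (m-∘ s-head₂ u1)))
             (def-app₂ {R = InBox n} (InBox-def n) (m-∘ s-tail₂ u1) (m-∘ (s→M s-tail) v0)))

  opaque
    -- Asking for a full set of corners instead of a single box is what carries the induction. Over
    -- an interval of `x` the fibre has a full set of corners; after the exchange, a full set of
    -- corners works for an interval of `x` each, and these intervals supply the corners `a` and `b`
    -- of the new coordinate.
    Full⇒boxes : ∀ n {X : Vec N n → Set ℓ} → DefP (Vₛ n) X → Full n X →
                 Full (corners n) λ p → Proper n p × (∀ v → InBox n p v → X v)
    Full⇒boxes zero    dX d = lift tt , λ { [] _ → d }
    Full⇒boxes (suc n) {X} dX d = inj₂ (∃∞-mono (λ a → inj₂)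
      (∃∞-mono (λ a e → ∃∞-mono (λ b → Dim-mono m m λ p (ab , pr , h) → (ab , pr) , λ { (x ∷ v) ((ax , xb) , i) → h x ax xb v i })
          (Full-∃∞ m {λ b p → Box a b p} (def-app₂ {S = Nₛ ⊗ Vₛ m} {T = Nₛ ⊗ Nₛ} {R = λ ab p → Box (proj₁ ab) (proj₂ ab) p}
             dBox (m-, (m-const a) u1) v0) e))
        (Full-∃∞ m {λ a p → ∃∞ λ b → Box a b p} (∃∞-def {P = λ ap b → Box (proj₁ ap) b (proj₂ ap)}
            (def-app₂ {T = Nₛ ⊗ Nₛ} {R = λ ab p → Box (proj₁ ab) (proj₂ ab) p} dBox (m-, u2 v0) v1))
          (Dim-mono m m corners-of
            (∃∞-Full m {Fibre} dFibre (∃∞-mono (λ x → Full⇒boxes n (def-app dX (m-∷ (m-const x) m-id))) (Full-∷ n {X} d)))))))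
      where
        m : ℕ
        m = corners n
        Fibre : N → Vec N m → Set ℓ
        Fibre x p = Proper n p × (∀ v → InBox n p v → X (x ∷ v))
        dFibre : DefP (Nₛ ⊗ Vₛ m) (λ xp → Fibre (proj₁ xp) (proj₂ xp))
        dFibre = def-× (def-app (Proper-def n) v0) (def-∀ (Vₛ n) (def-→ (def-app₂ {R = InBox n} (InBox-def n) v1 v0)
                   (def-app dX (m-∷ u2 v0))))
        Box : N → N → Vec N m → Set ℓ
        Box a b p = a < b × Proper n p × (∀ x → a < x → x < b → ∀ v → InBox n p v → X (x ∷ v))
        dBox : DefP (Nₛ ⊗ Nₛ ⊗ Vₛ m) (λ s → Box (proj₁ (proj₁ s)) (proj₂ (proj₁ s)) (proj₂ s))
        dBox = def-× (def-< u2 v1) (def-× (def-app (Proper-def n) v0) (def-∀ Nₛ (def-→ (def-< u3 v0) (def-→ (def-< v0 v2)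
                 (def-∀ (Vₛ n) (def-→ (def-app₂ {R = InBox n} (InBox-def n) v2 v0) (def-app dX (m-∷ v1 v0))))))))
        corners-of : ∀ p → (∃∞ λ x → Fibre x p) → ∃∞ λ a → ∃∞ λ b → Box a b p
        corners-of p (a , b , ab , h) with dense ab
        ... | c , ac , cb = a , c , ac , λ a′ aa′ a′c → c , b , cb , λ b′ cb′ b′b →
          <-trans a′c cb′ , proj₁ (h c ac cb) , λ x p q → proj₂ (h x (<-trans aa′ p) (<-trans q b′b))

  opaque
    Full⇒box : ∀ n {X : Vec N n → Set ℓ} → DefP (Vₛ n) X → Full n X →
               Σ (Vec N (corners n)) λ p → Proper n p × (∀ v → InBox n p v → X v)
    Full⇒box n dX d = Dim-nonempty (corners n) (corners n) (Full⇒boxes n dX d)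

  opaque
    box⇒Full : ∀ n {X : Vec N n → Set ℓ} p → Proper n p → (∀ v → InBox n p v → X v) → Full n X
    box⇒Full zero    p           pr        h = h [] (lift tt)
    box⇒Full (suc n) (a ∷ b ∷ p) (ab , pr) h = inj₂ (a , b , ab , λ x ax xb → box⇒Full n p pr λ v i → h (x ∷ v) ((ax , xb) , i))

  -- Groups and their topology

  module GroupSort (H : DefinableGroup 𝓝) where
    open DefinableGroup H hiding (dim)
    private
      n = DefinableGroup.dim H
      module I = IsGroup isGroup

    Mem-def : DefP (Vₛ n) Mem
    Mem-def = Def→DefP (Definable⇒Def (DefinableGroup.definable H))

    Gₛ : Sort
    Gₛ = Subₛ (Vₛ n) Mem Mem-def

    out : C Gₛ → ∃ Mem
    out (v , p) = v , toWitness p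

    into : ∃ Mem → C Gₛ
    into (v , p) = v , fromWitness p

    El≡ : ∀ {x y : C Gₛ} → proj₁ x ≡ proj₁ y → x ≡ y
    El≡ = sub-≡ {Vₛ n} {Mem} {Mem-def}

    infixl 7 _·_
    _·_ : C Gₛ → C Gₛ → C Gₛ
    x · y = into (out x ∙ out y)

    1# : C Gₛ
    1# = into ε

    inv : C Gₛ → C Gₛ
    inv x = into (out x ⁻¹)

    elGroup : Group ℓ ℓ
    elGroup = record { Carrier = C Gₛ ; _≈_ = _≡_ ; _∙_ = _·_ ; ε = 1# ; _⁻¹ = inv ; isGroup = record
      { isMonoid = record
        { isSemigroup = record
          { isMagma = record { isEquivalence = isEquivalence ; ∙-cong = cong₂ _·_ }
          ; assoc = λ x y z → El≡ (trans (I.∙-congʳ {x = out z} refl) (trans (I.assoc (out x) (out y) (out z)) (I.∙-congˡ {x = out x} refl))) }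
        ; identity = (λ x → El≡ (trans (I.∙-congʳ {x = out x} refl) (I.identityˡ (out x))))
                   , (λ x → El≡ (trans (I.∙-congˡ {x = out x} refl) (I.identityʳ (out x)))) }
      ; inverse = (λ x → El≡ (trans (I.∙-congʳ {x = out x} refl) (I.inverseˡ (out x))))
                , (λ x → El≡ (trans (I.∙-congˡ {x = out x} refl) (I.inverseʳ (out x))))
      ; ⁻¹-cong = cong inv } }
      where open import Relation.Binary.PropositionalEquality.Properties using (isEquivalence)

    opaque
      ·-def₀ : DefM (Gₛ ⊗ Gₛ) Gₛ (λ xy → proj₁ xy · proj₂ xy)
      ·-def₀ = DefP-resp fwd bwd
        (pull (s-∘ (s-enc {Gₛ ⊗ (Gₛ ⊗ Gₛ)}) (s-, (s-∘ s-proj₁ s-proj₁) (s-, (s-∘ s-proj₂ s-proj₁) s-proj₂)))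
              (Def→DefP (Definable⇒Def ∙-definable)))
        where
          fwd : ∀ s → Graph₂ 𝓝 (λ x y → proj₁ (x ∙ y)) (proj₁ (proj₁ (proj₁ s)) ++ (proj₁ (proj₂ (proj₁ s)) ++ proj₁ (proj₂ s))) →
                proj₁ (proj₁ s) · proj₂ (proj₁ s) ≡ proj₂ s
          fwd ((x , y) , z) (x′ , y′ , e) with ++-injective (proj₁ x) (proj₁ x′) e
          ... | e₁ , e′ with ++-injective (proj₁ y) (proj₁ y′) e′
          ... | e₂ , e₃ = El≡ (trans (I.∙-cong {out x} {x′} {out y} {y′} e₁ e₂) (sym e₃))
          bwd : ∀ s → proj₁ (proj₁ s) · proj₂ (proj₁ s) ≡ proj₂ s →
                Graph₂ 𝓝 (λ x y → proj₁ (x ∙ y)) (proj₁ (proj₁ (proj₁ s)) ++ (proj₁ (proj₂ (proj₁ s)) ++ proj₁ (proj₂ s)))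
          bwd ((x , y) , z) refl = out x , out y , refl

    ·-def : ∀ {S f g} → DefM S Gₛ f → DefM S Gₛ g → DefM S Gₛ (λ s → f s · g s)
    ·-def = m-app₂ {h = _·_} ·-def₀

    open import Algebra.Properties.Group elGroup using (inverseʳ-unique) public
    module G = Group elGroup

    opaque
      inv-def₀ : DefM Gₛ Gₛ inv
      inv-def₀ = DefP-resp (λ (x , y) e → sym (inverseʳ-unique x y e)) (λ { (x , _) refl → G.inverseʳ x })
        (def-≡ (·-def u1 v0) (m-const 1#))

    inv-def : ∀ {S f} → DefM S Gₛ f → DefM S Gₛ (λ s → inv (f s))
    inv-def = m-∘ inv-def₀

  PW : ∀ {n} → Vec N n → Vec N n → Set ℓ
  PW = Pointwise _<_

  opaque
    PW-def : ∀ {n} → DefP (Vₛ n ⊗ Vₛ n) (λ vw → PW (proj₁ vw) (proj₂ vw))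
    PW-def {zero}  = DefP-resp (λ { ([] , []) _ → [] }) (λ _ _ → lift tt) def-⊤
    PW-def {suc n} = DefP-resp (λ { ((a ∷ v) , (b ∷ w)) (p , q) → p ∷ q }) (λ { ((a ∷ v) , (b ∷ w)) (p ∷ q) → p , q })
      (def-× (def-< (m-∘ (s→M s-head) u1) (m-∘ (s→M s-head) v0))
             (def-app₂ {R = PW} PW-def (m-∘ (s→M s-tail) u1) (m-∘ (s→M s-tail) v0)))

  PW-lookup : ∀ {n} {v w : Vec N n} → PW v w → ∀ j → lookup v j < lookup w j
  PW-lookup (p ∷ q) zero    = p
  PW-lookup (p ∷ q) (suc j) = PW-lookup q j

  PW-tabulate : ∀ {n} {v w : Vec N n} → (∀ j → lookup v j < lookup w j) → PW v w
  PW-tabulate {v = []} {[]} h = []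
  PW-tabulate {v = a ∷ v} {b ∷ w} h = h zero ∷ PW-tabulate (h ∘ suc)

  PW-sup : ∀ {n} (lo lo′ v : Vec N n) → PW lo v → PW lo′ v →
           Σ (Vec N n) λ m → PW m v × (∀ w → PW m w → PW lo w × PW lo′ w)
  PW-sup [] [] [] [] [] = [] , [] , λ { [] [] → [] , [] }
  PW-sup (a ∷ lo) (b ∷ lo′) (c ∷ v) (p ∷ ps) (q ∷ qs) with PW-sup lo lo′ v ps qs | between₂ p q
  ... | m , mv , h | d , ad , bd , dc = d ∷ m , dc ∷ mv , λ { (x ∷ w) (r ∷ rs) →
        <-trans ad r ∷ proj₁ (h w rs) , <-trans bd r ∷ proj₂ (h w rs) }

  PW-inf : ∀ {n} (hi hi′ v : Vec N n) → PW v hi → PW v hi′ →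
           Σ (Vec N n) λ m → PW v m × (∀ w → PW w m → PW w hi × PW w hi′)
  PW-inf [] [] [] [] [] = [] , [] , λ { [] [] → [] , [] }
  PW-inf (a ∷ hi) (b ∷ hi′) (c ∷ v) (p ∷ ps) (q ∷ qs) with PW-inf hi hi′ v ps qs | min₂ p q
  ... | m , vm , h | d , cd , da , db = d ∷ m , cd ∷ vm , λ { (x ∷ w) (r ∷ rs) →
        <-trans r da ∷ proj₁ (h w rs) , <-trans r db ∷ proj₂ (h w rs) }

  around : ∀ {n} (v : Vec N n) → Σ (Vec N n) λ lo → Σ (Vec N n) λ hi → PW lo v × PW v hi
  around [] = [] , [] , [] , []
  around (a ∷ v) with around v | lower-exists a | upper-exists a
  ... | lo , hi , p , q | b , ba | c , ac = b ∷ lo , c ∷ hi , ba ∷ p , ac ∷ q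

  separate : ∀ {n} (v w : Vec N n) → ¬ v ≡ w → Σ (Vec N n) λ lo → Σ (Vec N n) λ hi → PW lo v × PW v hi × ¬ (PW lo w × PW w hi)
  separate [] [] n = ⊥-elim (n refl)
  separate (a ∷ v) (b ∷ w) n with tri a b
  ... | inj₁ ab with around (a ∷ v)
  ...   | lo , _ ∷ hi , p , _ ∷ q = lo , b ∷ hi , p , ab ∷ q , λ { (_ , (r ∷ _)) → <-irrefl r }
  separate (a ∷ v) (b ∷ w) n | inj₂ (inj₂ ba) with around (a ∷ v)
  ...   | _ ∷ lo , hi , _ ∷ p , q = b ∷ lo , hi , ba ∷ p , q , λ { ((r ∷ _) , _) → <-irrefl r }
  separate (a ∷ v) (b ∷ w) n | inj₂ (inj₁ refl) with separate v w (n ∘ cong (a ∷_)) | lower-exists a | upper-exists a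
  ...   | lo , hi , p , q , m | b , ba | c , ac = b ∷ lo , c ∷ hi , ba ∷ p , ac ∷ q , λ { ((_ ∷ r) , (_ ∷ s)) → m (r , s) }

  opaque
    Dim-⊎ : ∀ n l {X Y : Vec N n → Set ℓ} → DefP (Vₛ n) X → Dim n l (λ v → X v ⊎ Y v) → Dim n l X ⊎ Dim n l Y
    Dim-⊎ zero    zero    dX p = p
    Dim-⊎ (suc n) zero    dX (x , d) with Dim-⊎ n zero (def-app dX (m-∷ (m-const x) m-id)) d
    ... | inj₁ p = inj₁ (x , p)
    ... | inj₂ p = inj₂ (x , p)
    Dim-⊎ (suc n) (suc l) dX (inj₁ (x , d)) with Dim-⊎ n (suc l) (def-app dX (m-∷ (m-const x) m-id)) d
    ... | inj₁ p = inj₁ (inj₁ (x , p))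
    ... | inj₂ p = inj₂ (inj₁ (x , p))
    Dim-⊎ (suc n) (suc l) {X} {Y} dX (inj₂ e)
      with ∃∞-⊎ {P = λ x → Dim n l λ v → X (x ∷ v)} {Q = λ x → Dim n l λ v → Y (x ∷ v)}
            (Dim-def n l (def-app dX (m-∷ u1 v0)))
            (∃∞-mono (λ x → Dim-⊎ n l (def-app dX (m-∷ (m-const x) m-id))) e)
    ... | inj₁ p = inj₁ (inj₂ p)
    ... | inj₂ p = inj₂ (inj₂ p)

    Dim-⋃ : ∀ n l k {X : Fin k → Vec N n → Set ℓ} → (∀ i → DefP (Vₛ n) (X i)) →
            Dim n l (λ v → Σ (Fin k) λ i → X i v) → Σ (Fin k) λ i → Dim n l (X i)
    Dim-⋃ n l zero    dX d with () ← proj₁ (proj₂ (Dim-nonempty n l d))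
    Dim-⋃ n l (suc k) {X} dX d
      with Dim-⊎ n l {Y = λ v → Σ (Fin k) λ i → X (suc i) v} (dX zero)
             (Dim-mono n l (λ { v (zero , p) → inj₁ p ; v (suc i , p) → inj₂ (i , p) }) d)
    ... | inj₁ p = zero , p
    ... | inj₂ p with Dim-⋃ n l k (dX ∘ suc) p
    ... | i , q = suc i , q

  module Topology (A : DefinableGroup 𝓝) (τ : GroupManifold 𝓝 A) where
    open GroupSort A public renaming (Gₛ to Aₛ)
    open DefinableGroup A using (Mem; _∙_; ε; _⁻¹; isGroup)
    open GroupManifold τ public
    n : ℕ
    n = DefinableGroup.dim A
    private
      module I = IsGroup isGroup

    -- Chart i read on points; κ i is junk outside of the domain U i.
    U : Fin size → C Aₛ → Set ℓ
    U i x = C.U i (proj₁ x)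

    private
      Coord : ∀ i → C Aₛ → Vec N d → Set ℓ
      Coord i x w = Σ (C.U i (proj₁ x)) λ p → proj₁ (DefinableMap.to (C.φ i) (proj₁ x , p)) ≡ w

      opaque
        Coord-def : ∀ i → DefP (Aₛ ⊗ Vₛ d) (λ xw → Coord i (proj₁ xw) (proj₂ xw))
        Coord-def i = DefP-resp fwd bwd
          (pull (s-enc {Aₛ ⊗ Vₛ d}) (Def→DefP (Definable⇒Def (DefinableMap.definable (C.φ i)))))
          where
            fwd : ∀ s → Graph 𝓝 (proj₁ ∘ DefinableMap.to (C.φ i)) (proj₁ (proj₁ s) ++ proj₂ s) → Coord i (proj₁ s) (proj₂ s)
            fwd (x , w) ((v , p) , e) with ++-injective (proj₁ x) v e
            ... | refl , e′ = p , sym e′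
            bwd : ∀ s → Coord i (proj₁ s) (proj₂ s) → Graph 𝓝 (proj₁ ∘ DefinableMap.to (C.φ i)) (proj₁ (proj₁ s) ++ proj₂ s)
            bwd (x , w) (p , refl) = (proj₁ x , p) , refl

      module K i = Description {Aₛ} {Vₛ d} (Coord i) (Coord-def i) (tabulate λ _ → pt)

    κ : Fin size → C Aₛ → Vec N d
    κ i = K.the i

    κ-def : ∀ i {S f} → DefM S Aₛ f → DefM S (Vₛ d) (λ s → κ i (f s))
    κ-def i = m-∘ (K.the-def i)

    opaque
      U-def : ∀ i → DefP Aₛ (U i)
      U-def i = DefP-resp (λ x (w , p , _) → p) (λ x p → _ , p , refl) (def-∃ (Vₛ d) {P = Coord i} (Coord-def i))

      κ-≡ : ∀ i (x : C Aₛ) (p : U i x) → κ i x ≡ proj₁ (DefinableMap.to (C.φ i) (proj₁ x , p))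
      κ-≡ i x p = K.the-unique i x _ (p , refl) λ { w (q , refl) → DefinableMap.cong (C.φ i) refl }

      κ-injective : ∀ i {x y} → U i x → U i y → κ i x ≡ κ i y → x ≡ y
      κ-injective i {x} {y} p q e = El≡ (proj₁ (C.bijective i) {_ , p} {_ , q}
        (trans (sym (κ-≡ i x p)) (trans e (κ-≡ i y q))))

      κ-surjective : ∀ i w → C.V i w → Σ (C Aₛ) λ x → U i x × κ i x ≡ w
      κ-surjective i w Vw with proj₂ (C.bijective i) (w , Vw)
      ... | (v , p) , e = into (v , C.U⊆X i p) , p , trans (κ-≡ i _ p) (e refl)

      κ-range : ∀ i x → U i x → C.V i (κ i x)
      κ-range i x p = subst (C.V i) (sym (κ-≡ i x p)) (proj₂ (DefinableMap.to (C.φ i) (proj₁ x , p)))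

      open-box : ∀ i W → Open W → ∀ x → U i x → W (proj₁ x) → Σ (Vec N d) λ lo → Σ (Vec N d) λ hi →
                 PW lo (κ i x) × PW (κ i x) hi × (∀ y → U i y → PW lo (κ i y) → PW (κ i y) hi → W (proj₁ y))
      open-box i W oW x p Wx = case oW i (κ i x) ((proj₁ x , p) , Wx , κ-≡ i x p) of λ
        { (lo , hi , l , h , sub) → lo , hi , l , h , λ y q ly yh → inside y q (sub (κ i y) ly yh) }
        where
          inside : ∀ y → U i y → image 𝓝 (C.φ i) W (κ i y) → W (proj₁ y)
          inside y q ((v , r) , Wv , e) = subst W (proj₁ (C.bijective i) {_ , r} {_ , q} (trans (sym e) (κ-≡ i y q))) Wv

    Corner : Vec N d → Vec N d → Vec N d → Set ℓ
    Corner lo hi w = PW lo w × PW w hi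

    Chartbox : Fin size → Vec N d → Vec N d → Vec N n → Set ℓ
    Chartbox i lo hi = preimage 𝓝 (C.φ i) (Corner lo hi)

    opaque
      chartbox-open : ∀ i lo hi → Open (Chartbox i lo hi)
      chartbox-open i lo hi j = transition j i (Corner lo hi) λ v (l , h) → lo , hi , l , h , λ w p q → p , q

      chartbox-in : ∀ i lo hi x → U i x → PW lo (κ i x) → PW (κ i x) hi → Chartbox i lo hi (proj₁ x)
      chartbox-in i lo hi x p l h = p , subst (PW lo) (κ-≡ i x p) l , subst (λ w → PW w hi) (κ-≡ i x p) h

      chartbox-out : ∀ i lo hi x → Chartbox i lo hi (proj₁ x) → U i x × PW lo (κ i x) × PW (κ i x) hi
      chartbox-out i lo hi x (p , l , h) = p , subst (PW lo) (sym (κ-≡ i x p)) l , subst (λ w → PW w hi) (sym (κ-≡ i x p)) h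

    i₀ : Fin size
    i₀ = proj₁ (covers (proj₂ ε))

    U1# : U i₀ 1#
    U1# = proj₂ (covers (proj₂ ε))

    opaque
      IsBase-def : DefP (Vₛ d ⊗ Vₛ d) (λ u → PW (proj₁ u) (κ i₀ 1#) × PW (κ i₀ 1#) (proj₂ u))
      IsBase-def = def-× (def-app₂ {R = PW} PW-def u1 (m-const _)) (def-app₂ {R = PW} PW-def (m-const _) v0)

    -- The boxes around the neutral element in one chart index a definable neighbourhood base.
    Uₛ : Sort
    Uₛ = Subₛ (Vₛ d ⊗ Vₛ d) (λ u → PW (proj₁ u) (κ i₀ 1#) × PW (κ i₀ 1#) (proj₂ u)) IsBase-def

    B : C Uₛ → C Aₛ → Set ℓ
    B ((lo , hi) , _) x = U i₀ x × PW lo (κ i₀ x) × PW (κ i₀ x) hi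

    opaque
      B-def₀ : DefP (Uₛ ⊗ Aₛ) (λ ux → B (proj₁ ux) (proj₂ ux))
      B-def₀ = def-× (def-app (U-def i₀) v0)
        (def-× (def-app₂ {R = PW} PW-def (m-∘ u1 lohi) (κ-def i₀ v0)) (def-app₂ {R = PW} PW-def (κ-def i₀ v0) (m-∘ v0 lohi)))
        where
          lohi : DefM (Uₛ ⊗ Aₛ) (Vₛ d ⊗ Vₛ d) (λ ux → proj₁ (proj₁ ux))
          lohi = m-∘ (s→M (s-incl {dP = IsBase-def})) u1

      B-1# : ∀ u → B u 1#
      B-1# ((lo , hi) , p) = U1# , toWitness p

      nbhd-base : ∀ W → Open W → W (proj₁ 1#) → Σ (C Uₛ) λ u → ∀ x → B u x → W (proj₁ x)
      nbhd-base W oW W1 = case open-box i₀ W oW 1# U1# W1 of λ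
        { (lo , hi , l , h , sub) → ((lo , hi) , fromWitness (l , h)) , λ x (p , q , r) → sub x p q r }

      Bset : C Uₛ → Vec N n → Set ℓ
      Bset ((lo , hi) , _) = Chartbox i₀ lo hi

      Bset-open : ∀ u → Open (Bset u)
      Bset-open ((lo , hi) , _) = chartbox-open i₀ lo hi

      Bset⇒B : ∀ u x → Bset u (proj₁ x) → B u x
      Bset⇒B ((lo , hi) , _) x = chartbox-out i₀ lo hi x

      B⇒Bset : ∀ u x → B u x → Bset u (proj₁ x)
      B⇒Bset ((lo , hi) , _) x (p , q , r) = chartbox-in i₀ lo hi x p q r

      B-∩ : ∀ u u′ → Σ (C Uₛ) λ w → ∀ x → B w x → B u x × B u′ x
      B-∩ ((lo , hi) , p) ((lo′ , hi′) , p′) =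
        case PW-sup lo lo′ (κ i₀ 1#) (proj₁ (toWitness p)) (proj₁ (toWitness p′)) of λ
          { (m , q , h) → case PW-inf hi hi′ (κ i₀ 1#) (proj₂ (toWitness p)) (proj₂ (toWitness p′)) of λ
            { (m′ , q′ , h′) → ((m , m′) , fromWitness (q , q′)) , λ x (a , b , c) →
                (a , proj₁ (h _ b) , proj₁ (h′ _ c)) , (a , proj₂ (h _ b) , proj₂ (h′ _ c)) } }

      B-div : ∀ u → Σ (C Uₛ) λ w → ∀ x y → B w x → B w y → B u (x · inv y)
      B-div u = case ∙-continuous ε ε (Bset u) (Bset-open u) (subst (Bset u) (sym (I.identityˡ ε)) (B⇒Bset u 1# (B-1# u))) of λ
        { (W₁ , W₂ , o₁ , o₂ , ε₁ , ε₂ , mul) →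
          case nbhd-base W₁ o₁ ε₁ of λ
          { (u₁ , h₁) → case nbhd-base _ (⁻¹-continuous W₂ o₂) (proj₂ ε , subst W₂ (sym inv-ε) ε₂) of λ
          { (u₂ , h₂) → case B-∩ u₁ u₂ of λ
          { (w , h) → w , λ x y p q → Bset⇒B u (x · inv y) (mul (out x) (out (inv y)) (h₁ x (proj₁ (h x p))) (lem W₂ y (h₂ y (proj₂ (h y q))))) } } } }
        where
          inv-ε : proj₁ ((proj₁ ε , proj₂ ε) ⁻¹) ≡ proj₁ ε
          inv-ε = trans (sym (I.identityʳ (ε ⁻¹))) (I.inverseˡ ε)
          lem : ∀ (W₂ : Vec N n → Set ℓ) (y : C Aₛ) → (Σ (Mem (proj₁ y)) λ p → W₂ (proj₁ ((proj₁ y , p) ⁻¹))) → W₂ (proj₁ (inv y))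
          lem W₂ y (p , q) = subst W₂ (I.⁻¹-cong {proj₁ y , p} {out y} refl) q

      -- A point outside of the chart is missed by every box; inside, coordinates are injective and
      -- a box separates distinct vectors. Separation from the neutral element suffices, since
      -- `close⇒≡` reduces uniqueness of limits to it by translation.
      B-Hausdorff : ∀ x → ¬ x ≡ 1# → Σ (C Uₛ) λ u → ¬ B u x
      B-Hausdorff x x≢1 = case em {P = U i₀ x} of λ
        { (no ¬p) → case around (κ i₀ 1#) of λ
            { (lo , hi , p , q) → ((lo , hi) , fromWitness (p , q)) , λ b → ¬p (proj₁ b) }
        ; (yes p) → case separate (κ i₀ 1#) (κ i₀ x) (λ e → x≢1 (κ-injective i₀ p U1# (sym e))) of λ
            { (lo , hi , q , r , ¬b) → ((lo , hi) , fromWitness (q , r)) , λ b → ¬b (proj₂ b) } }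

      open-translate : ∀ W → Open W → ∀ x → W (proj₁ x) → Σ (C Uₛ) λ u → ∀ y → B u y → W (proj₁ (x · y))
      open-translate W oW x Wx = case ∙-continuous (out x) ε W oW (subst W (sym (I.identityʳ (out x))) Wx) of λ
        { (W₁ , W₂ , o₁ , o₂ , x₁ , ε₂ , mul) → case nbhd-base W₂ o₂ ε₂ of λ
          { (u , h) → u , λ y b → mul (out x) (out y) x₁ (h y b) } }

      -- Definable compactness speaks of open sets, `Limit` of translated base boxes; continuity of
      -- left multiplication provides an open set inside the translate.
      nbhd-open : ∀ u x → Σ (Vec N n → Set ℓ) λ W → Open W × W (proj₁ x) × (∀ y → W (proj₁ y) → B u (inv x · y))
      nbhd-open u x = case ∙-continuous (out (inv x)) (out x) (Bset u) (Bset-open u)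
                             (subst (Bset u) (sym (cong proj₁ (G.inverseˡ x))) (B⇒Bset u 1# (B-1# u))) of λ
        { (W₁ , W₂ , o₁ , o₂ , x₁ , x₂ , mul) →
          W₂ , o₂ , x₂ , λ y Wy → Bset⇒B u (inv x · y) (mul (out (inv x)) (out y) x₁ Wy) }

    B-def : ∀ {S f g} → DefM S Uₛ f → DefM S Aₛ g → DefP S (λ s → B (f s) (g s))
    B-def = def-app₂ {R = B} B-def₀

  -- Dimension of definable subsets of sorts

  DimS : (S : Sort) → ℕ → (C S → Set ℓ) → Set ℓ
  DimS S l X = Dim (dim S) l λ v → Σ (C S) λ s → enc S s ≡ v × X s

  opaque
    points-def : ∀ {S} {X : C S → Set ℓ} → DefP S X → DefP (Vₛ (dim S)) (λ v → Σ (C S) λ s → enc S s ≡ v × X s)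
    points-def dX = Def→DefP (DefP.get dX)

    DimS-mono : ∀ S l {X Y : C S → Set ℓ} → (∀ s → X s → Y s) → DimS S l X → DimS S l Y
    DimS-mono S l f = Dim-mono (dim S) l λ v (s , e , p) → s , e , f s p

    DimS-image : ∀ S T l k {X : C S → Set ℓ} {R : C S → C T → Set ℓ} → DefP S X →
                 DefP (S ⊗ T) (λ st → R (proj₁ st) (proj₂ st)) →
                 (∀ s → X s → Σ (C T) (R s)) → (∀ t → ¬ DimS S (suc k) (λ s → X s × R s t)) →
                 DimS S l X → DimS T (l ∸ k) (λ t → Σ (C S) λ s → X s × R s t)
    DimS-image S T l k {X} {R} dX dR total fibre δ =
      Dim-mono (dim T) (l ∸ k) (λ { w (v , (s , refl , Xs) , (s′ , t , e , e′ , Rst)) →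
          t , e′ , s′ , subst X (sym (enc-injective S e)) Xs , Rst })
        (Dim-image (dim S) (dim T) l k (points-def dX) dR′
          (λ { v (s , e , Xs) → let (t , r) = total s Xs in enc T t , s , t , e , refl , r })
          fibre′ δ)
      where
        R′ : Vec N (dim S) → Vec N (dim T) → Set ℓ
        R′ v w = Σ (C S) λ s → Σ (C T) λ t → enc S s ≡ v × enc T t ≡ w × R s t
        dR′ : DefP (Vₛ (dim S) ⊗ Vₛ (dim T)) (λ vw → R′ (proj₁ vw) (proj₂ vw))
        dR′ = def-∃ S (def-∃ T (def-× (def-≡ (m-enc {T = S} v1) u2′) (def-× (def-≡ (m-enc {T = T} v0) v2′)
                (def-app₂ {R = R} dR v1 v0))))
          where
            u2′ : DefM (Vₛ (dim S) ⊗ Vₛ (dim T) ⊗ S ⊗ T) (Vₛ (dim S)) (λ s → proj₁ (proj₁ (proj₁ s)))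
            u2′ = u3
            v2′ : DefM (Vₛ (dim S) ⊗ Vₛ (dim T) ⊗ S ⊗ T) (Vₛ (dim T)) (λ s → proj₂ (proj₁ (proj₁ s)))
            v2′ = v2
        fibre′ : ∀ w → ¬ Dim (dim S) (suc k) (λ v → (Σ (C S) λ s → enc S s ≡ v × X s) × R′ v w)
        fibre′ w δ′ with Dim-nonempty (dim S) (suc k) δ′
        ... | _ , _ , (_ , t₀ , _ , e₀ , _) = fibre t₀ (Dim-mono (dim S) (suc k) (λ { v ((s , refl , Xs) , (s′ , t , e , e′ , r)) →
                s , refl , Xs , subst₂ R (enc-injective S e) (enc-injective T (trans e′ (sym e₀))) r }) δ′)

    DimS-injection : ∀ S T l {X : C S → Set ℓ} {R : C S → C T → Set ℓ} → DefP S X →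
                     DefP (S ⊗ T) (λ st → R (proj₁ st) (proj₂ st)) →
                     (∀ s → X s → Σ (C T) (R s)) → (∀ s s′ t → X s → X s′ → R s t → R s′ t → s ≡ s′) →
                     DimS S l X → DimS T l (λ t → Σ (C S) λ s → X s × R s t)
    DimS-injection S T l dX dR total inj = DimS-image S T l 0 dX dR total λ t →
      ¬Dim-singleton (dim S) λ { v v′ (s , refl , p , r) (s′ , refl , p′ , r′) → cong (enc S) (inj s s′ t p p′ r r′) }

    DimS-× : ∀ S T k l {X : C S → Set ℓ} {Y : C T → Set ℓ} → DimS S k X → DimS T l Y →
             DimS (S ⊗ T) (k + l) (λ st → X (proj₁ st) × Y (proj₂ st))
    DimS-× S T k l δ ε = Dim-mono (dim S + dim T) (k + l)
      (λ { _ (v , w , refl , (s , refl , p) , (t , refl , q)) → (s , t) , refl , p , q })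
      (Dim₂⇒Dim (dim S) (dim T) (k + l) (Dim₂-lower (dim S) (dim T) k l
        (Dim-mono (dim S) k (λ v p → Dim-mono (dim T) l (λ w q → p , q) ε) δ)))

  los his : ∀ n → Vec N (corners n) → Vec N n
  los zero    _           = []
  los (suc n) (a ∷ b ∷ p) = a ∷ los n p
  his zero    _           = []
  his (suc n) (a ∷ b ∷ p) = b ∷ his n p

  PW⇒InBox : ∀ n p w → PW (los n p) w → PW w (his n p) → InBox n p w
  PW⇒InBox zero    p           []      _        _        = lift tt
  PW⇒InBox (suc n) (a ∷ b ∷ p) (x ∷ w) (r ∷ rs) (s ∷ ss) = (r , s) , PW⇒InBox n p w rs ss

  centre : ∀ n p → Proper n p → Σ (Vec N n) λ w → PW (los n p) w × PW w (his n p)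
  centre zero    p           _         = [] , [] , []
  centre (suc n) (a ∷ b ∷ p) (ab , pr) with dense ab | centre n p pr
  ... | x , r , s | w , rs , ss = x ∷ w , r ∷ rs , s ∷ ss

  PW⇒Full : ∀ n lo w hi → PW lo w → PW w hi → Full n (λ v → PW lo v × PW v hi)
  PW⇒Full zero    []       []      []       []       []       = [] , []
  PW⇒Full (suc n) (a ∷ lo) (x ∷ w) (b ∷ hi) (r ∷ rs) (s ∷ ss) = inj₂ (a , b , <-trans r s , λ y ay yb →
    Dim-mono n n (λ v (p , q) → ay ∷ p , yb ∷ q) (PW⇒Full n lo w hi rs ss))

  opaque
    Initially-∩ : ∀ {D P P′ : N → Set ℓ} → Initially _<_ D P → Initially _<_ D P′ → Initially _<_ D (λ x → P x × P′ x)
    Initially-∩ (e , De , h) (e′ , De′ , h′) with tri e e′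
    ... | inj₁ p           = e , De , λ x Dx q → h x Dx q , h′ x Dx λ r → q (<-trans p r)
    ... | inj₂ (inj₁ refl) = e , De , λ x Dx q → h x Dx q , h′ x Dx q
    ... | inj₂ (inj₂ p)    = e′ , De′ , λ x Dx q → (h x Dx λ r → q (<-trans p r)) , h′ x Dx q

    Initially-∀ : ∀ {D : N → Set ℓ} k {P : Fin k → N → Set ℓ} → Σ N D → (∀ i → Initially _<_ D (P i)) →
                  Initially _<_ D (λ x → ∀ i → P i x)
    Initially-∀ zero    (x , Dx) h = x , Dx , λ _ _ _ ()
    Initially-∀ (suc k) d h with Initially-∩ (h zero) (Initially-∀ k d (h ∘ suc))
    ... | e , De , g = e , De , λ x Dx q → λ { zero → proj₁ (g x Dx q) ; (suc i) → proj₂ (g x Dx q) i }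

    Initially-mono : ∀ {D P P′ : N → Set ℓ} → (∀ x → D x → P x → P′ x) → Initially _<_ D P → Initially _<_ D P′
    Initially-mono f (e , De , h) = e , De , λ x Dx q → f x Dx (h x Dx q)

    Initially-point : ∀ {D P : N → Set ℓ} → Initially _<_ D P → Σ N λ x → D x × P x
    Initially-point (e , De , h) = e , De , h e De <-irrefl

    Initially-⋃ : ∀ {D : N → Set ℓ} k {P : Fin k → N → Set ℓ} → DefP Nₛ D → (∀ i → DefP Nₛ (P i)) → Σ N D →
                  (∀ x → Σ (Fin k) λ i → P i x) → Σ (Fin k) λ i → Initially _<_ D (P i)
    Initially-⋃ {D} k {P} dD dP d h = by-contra λ n →
      case Initially-point (Initially-∀ k d λ i → case LineLaws.initially <-laws {D} {P i} dD (dP i) d of λ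
        { (inj₁ p) → ⊥-elim (n (i , p)) ; (inj₂ p) → p }) of λ
      { (x , _ , q) → q (proj₁ (h x)) (proj₂ (h x)) }

  Near : N → (N → Set ℓ) → Set ℓ
  Near x P = Σ N λ l → Σ N λ r → l < x × x < r × (∀ y → l < y → y < r → P y)

  opaque
    Near-∀ : ∀ k {x} {P : Fin k → N → Set ℓ} → (∀ i → Near x (P i)) → Near x (λ y → ∀ i → P i y)
    Near-∀ zero    {x} h = let (l , p) = lower-exists x ; (r , q) = upper-exists x in l , r , p , q , λ _ _ _ ()
    Near-∀ (suc k) {x} {P} h with h zero | Near-∀ k (h ∘ suc)
    ... | l , r , lx , xr , f | l′ , r′ , l′x , xr′ , g with between₂ lx l′x | min₂ xr xr′
    ... | m , lm , l′m , mx | m′ , xm′ , m′r , m′r′ = m , m′ , mx , xm′ , λ y p q →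
          λ { zero → f y (<-trans lm p) (<-trans q m′r) ; (suc i) → g y (<-trans l′m p) (<-trans q m′r′) i }

  -- Limits of curves in a definably compact group

  module Compact (A : DefinableGroup 𝓝) (τ : GroupManifold 𝓝 A) (compact : DefinablyCompact 𝓝 τ) where
    open Topology A τ public

    opaque
      -- Some chart captures a part of `X` of dimension `d`. Its coordinates map that part
      -- injectively into a space with exactly `d` coordinates, where a set of dimension `d`
      -- contains a box.
      interior : ∀ {X : C Aₛ → Set ℓ} → DefP Aₛ X → DimS Aₛ d X → Σ (C Aₛ) λ x → Σ (C Uₛ) λ u → ∀ y → B u y → X (x · y)
      interior {X} dX δ = inChart (Dim-⋃ n d size
        {λ i v → Σ (C Aₛ) λ x → proj₁ x ≡ v × (X x × U i x)} (λ i → points-def {Aₛ} (def-× dX (U-def i)))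
        (Dim-mono n d (λ v (x , e , p) → let (i , q) = covers (toWitness (proj₂ x)) in i , x , e , p , q) δ))
        where
          Image : Fin size → Vec N d → Set ℓ
          Image i w = Σ (C Aₛ) λ x → (X x × U i x) × κ i x ≡ w
          dImage : ∀ i → DefP (Vₛ d) (Image i)
          dImage i = def-∃ Aₛ (def-× (def-× (def-app dX v0) (def-app (U-def i) v0)) (def-≡ (κ-def i v0) u1))
          onBox : ∀ i p → (∀ w → InBox d p w → Image i w) → (Σ (Vec N d) λ w → PW (los d p) w × PW w (his d p)) →
                  Σ (C Aₛ) λ x → Σ (C Uₛ) λ u → ∀ y → B u y → X (x · y)
          onBox i p h (w , r , s) = case h w (PW⇒InBox d p w r s) of λ
            { (x , (Xx , Ux) , refl) →
              case open-translate (Chartbox i (los d p) (his d p)) (chartbox-open i (los d p) (his d p)) x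
                     (chartbox-in i (los d p) (his d p) x Ux r s) of λ
              { (u , g) → x , u , λ y b → case chartbox-out i (los d p) (his d p) (x · y) (g y b) of λ
                { (Uxy , r′ , s′) → case h (κ i (x · y)) (PW⇒InBox d p _ r′ s′) of λ
                  { (z , (Xz , Uz) , e) → subst X (κ-injective i Uz Uxy e) Xz } } } }
          inChart : (Σ (Fin size) λ i → DimS Aₛ d (λ x → X x × U i x)) →
                    Σ (C Aₛ) λ x → Σ (C Uₛ) λ u → ∀ y → B u y → X (x · y)
          inChart (i , δᵢ) = case Full⇒box d (dImage i) (Dim-mono d d (λ { w (_ , refl , p) → p })
              (DimS-injection Aₛ (Vₛ d) d {λ x → X x × U i x} {λ x w → κ i x ≡ w} (def-× dX (U-def i)) (def-≡ (κ-def i u1) v0)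
                (λ x _ → κ i x , refl) (λ x x′ w p q e e′ → κ-injective i (proj₂ p) (proj₂ q) (trans e (sym e′))) δᵢ)) of λ
            { (p , pr , h) → onBox i p h (centre d p pr) }

      full : DimS Aₛ d (λ _ → Lift ℓ ⊤)
      full = case C.V-open i₀ (κ i₀ 1#) (κ-range i₀ 1# U1#) of λ
        { (lo , hi , r , s , sub) → DimS-mono Aₛ d (λ _ _ → lift tt)
            (DimS-injection (Vₛ d) Aₛ d {Corner lo hi} {λ w x → U i₀ x × κ i₀ x ≡ w}
              (def-× (def-app₂ {R = PW} PW-def (m-const lo) m-id) (def-app₂ {R = PW} PW-def m-id (m-const hi)))
              (def-× (def-app (U-def i₀) v0) (def-≡ (κ-def i₀ v0) u1))
              (λ w (p , q) → κ-surjective i₀ w (sub w p q))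
              (λ w w′ x _ _ (_ , e) (_ , e′) → trans (sym e) e′)
              (Dim-mono d d (λ w p → w , refl , p) (PW⇒Full d lo (κ i₀ 1#) hi r s))) }

    Limit : (N → Set ℓ) → (N → C Aₛ) → C Aₛ → Set ℓ
    Limit D c z = ∀ u → Initially _<_ D λ x → B u (inv z · c x)

    private
      module Curve {D : N → Set ℓ} (dD : DefP Nₛ D) (c : N → C Aₛ) (dc : DefM Nₛ Aₛ c)
                   (a : N ±) (e : N) (De : D e) (sub : ∀ x → a <± ⟨ x ⟩ → ¬ (e < x) → D x)
                   (low : ∀ x → D x → a <± ⟨ x ⟩) where
        f : Fin size → Fin d → N → N
        f i j x = lookup (κ i (c x)) j

        df : ∀ i j → DefM Nₛ Nₛ (f i j)
        df i j = m-∘ (s→M (s-lookup j)) (κ-def i dc)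

        open Monotone using (Good; good-def; RelF; RelF-def; Cont; monotonicity)

        opaque
          -- If no kind held near the lower end, all three would fail there by `initially`, against
          -- `monotonicity` on an interval close to that end.
          kind : ∀ i j → Σ Kind λ k → Initially _<_ D (Good (f i j) (df i j) k)
          kind i j = case test con of λ { (inj₁ p) → con , p ; (inj₂ p) →
                     case test inc of λ { (inj₁ q) → inc , q ; (inj₂ q) →
                     case test dec of λ { (inj₁ r) → dec , r ; (inj₂ r) →
                     ⊥-elim (none (Initially-∩ (Initially-∩ p q) (Initially-∩ r (e , De , λ x _ s → s)))) } } }
            where
              G : Kind → N → Set ℓ
              G = Good (f i j) (df i j)
              test : ∀ k → Initially _<_ D (G k) ⊎ Initially _<_ D (λ x → ¬ G k x)
              test k = LineLaws.initially <-laws dD (good-def (f i j) (df i j) k) (e , De)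
              none : ¬ Initially _<_ D (λ x → (¬ G con x × ¬ G inc x) × (¬ G dec x × ¬ (e < x)))
              none (e₁ , De₁ , h) = case left± a (low e₁ De₁) of λ
                { (y , ay , ye₁) → case monotonicity (f i j) (df i j) ye₁ of λ
                  { (a′ , b′ , k , (a′b′ , in-ye₁) , good) → case dense a′b′ of λ
                    { (x , a′x , xb′) →
                      let yx = proj₁ (in-ye₁ x a′x xb′)
                          xe₁ = proj₂ (in-ye₁ x a′x xb′)
                          ¬ee₁ = proj₂ (proj₂ (h e₁ De₁ <-irrefl))
                          ¬g = h x (sub x (<±-<-trans ay yx) (λ ex → ¬ee₁ (<-trans ex xe₁))) (asym xe₁)
                      in refute k ¬g (good x a′x xb′) } } }
                where
                  refute : ∀ k {x} → (¬ G con x × ¬ G inc x) × (¬ G dec x × ¬ (e < x)) → ¬ G k x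
                  refute con ((p , _) , _) = p
                  refute inc ((_ , p) , _) = p
                  refute dec (_ , (p , _)) = p

          in-chart : Σ (Fin size) λ i → Initially _<_ D (λ x → U i (c x))
          in-chart = Initially-⋃ size dD (λ i → def-app (U-def i) dc) (e , De) (λ x → covers (toWitness (proj₂ (c x))))

        i : Fin size
        i = proj₁ in-chart

        k : Fin d → Kind
        k j = proj₁ (kind i j)

        Nice : N → Set ℓ
        Nice x = U i (c x) × (∀ j → Good (f i j) (df i j) (k j) x) × ¬ (e < x)

        opaque
          nice : Initially _<_ D Nice
          nice = Initially-mono (λ x _ ((p , q) , r) → p , q , r)
            (Initially-∩ (Initially-∩ (proj₂ in-chart) (Initially-∀ d (e , De) λ j → proj₂ (kind i j))) (e , De , λ x _ s → s))

        e₁ : N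
        e₁ = proj₁ nice

        De₁ : D e₁
        De₁ = proj₁ (proj₂ nice)

        opaque
          inside-D : ∀ x → a <± ⟨ x ⟩ → x < e₁ → D x
          inside-D x p q = sub x p λ ex → proj₂ (proj₂ (proj₂ (proj₂ nice) e₁ De₁ <-irrefl)) (<-trans ex q)

          inside : ∀ x → a <± ⟨ x ⟩ → x < e₁ → Nice x
          inside x p q = proj₂ (proj₂ nice) x (inside-D x p q) (asym q)

          globally : ∀ j x z → a <± ⟨ x ⟩ → x < z → z < e₁ → Rel (k j) (f i j x) (f i j z)
          globally j x z ax xz ze₁ = case left± a ax of λ
            { (y , ay , yx) → local→global (RelF-def (f i j) (df i j) (k j)) (Rel-trans (k j)) {y} {e₁}
                (λ w yw we₁ → proj₁ (proj₁ (proj₂ (inside w (<±-<-trans ay yw) we₁)) j)) x z yx xz ze₁ }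

          start : Σ N λ x → a <± ⟨ x ⟩ × x < e₁
          start = left± a (low e₁ De₁)

          -- Compactness speaks only of injective curves, so the eventually constant ones are
          -- treated apart.
          constant-limit : (∀ j → k j ≡ con) → Σ (C Aₛ) (Limit D c)
          constant-limit h = c x₀ , λ u → x₀ , inside-D x₀ ax₀ x₀e₁ , λ x Dx q →
            subst (λ y → B u (inv (c x₀) · y)) (sym (const-below x Dx (tri x x₀) q)) (subst (B u) (sym (G.inverseˡ (c x₀))) (B-1# u))
            where
              x₀ : N
              x₀ = proj₁ start
              ax₀ : a <± ⟨ x₀ ⟩
              ax₀ = proj₁ (proj₂ start)
              x₀e₁ : x₀ < e₁
              x₀e₁ = proj₂ (proj₂ start)
              same : ∀ j x z → a <± ⟨ x ⟩ → x < z → z < e₁ → f i j x ≡ f i j z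
              same j x z p q r = subst (λ κ → Rel κ (f i j x) (f i j z)) (h j) (globally j x z p q r)
              const-below : ∀ x → D x → x < x₀ ⊎ x ≡ x₀ ⊎ x₀ < x → ¬ (x₀ < x) → c x ≡ c x₀
              const-below x Dx (inj₁ p) q = κ-injective i (proj₁ (inside x (low x Dx) (<-trans p x₀e₁))) (proj₁ (inside x₀ ax₀ x₀e₁))
                (trans (sym (tabulate∘lookup _)) (trans (tabulate-cong (λ j → same j x x₀ (low x Dx) p x₀e₁)) (tabulate∘lookup _)))
              const-below x Dx (inj₂ (inj₁ e)) q = cong c e
              const-below x Dx (inj₂ (inj₂ p)) q = ⊥-elim (q p)

        Dom : N → Set ℓ
        Dom = Interval 𝓝 a ⟨ e₁ ⟩

        opaque
          graph-def : Definable 𝓝 (Graph 𝓝 {m = 1} {X = λ v → Dom (head v)} (λ (v , _) → proj₁ (c (head v))))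
          graph-def = Def⇒Definable (Def-resp
            (λ { w ((t , y) , e , (at , te₁) , refl) → (t ∷ [] , at , [ te₁ ]<±) , sym e })
            (λ { w ((t ∷ [] , at , te₁) , e) → (t , c t) , sym e , (at , un<± te₁) , refl })
            (DefP.get (def-× {Nₛ ⊗ Aₛ} {λ s → a <± ⟨ proj₁ s ⟩ × proj₁ s < e₁} {λ s → c (proj₁ s) ≡ proj₂ s}
                         (def-× (def-app (above±-def a) u1) (def-< u1 (m-const e₁))) (def-≡ (m-∘ dc u1) v0))))

        σ : DefinableMap 𝓝 {1} (λ v → Dom (head v)) (DefinableGroup.Mem A)
        σ = record { func = record { to = λ (v , _) → out (c (head v)) ; cong = cong (λ v → proj₁ (c (head v))) }
                   ; definable = graph-def }

        opaque
          σ-continuous : CurveContinuous 𝓝 τ σ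
          σ-continuous W oW (x ∷ []) ((ax , xe₁) , Wx) =
            case open-box i W oW (c x) (proj₁ nx) Wx of λ
            { (lo , hi , r , s , boxW) →
              case Near-∀ d {x} {λ j y → lookup lo j < f i j y × f i j y < lookup hi j}
                     (λ j → proj₂ (proj₁ (proj₂ nx) j) (lookup lo j) (lookup hi j) (PW-lookup r j) (PW-lookup s j)) of λ
              { (l , m , lx , xm , near) → case left± a ax of λ { (y , ay , yx) →
                case between₂ lx yx of λ { (l′ , ll′ , yl′ , l′x) →
                case min₂ xm (un<± xe₁) of λ { (m′ , xm′ , m′m , m′e₁) →
                  (l′ ∷ []) , (m′ ∷ []) , (l′x ∷ []) , (xm′ ∷ []) , λ { (w ∷ []) (l′w ∷ []) (wm′ ∷ []) →
                    let aw = <±-<-trans ay (<-trans yl′ l′w)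
                        we₁ = <-trans wm′ m′e₁
                        g = near w (<-trans ll′ l′w) (<-trans wm′ m′m)
                    in (aw , [ we₁ ]<±) , boxW (c w) (proj₁ (inside w aw we₁))
                         (PW-tabulate (λ j → proj₁ (g j))) (PW-tabulate (λ j → proj₂ (g j))) } } } } } }
            where
              nx : Nice x
              nx = inside x ax (un<± xe₁)

          -- One coordinate of a strict kind is enough to make the curve injective on `(a , e₁)`,
          -- and the limit at the left end comes from compactness.
          moving-limit : ∀ j → ¬ k j ≡ con → Σ (C Aₛ) (Limit D c)
          moving-limit j k≢con = case compact (low e₁ De₁) σ σ-continuous (λ {v} {w} → σ-injective v w) of λ
            { ((z , left) , _) → into z , λ u → case nhbd u z of λ
              { (W , oW , Wz , h) → case left W oW Wz of λ
                { (t , (at , te₁) , g) → case left± a at of λ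
                  { (t′ , at′ , t′t) → t′ , inside-D t′ at′ (<-trans t′t (un<± te₁)) , λ x Dx q →
                      h (c x) (g x (low x Dx , [ <-trans (⊑⊏ q t′t) (un<± te₁) ]<±) (⊑⊏ q t′t)) } } } }
            where
              nhbd : ∀ u z → Σ (Vec N n → Set ℓ) λ W → Open W × W (proj₁ z) × (∀ y → W (proj₁ y) → B u (inv (into z) · y))
              nhbd u z = nbhd-open u (into z)
              distinct : ∀ x y → Dom x → Dom y → x < y → ¬ c x ≡ c y
              distinct x y (ax , _) (_ , ye₁) xy e = refute (k j) refl (globally j x y ax xy (un<± ye₁))
                where
                  refute : ∀ κ′ → k j ≡ κ′ → ¬ Rel κ′ (f i j x) (f i j y)
                  refute con e′ _ = k≢con e′
                  refute inc e′ p = <-irrefl (subst (λ z → f i j x < lookup (κ i z) j) (sym e) p)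
                  refute dec e′ p = <-irrefl (subst (λ z → f i j y < lookup (κ i z) j) e p)
              σ-injective : ∀ (v w : ∃ λ (v : Vec N 1) → Dom (head v)) → proj₁ (c (head (proj₁ v))) ≡ proj₁ (c (head (proj₁ w))) → proj₁ v ≡ proj₁ w
              σ-injective ((x ∷ []) , p) ((y ∷ []) , q) e with tri x y
              ... | inj₁ r           = ⊥-elim (distinct x y p q r (El≡ e))
              ... | inj₂ (inj₁ refl) = refl
              ... | inj₂ (inj₂ r)    = ⊥-elim (distinct y x q p r (El≡ (sym e)))

          curve-limit : Σ (C Aₛ) (Limit D c)
          curve-limit = case em {P = Σ (Fin d) λ j → ¬ k j ≡ con} of λ
            { (yes (j , p)) → moving-limit j p
            ; (no n) → constant-limit λ j → by-contra λ p → n (j , p) }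

    opaque
      limit : ∀ {D} → DefP Nₛ D → Σ N D → ∀ (c : N → C Aₛ) → DefM Nₛ Aₛ c → Σ (C Aₛ) (Limit D c)
      limit {D} dD x c dc = case initial-interval dD x of λ
        -- At a least point of `D` the type is realised by that point, so the limit is the value
        -- there.
        { (inj₁ (m , Dm , least)) → c m , λ u → m , Dm , λ x Dx q →
            subst (λ y → B u (inv (c m) · c y)) (equal m x (tri m x) (least x Dx) q) (subst (B u) (sym (G.inverseˡ (c m))) (B-1# u))
        ; (inj₂ (a , e , ae , De , sub , low)) → Curve.curve-limit dD c dc a e De sub low }
        where
          equal : ∀ m x → m < x ⊎ m ≡ x ⊎ x < m → ¬ (x < m) → ¬ (m < x) → m ≡ x
          equal m x (inj₁ p) q r = ⊥-elim (r p)
          equal m x (inj₂ (inj₁ p)) q r = p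
          equal m x (inj₂ (inj₂ p)) q r = ⊥-elim (q p)

  -- Limits along definable types

  -- P holds for the lexicographically initial definable type of X. This type is complete, and limits
  -- along it are definable in parameters, which makes up for the lack of definable choice.
  Gen : ∀ n → (X P : Vec N n → Set ℓ) → Set ℓ
  Gen zero    X P = P []
  Gen (suc n) X P = Initially _<_ (λ x → Σ (Vec N n) λ v → X (x ∷ v)) λ x → Gen n (λ v → X (x ∷ v)) (λ v → P (x ∷ v))

  opaque
    Initially-def : ∀ {S} {D P : C S → N → Set ℓ} → DefP (S ⊗ Nₛ) (λ sx → D (proj₁ sx) (proj₂ sx)) →
                    DefP (S ⊗ Nₛ) (λ sx → P (proj₁ sx) (proj₂ sx)) → DefP S (λ s → Initially _<_ (D s) (P s))
    Initially-def {D = D} {P} dD dP = def-∃ Nₛ (def-× dD (def-∀ Nₛ (def-→ (def-app₂ {R = D} dD u2 v0)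
      (def-→ (def-¬ (def-< v1 v0)) (def-app₂ {R = P} dP u2 v0)))))

    Gen-def : ∀ {S} n {X P : C S → Vec N n → Set ℓ} → DefP (S ⊗ Vₛ n) (λ sv → X (proj₁ sv) (proj₂ sv)) →
              DefP (S ⊗ Vₛ n) (λ sv → P (proj₁ sv) (proj₂ sv)) → DefP S (λ s → Gen n (X s) (P s))
    Gen-def zero    {X} {P} dX dP = def-app₂ {R = P} dP m-id (m-const [])
    Gen-def (suc n) {X} {P} dX dP = Initially-def
      (def-∃ (Vₛ n) (def-app₂ {R = X} dX u2 (m-∷ v1 v0)))
      (Gen-def n (def-app₂ {R = X} dX u2 (m-∷ v1 v0)) (def-app₂ {R = P} dP u2 (m-∷ v1 v0)))

    Gen-mono : ∀ n {X P Q : Vec N n → Set ℓ} → Σ (Vec N n) X → (∀ v → X v → P v → Q v) → Gen n X P → Gen n X Q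
    Gen-mono zero    ([] , x) f g = f [] x g
    Gen-mono (suc n) _        f g = Initially-mono (λ x Dx → Gen-mono n Dx λ v → f (x ∷ v)) g

    Gen-∩ : ∀ n {X P Q : Vec N n → Set ℓ} → Gen n X P → Gen n X Q → Gen n X (λ v → P v × Q v)
    Gen-∩ zero    p q = p , q
    Gen-∩ (suc n) p q = Initially-mono (λ x _ (p , q) → Gen-∩ n p q) (Initially-∩ p q)

    Gen-all : ∀ n {X P : Vec N n → Set ℓ} → Σ (Vec N n) X → (∀ v → X v → P v) → Gen n X P
    Gen-all zero    ([] , x)      f = f [] x
    Gen-all (suc n) ((a ∷ v) , x) f = a , (v , x) , λ b Db _ → Gen-all n Db λ w → f (b ∷ w)

    Gen-point : ∀ n {X P : Vec N n → Set ℓ} → Σ (Vec N n) X → Gen n X P → Σ (Vec N n) λ v → X v × P v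
    Gen-point zero    ([] , x) p = [] , x , p
    Gen-point (suc n) _        g with Initially-point g
    ... | x , Dx , g′ with Gen-point n Dx g′
    ... | v , p , q = x ∷ v , p , q

    Gen-em : ∀ n {X P : Vec N n → Set ℓ} → DefP (Vₛ n) X → DefP (Vₛ n) P → Σ (Vec N n) X → Gen n X P ⊎ Gen n X (λ v → ¬ P v)
    Gen-em zero {P = P} dX dP _ with em {P = P []}
    ... | yes p = inj₁ p
    ... | no ¬p = inj₂ ¬p
    Gen-em (suc n) {X} {P} dX dP ((a ∷ v) , x)
      with LineLaws.initially <-laws {λ x → Σ (Vec N n) λ v → X (x ∷ v)} {λ x → Gen n (λ v → X (x ∷ v)) (λ v → P (x ∷ v))}
             (def-∃ (Vₛ n) (def-app dX (m-∷ u1 v0)))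
             (Gen-def n (def-app dX (m-∷ u1 v0)) (def-app dP (m-∷ u1 v0))) (a , v , x)
    ... | inj₁ g = inj₁ g
    ... | inj₂ g = inj₂ (Initially-mono (λ x Dx ¬g → [ (λ g′ → ⊥-elim (¬g g′)) , id ]′
            (Gen-em n (def-app dX (m-∷ (m-const x) m-id)) (def-app dP (m-∷ (m-const x) m-id)) Dx)) g)

    Gen-cong : ∀ n {X Y P : Vec N n → Set ℓ} → (∀ v → X v → Y v) → (∀ v → Y v → X v) → Gen n X P → Gen n Y P
    Gen-cong zero    f g p = p
    Gen-cong (suc n) f g (e , De , h) = e , map₂ (f _) De , λ x Dx q →
      Gen-cong n (λ v → f (x ∷ v)) (λ v → g (x ∷ v)) (h x (map₂ (g _) Dx) q)

  -- Finite sets and curve selection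

  Listable : ∀ {n} → (Vec N n → Set ℓ) → Set ℓ
  Listable {n} X = Σ (List (Vec N n)) λ vs → ∀ v → X v → Any (v ≡_) vs

  opaque
    -- A complete type that contains a finite set contains one of its points. This is definable
    -- choice for finite fibres.
    Gen-finite : ∀ n {X : Vec N n → Set ℓ} → DefP (Vₛ n) X → Listable X → Σ (Vec N n) X →
                 Σ (Vec N n) λ w → Gen n X (_≡ w)
    Gen-finite n {X} dX (vs , h) x = search vs (Gen-all n x h)
      where
        search : ∀ vs → Gen n X (λ v → Any (v ≡_) vs) → Σ (Vec N n) λ w → Gen n X (_≡ w)
        search [] g with () ← proj₂ (proj₂ (Gen-point n x g))
        search (w ∷ vs) g with Gen-em n {X} {_≡ w} dX (def-≡ m-id (m-const w)) x
        ... | inj₁ p = w , p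
        ... | inj₂ p = search vs (Gen-mono n x (λ v _ → λ { (¬e , here e) → ⊥-elim (¬e e) ; (¬e , there z) → z }) (Gen-∩ n p g))

    Gen-≡-unique : ∀ n {X : Vec N n → Set ℓ} {v w} → Σ (Vec N n) X → Gen n X (_≡ v) → Gen n X (_≡ w) → v ≡ w
    Gen-≡-unique n x g h with Gen-point n x (Gen-∩ n g h)
    ... | _ , _ , (refl , e) = e

  Curve : ∀ {n} → (Vec N n → Set ℓ) → Set ℓ
  Curve {n} X = Σ N λ a → Σ N λ b → a < b × Σ (N → Vec N n) λ σ → DefM Nₛ (Vₛ n) σ ×
    (∀ t → a < t → t < b → X (σ t)) × (∀ s t → a < s → s < t → t < b → ¬ σ s ≡ σ t)

  opaque
    list-fibres : ∀ {n} {X : Vec N (suc n) → Set ℓ} (xs : List N) → (∀ x → Listable λ v → X (x ∷ v)) →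
                  Σ (List (Vec N (suc n))) λ vs → ∀ x v → Any (x ≡_) xs → X (x ∷ v) → Any (x ∷ v ≡_) vs
    list-fibres [] l = [] , λ _ _ ()
    list-fibres {n} {X} (x ∷ xs) l with list-fibres {X = X} xs l | l x
    ... | ws , h | vs , g = map (x ∷_) vs ++ˡ ws , λ
          { y v (here refl) p → ++⁺ˡ (map⁺ (Any-map (cong (x ∷_)) (g v p)))
          ; y v (there z) p → ++⁺ʳ (map (x ∷_) vs) (h y v z p) }

    -- If a fibre over the first coordinate is infinite, the curve is sought inside it. Otherwise
    -- the first coordinate fills an interval over which the fibres are finite, and `Gen-finite`
    -- selects from them; the parameter is then itself a coordinate, which makes the curve
    -- injective.
    infinite⇒curve : ∀ n {X : Vec N n → Set ℓ} → DefP (Vₛ n) X → ¬ Listable X → Curve X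
    infinite⇒curve zero dX ¬l = ⊥-elim (¬l (([] ∷ []) , λ { [] _ → here refl }))
    infinite⇒curve (suc n) {X} dX ¬l with em {P = Σ N λ x → ¬ Listable λ v → X (x ∷ v)}
    ... | yes (x , ¬lx) with infinite⇒curve n (def-app dX (m-∷ (m-const x) m-id)) ¬lx
    ...   | a , b , ab , σ , dσ , inX , inj = a , b , ab , (λ t → x ∷ σ t) , m-∷ (m-const x) dσ , inX ,
            λ s t p q r e → inj s t p q r (proj₂ (∷-injective e))
    infinite⇒curve (suc n) {X} dX ¬l | no ¬x = result base-interval
      where
        D : N → Set ℓ
        D x = Σ (Vec N n) λ v → X (x ∷ v)
        dFibre : DefP (Nₛ ⊗ Vₛ n) (λ xv → X (proj₁ xv ∷ proj₂ xv))
        dFibre = def-app dX (m-∷ u1 v0)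
        finite : ∀ x → Listable λ v → X (x ∷ v)
        finite x = by-contra λ m → ¬x (x , m)
        base-interval : ∃∞ D
        base-interval = by-contra λ m →
          let (xs , h) = LineLaws.discrete <-laws {D} (def-∃ (Vₛ n) dFibre) (λ a b p q → m (a , b , p , q))
              (vs , g) = list-fibres {X = X} xs finite
          in ¬l (vs , λ { (x ∷ v) p → g x v (h x (v , p)) p })
        open Description {Nₛ} {Vₛ n} (λ x v → Gen n (λ w → X (x ∷ w)) (_≡ v))
               (Gen-def n (def-app dX (m-∷ u2 v0)) (def-≡ v0 v1)) (tabulate λ _ → pt)
        result : ∃∞ D → Curve X
        result (a , b , ab , h) = a , b , ab , (λ x → x ∷ the x) , m-∷ m-id the-def , inX ,
            λ s t p q r e → <-irrefl (subst (s <_) (sym (proj₁ (∷-injective e))) q)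
          where
            inX : ∀ t → a < t → t < b → X (t ∷ the t)
            inX t p q with Gen-finite n (def-app dX (m-∷ (m-const t) m-id)) (finite t) (h t p q)
            ... | w , g with Gen-point n (h t p q) (the-sat t w g (λ w′ g′ → Gen-≡-unique n (h t p q) g′ g))
            ... | v , Xv , refl = Xv

  module Limits (A : DefinableGroup 𝓝) (τ : GroupManifold 𝓝 A) (compact : DefinablyCompact 𝓝 τ) where
    open Compact A τ compact public
    open import Algebra.Properties.Group elGroup
      using (⁻¹-anti-homo-∙; ⁻¹-involutive; ε⁻¹≈ε; \\-leftDividesˡ; \\-leftDividesʳ; x∙y⁻¹≈ε⇒x≈y) public

    opaque
      B-mul : ∀ u → Σ (C Uₛ) λ w → ∀ x y → B w x → B w y → B u (x · y)
      B-mul u = case B-div u of λ { (w , h) → case B-div w of λ { (w′ , h′) → case B-∩ w w′ of λ { (w″ , h″) →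
        w″ , λ x y p q → subst (λ z → B u (x · z)) (trans (cong inv (G.identityˡ (inv y))) (⁻¹-involutive y))
          (h x (1# · inv y) (proj₁ (h″ x p)) (h′ 1# y (B-1# w′) (proj₂ (h″ y q)))) } } }

      -- With `x` near both points, `inv z · z′` is the quotient of the small elements `inv z · x`
      -- and `inv z′ · x`, so it lies in every base neighbourhood.
      close⇒≡ : ∀ z z′ → (∀ w → Σ (C Aₛ) λ x → B w (inv z · x) × B w (inv z′ · x)) → z ≡ z′
      close⇒≡ z z′ h = by-contra λ z≢z′ → case B-Hausdorff (inv z · z′) (λ e → z≢z′ (trans (sym (G.identityʳ z))
          (trans (cong (z ·_) (sym e)) (\\-leftDividesˡ z z′)))) of λ
        { (u , ¬b) → case B-div u of λ { (w , g) → case h w of λ { (x , p , q) →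
            ¬b (subst (B u) (quotient x) (g _ _ p q)) } } }
        where
          quotient : ∀ x → (inv z · x) · inv (inv z′ · x) ≡ inv z · z′
          quotient x = trans (cong ((inv z · x) ·_) (trans (⁻¹-anti-homo-∙ (inv z′) x) (cong (inv x ·_) (⁻¹-involutive z′))))
            (trans (G.assoc (inv z) x (inv x · z′)) (cong (inv z ·_) (\\-leftDividesˡ x z′)))

    IsLim : ∀ m → (Vec N m → Set ℓ) → (Vec N m → C Aₛ) → C Aₛ → Set ℓ
    IsLim m X h z = ∀ u → Gen m X λ v → B u (inv z · h v)

    opaque
      IsLim-def : ∀ {S} m {X : C S → Vec N m → Set ℓ} {h : C S → Vec N m → C Aₛ} →
                  DefP (S ⊗ Vₛ m) (λ sv → X (proj₁ sv) (proj₂ sv)) → DefM (S ⊗ Vₛ m) Aₛ (λ sv → h (proj₁ sv) (proj₂ sv)) →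
                  DefP (S ⊗ Aₛ) (λ sz → IsLim m (X (proj₁ sz)) (h (proj₁ sz)) (proj₂ sz))
      IsLim-def m {X} {h} dX dh = def-∀ Uₛ (Gen-def m (def-app₂ {R = X} dX u3 v0)
        (B-def v1 (·-def (inv-def v2) (m-∘ dh (m-, u3 v0)))))

      IsLim-unique : ∀ m {X h z z′} → Σ (Vec N m) X → IsLim m X h z → IsLim m X h z′ → z ≡ z′
      IsLim-unique m {X} {h} {z} {z′} x p q = close⇒≡ z z′ λ w → case Gen-point m x (Gen-∩ m (p w) (q w)) of λ
        { (v , _ , r) → h v , r }

      IsLim-cong : ∀ m {X h h′ z} → Σ (Vec N m) X → (∀ v → X v → h v ≡ h′ v) → IsLim m X h z → IsLim m X h′ z
      IsLim-cong m {z = z} x e p u = Gen-mono m x (λ v Xv → subst (λ y → B u (inv z · y)) (e v Xv)) (p u)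

      IsLim-const : ∀ m {X} z → Σ (Vec N m) X → IsLim m X (λ _ → z) z
      IsLim-const m z x u = Gen-all m x λ v _ → subst (B u) (sym (G.inverseˡ z)) (B-1# u)

      compose-inv : ∀ z c h → (inv z · c) · (inv c · h) ≡ inv z · h
      compose-inv z c h = trans (G.assoc (inv z) c (inv c · h)) (cong (inv z ·_) (\\-leftDividesˡ c h))

      -- An iterated limit. Limits over the fibres of the first coordinate exist by induction and
      -- are unique, so they form a definable curve in that coordinate, which has a limit in turn;
      -- `B-mul` adds the two errors.
      IsLim-exists : ∀ m {X : Vec N m → Set ℓ} {h : Vec N m → C Aₛ} → DefP (Vₛ m) X → DefM (Vₛ m) Aₛ h →
                     Σ (Vec N m) X → Σ (C Aₛ) (IsLim m X h)
      IsLim-exists zero    {X} {h} dX dh _ = h [] , λ u → subst (B u) (sym (G.inverseˡ (h []))) (B-1# u)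
      IsLim-exists (suc m) {X} {h} dX dh ((a ∷ v) , Xav) =
        case limit {λ x → Σ (Vec N m) λ v → X (x ∷ v)} (def-∃ (Vₛ m) (def-app dX (m-∷ u1 v0))) (a , v , Xav) Fib.the Fib.the-def of λ
          { (z , lim) → z , λ u → case B-mul u of λ { (w , mul) →
              Initially-mono (λ x Dx b → Gen-mono m Dx
                  (λ v _ b′ → subst (B u) (compose-inv z (Fib.the x) (h (x ∷ v))) (mul _ _ b b′)) (fibre x Dx w))
                (lim w) } }
        where
          module Fib = Description {Nₛ} {Aₛ} (λ x z → IsLim m (λ v → X (x ∷ v)) (λ v → h (x ∷ v)) z)
            (IsLim-def m (def-app dX (m-∷ u1 v0)) (m-∘ dh (m-∷ u1 v0))) 1#
          fibre : ∀ x → (Σ (Vec N m) λ v → X (x ∷ v)) → IsLim m (λ v → X (x ∷ v)) (λ v → h (x ∷ v)) (Fib.the x)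
          fibre x Dx = case IsLim-exists m (def-app dX (m-∷ (m-const x) m-id)) (m-∘ dh (m-∷ (m-const x) m-id)) Dx of λ
            { (z , p) → Fib.the-sat x z p λ z′ p′ → IsLim-unique m Dx p′ p }

      Limit-unique : ∀ {D c z z′} → Limit D c z → Limit D c z′ → z ≡ z′
      Limit-unique {c = c} {z} {z′} p q = close⇒≡ z z′ λ w → case Initially-point (Initially-∩ (p w) (q w)) of λ
        { (x , _ , r) → c x , r }

  -- Rigidity

  module Decode (H : DefinableGroup 𝓝) where
    open GroupSort H
    private
      module E = Description {Vₛ (DefinableGroup.dim H)} {Gₛ} (λ v x → proj₁ x ≡ v) (def-≡ (m-enc {T = Gₛ} v0) u1) 1#

    -- `IsLim` runs over vectors, so points are recovered from their codes, with `1#` at vectors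
    -- that encode none.
    decode : Vec N (DefinableGroup.dim H) → C Gₛ
    decode = E.the

    decode-def : ∀ {S f} → DefM S (Vₛ (DefinableGroup.dim H)) f → DefM S Gₛ (λ s → decode (f s))
    decode-def = m-∘ E.the-def

    opaque
      decode-proj₁ : ∀ x → decode (proj₁ x) ≡ x
      decode-proj₁ x = E.the-unique (proj₁ x) x refl λ _ → El≡

    connected : DefinablyConnected 𝓝 H → ∀ {P : C Gₛ → Set ℓ} → DefP Gₛ P → P 1# →
                (∀ x y → P x → P y → P (x · y)) → (∀ x → P x → P (inv x)) →
                (Σ (List (C Gₛ)) λ rs → ∀ g → Any (λ r → P (inv r · g)) rs) → ∀ g → P g
    connected conn {P} dP P1 P· Pinv (rs , cover) g =
      let (x , e , p) = conn P̂ subgroup (map out rs , λ h → map⁺ (Any-map (λ {r} p → inv r · into h , coset r h , p) (cover (into h))))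
                          (toWitness (proj₂ g))
      in subst P (El≡ e) p
      where
        open DefinableGroup H using (Mem; _∙_; _⁻¹; isGroup)
        module I = IsGroup isGroup
        P̂ : Vec N (DefinableGroup.dim H) → Set ℓ
        P̂ v = Σ (C Gₛ) λ x → proj₁ x ≡ v × P x
        coset : ∀ r h → proj₁ (inv r · into h) ≡ proj₁ ((out r ⁻¹) ∙ h)
        coset r h = I.∙-cong {out (inv r)} {out r ⁻¹} {out (into h)} {h} refl refl
        subgroup : IsDefinableSubgroup 𝓝 H P̂
        subgroup = record
          { subset      = λ { (x , refl , _) → toWitness (proj₂ x) }
          ; H-definable = Def⇒Definable (DefP.get dP)
          ; ε-closed    = 1# , refl , P1
          ; ∙-closed    = λ x y (x′ , e , p) (y′ , e′ , q) → x′ · y′ , I.∙-cong {out x′} {x} {out y′} {y} e e′ , P· x′ y′ p q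
          ; ⁻¹-closed   = λ x (x′ , e , p) → inv x′ , I.⁻¹-cong {out x′} {x} e , Pinv x′ p }

  -- Definable subgroups of full dimension

  module Subgroups (A : DefinableGroup 𝓝) (τ : GroupManifold 𝓝 A) (compact : DefinablyCompact 𝓝 τ)
                   (conn : DefinablyConnected 𝓝 A) where
    open Limits A τ compact public
    open Decode A public

    record Subgroup (P : C Aₛ → Set ℓ) : Set ℓ where
      field
        def     : DefP Aₛ P
        unit    : P 1#
        product : ∀ x y → P x → P y → P (x · y)
        inverse : ∀ x → P x → P (inv x)

    quotient : ∀ z x y → inv (inv z · x) · (inv z · y) ≡ inv x · y
    quotient z x y = trans (cong (_· (inv z · y)) (trans (⁻¹-anti-homo-∙ (inv z) x) (cong (inv x ·_) (⁻¹-involutive z))))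
      (trans (G.assoc (inv x) z (inv z · y)) (cong (inv x ·_) (\\-leftDividesˡ z y)))

    opaque
      -- A definable subgroup of full dimension is open; if it had infinite index, a curve of coset
      -- representatives would converge, and its points would eventually lie in a single coset.
      full-subgroup : ∀ {P} → Subgroup P → DimS Aₛ d P → ∀ x → P x
      full-subgroup {P} S δ = case interior S.def δ of λ { (x₀ , w , open-P) → Open-P.everything w λ y b →
          subst P (\\-leftDividesʳ x₀ y) (S.product _ _ (S.inverse _ (subst P (G.identityʳ x₀) (open-P 1# (B-1# w)))) (open-P y b)) }
        where
          module S = Subgroup S
          module Open-P (w : C Uₛ) (B⊆P : ∀ y → B w y → P y) where
            Coset : C Aₛ → Vec N n → Set ℓ
            Coset x v = Σ (C Aₛ) λ y → proj₁ y ≡ v × P (inv x · y)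

            Coset-def : DefP (Aₛ ⊗ Vₛ n) (λ xv → Coset (proj₁ xv) (proj₂ xv))
            Coset-def = def-∃ Aₛ (def-× (def-≡ (m-enc {T = Aₛ} v0) v1) (def-app S.def (·-def (inv-def u2) v0)))

            inhabited : ∀ x → Σ (Vec N n) (Coset x)
            inhabited x = proj₁ x , x , refl , subst P (sym (G.inverseˡ x)) S.unit

            module R = Description {Aₛ} {Aₛ} (λ x z → IsLim n (Coset x) decode z) (IsLim-def n Coset-def (decode-def v0)) 1#

            -- In place of a chosen element, the limit of the coset along its own type. It depends
            -- only on the coset as a set, whence `rep-cong`.
            rep : C Aₛ → C Aₛ
            rep = R.the

            rep-lim : ∀ x → IsLim n (Coset x) decode (rep x)
            rep-lim x = case IsLim-exists n (fix₁ {P = Coset} Coset-def x) (decode-def m-id) (inhabited x) of λ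
              { (z , p) → R.the-sat x z p λ z′ p′ → IsLim-unique n (inhabited x) p′ p }

            -- Cosets of an open subgroup are closed: an element of the coset close to `rep x`
            -- differs from it by an element of `P`.
            rep-in : ∀ x → P (inv x · rep x)
            rep-in x = case Gen-point n (inhabited x) (rep-lim x w) of λ
              { (v , (y , refl , Pxy) , b) → subst P (compose-inv x y (rep x))
                  (S.product _ _ Pxy (subst P (quotient-inv x y) (S.inverse _ (B⊆P _ b)))) }
              where
                quotient-inv : ∀ x y → inv (inv (rep x) · decode (proj₁ y)) ≡ inv y · rep x
                quotient-inv x y = trans (⁻¹-anti-homo-∙ (inv (rep x)) (decode (proj₁ y)))
                  (cong₂ _·_ (cong inv (decode-proj₁ y)) (⁻¹-involutive (rep x)))

            same-coset : ∀ x y → P (inv x · y) → ∀ v → Coset y v → Coset x v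
            same-coset x y p v (z , e , q) = z , e , subst P (compose-inv x y z) (S.product _ _ p q)

            flip-coset : ∀ x y → P (inv x · y) → P (inv y · x)
            flip-coset x y p = subst P (trans (⁻¹-anti-homo-∙ (inv x) y) (cong (inv y ·_) (⁻¹-involutive x))) (S.inverse _ p)

            rep-cong : ∀ x y → P (inv x · y) → rep x ≡ rep y
            rep-cong x y p = IsLim-unique n (inhabited x) (rep-lim x) λ u →
              Gen-cong n (same-coset x y p) (same-coset y x (flip-coset x y p)) (rep-lim y u)

            rep-rep : ∀ x y → P (inv (rep x) · rep y) → rep x ≡ rep y
            rep-rep x y p = rep-cong x y (subst P (compose-inv x (rep x) y)
              (S.product _ _ (rep-in x) (subst P (compose-inv (rep x) (rep y) y) (S.product _ _ p (flip-coset y (rep y) (rep-in y))))))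

            Reps : Vec N n → Set ℓ
            Reps v = Σ (C Aₛ) λ x → proj₁ (rep x) ≡ v

            Reps-def : DefP (Vₛ n) Reps
            Reps-def = def-∃ Aₛ (def-≡ (m-enc {T = Aₛ} (m-∘ R.the-def v0)) u1)

            no-curve : ¬ Curve Reps
            no-curve (a , b , ab , σ , dσ , inR , inj) =
              case limit {λ t → a < t × t < b} (ioo-def (m-const a) (m-const b) m-id) (dense ab) (λ t → decode (σ t)) (decode-def dσ) of λ
              { (z , lim) → clash z (lim w) }
              where
                clash : ∀ z → ¬ Initially _<_ (λ t → a < t × t < b) (λ t → B w (inv z · decode (σ t)))
                clash z (e , (ae , eb) , h) = case dense ae of λ { (s , as , se) →
                  case inR s as (<-trans se eb) of λ { (x , ex) → case inR e ae eb of λ { (y , ey) →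
                    inj s e as se eb (trans (sym ex) (trans (cong proj₁ (rep-rep x y
                      (subst₂ (λ p q → P (inv p · q)) (decoded x s ex) (decoded y e ey)
                        (subst P (quotient z (decode (σ s)) (decode (σ e)))
                          (S.product _ _ (S.inverse _ (B⊆P _ (h s (as , <-trans se eb) (asym se)))) (B⊆P _ (h e (ae , eb) <-irrefl))))))) ey)) } } }
                  where
                    decoded : ∀ x t → proj₁ (rep x) ≡ σ t → decode (σ t) ≡ rep x
                    decoded x t e = trans (cong decode (sym e)) (decode-proj₁ (rep x))

            everything : ∀ x → P x
            everything = connected conn S.def S.unit S.product S.inverse
              (case em {P = Listable Reps} of λ
                { (no ¬l) → ⊥-elim (no-curve (infinite⇒curve n Reps-def ¬l))
                ; (yes (vs , h)) → map decode vs , λ g → map⁺ (Any-map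
                    (λ {v} e → subst (λ r → P (inv r · g)) (trans (sym (decode-proj₁ (rep g))) (cong decode e)) (flip-coset g (rep g) (rep-in g)))
                    (h (proj₁ (rep g)) (g , refl))) })

    module Abelian (comm : ∀ x y → x · y ≡ y · x) where
      interchange : ∀ p q r s → (p · q) · (r · s) ≡ (p · r) · (q · s)
      interchange p q r s = trans (G.assoc p q (r · s)) (trans (cong (p ·_) (trans (sym (G.assoc q r s))
        (trans (cong (_· s) (comm q r)) (G.assoc r q s)))) (sym (G.assoc p r (q · s))))

      inv-· : ∀ x y → inv (x · y) ≡ inv x · inv y
      inv-· x y = trans (⁻¹-anti-homo-∙ x y) (comm (inv y) (inv x))

  -- A definable family of endomorphisms that tends pointwise to the trivial one does so uniformly,
  -- so that the images form arbitrarily small subgroups. Adding up such images increases the dimension forever.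
  module Shrinking (A : DefinableGroup 𝓝) (τ : GroupManifold 𝓝 A) (compact : DefinablyCompact 𝓝 τ)
                   (conn : DefinablyConnected 𝓝 A) where
    open Subgroups A τ compact conn

    module Family (comm : ∀ x y → x · y ≡ y · x) (a b : N) (ab : a < b)
      (F : N → C Aₛ → C Aₛ) (dF : DefM (Nₛ ⊗ Aₛ) Aₛ (λ tx → F (proj₁ tx) (proj₂ tx)))
      (hom : ∀ t → a < t × t < b → ∀ x y → F t (x · y) ≡ F t x · F t y)
      (pointwise : ∀ x u → Initially _<_ (λ t → a < t × t < b) λ t → B u (F t x))
      (nontrivial : ∀ {P} → Initially _<_ (λ t → a < t × t < b) P → Σ N λ t → (a < t × t < b) × P t × Σ (C Aₛ) λ x → ¬ F t x ≡ 1#) where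

      open Abelian comm
      open import Algebra.Properties.Group elGroup using (identityʳ-unique)

      D : N → Set ℓ
      D t = a < t × t < b

      D-def : DefP Nₛ D
      D-def = ioo-def (m-const a) (m-const b) m-id

      F-def : ∀ {S f g} → DefM S Nₛ f → DefM S Aₛ g → DefM S Aₛ (λ s → F (f s) (g s))
      F-def = m-app₂ {h = F} dF

      hom-1# : ∀ t → D t → F t 1# ≡ 1#
      hom-1# t Dt = identityʳ-unique (F t 1#) (F t 1#) (trans (sym (hom t Dt 1# 1#)) (cong (F t) (G.identityˡ 1#)))

      hom-inv : ∀ t → D t → ∀ x → F t (inv x) ≡ inv (F t x)
      hom-inv t Dt x = inverseʳ-unique (F t x) (F t (inv x))
        (trans (sym (hom t Dt x (inv x))) (trans (cong (F t) (G.inverseʳ x)) (hom-1# t Dt)))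

      xy/x : ∀ x y → (x · y) · inv x ≡ y
      xy/x x y = trans (comm (x · y) (inv x)) (\\-leftDividesʳ x y)

      opaque
        -- The interior point `x₀` of the large set need not be neutral. Writing `F s y` as the
        -- difference of `F s (x₀ · y)` and `F s x₀` moves the estimate to the neutral element, at
        -- the cost of passing from `u` to a `v` whose quotients lie in `u`.
        equicontinuous : ∀ u → Σ (C Uₛ) λ w → Initially _<_ D λ t → ∀ y → B w y → B u (F t y)
        equicontinuous u = case B-div u of λ { (v , div) → near v div (large v) }
          where
            E : C Uₛ → N → C Aₛ → Set ℓ
            E v t x = D t × (∀ s → D s → ¬ (t < s) → B v (F s x))
            E-def : ∀ v → DefP (Nₛ ⊗ Aₛ) (λ tx → E v (proj₁ tx) (proj₂ tx))
            E-def v = def-× (def-app D-def u1) (def-∀ Nₛ (def-→ (def-app D-def v0) (def-→ (def-¬ (def-< u2 v0))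
                        (B-def (m-const v) (F-def v0 v1)))))
            -- In place of a Baire argument over a countable union: each `x` lies in `E v t` for an
            -- interval of `t`, and `Dim-∃∞` turns this into one `t` whose set has the dimension of
            -- the whole group.
            large : ∀ v → Σ N λ t → DimS Aₛ d (E v t)
            large v = Dim-∃∞ n d {λ t v′ → Σ (C Aₛ) λ x → proj₁ x ≡ v′ × E v t x}
              (def-∃ Aₛ (def-× (def-≡ (m-enc {T = Aₛ} v0) v1) (def-app₂ {R = E v} (E-def v) u2 v0)))
              (Dim-mono n d (λ { _ (x , refl , _) → often x }) full)
              where
                often : ∀ (x : C Aₛ) → ∃∞ λ t → Σ (C Aₛ) λ x′ → proj₁ x′ ≡ proj₁ x × E v t x′
                often x = case pointwise x v of λ { (e , (ae , eb) , h) → a , e , ae , λ t at te →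
                  x , refl , (at , <-trans te eb) , λ s Ds t≮s → h s Ds λ es → t≮s (<-trans te es) }
            near : ∀ v → (∀ x y → B v x → B v y → B u (x · inv y)) → (Σ N λ t → DimS Aₛ d (E v t)) →
                   Σ (C Uₛ) λ w → Initially _<_ D λ t → ∀ y → B w y → B u (F t y)
            near v div (t , δ) = case interior (fix₁ {P = E v} (E-def v) t) δ of λ { (x₀ , w , h) →
              w , t , proj₁ (h 1# (B-1# w)) , λ s Ds t≮s y b →
                subst (B u) (trans (cong (_· inv (F s x₀)) (hom s Ds x₀ y)) (xy/x (F s x₀) (F s y)))
                  (div _ _ (proj₂ (h y b) s Ds t≮s)
                    (subst (λ z → B v (F s z)) (G.identityʳ x₀) (proj₂ (h 1# (B-1# w)) s Ds t≮s))) }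

        -- If it failed, the sets `Out t` would be nonempty for all early `t`. The points `c t` have
        -- a limit `z` but need not lie in `Out t`, so an `x` of `Out t` close to `c t`, hence to
        -- `z`, is taken. Then `F t x` is the product of `F t z`, small by pointwise convergence,
        -- and `F t (inv z · x)`, small by equicontinuity.
        uniform : ∀ u → Initially _<_ D λ t → ∀ x → B u (F t x)
        uniform u = case LineLaws.initially <-laws {D} {λ t → ∀ x → B u (F t x)} D-def (def-∀ Aₛ (B-def (m-const u) (F-def u1 v0))) (dense ab) of λ
          { (inj₁ p) → p
          ; (inj₂ p) → ⊥-elim (case B-mul u of λ { (v , mul) → case equicontinuous v of λ { (w , eq) → case B-mul w of λ { (w′ , mul′) →
              case limit D-def (dense ab) c R.the-def of λ { (z , lim) →
                case Initially-point (Initially-∩ (Initially-∩ p eq) (Initially-∩ (lim w′) (pointwise z v))) of λ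
                { (t , Dt , (bad , eqt) , (ct , Fz)) → case escape t bad of λ { (x₁ , out₁) →
                  case Gen-point n (x₁ , out₁) (c-lim t (x₁ , out₁) w′) of λ
                  { (v′ , (x , refl , Fx) , b) →
                    Fx (subst (λ y → B u (F t y)) (\\-leftDividesˡ z x)
                      (subst (B u) (sym (hom t Dt z (inv z · x)))
                        (mul _ _ Fz (eqt (inv z · x) (subst (B w) (compose-inv z (c t) x)
                          (mul′ _ _ ct (subst (λ y → B w′ (inv (c t) · y)) (decode-proj₁ x) b)))))) ) } } } } } } }) }
          where
            Out : N → Vec N n → Set ℓ
            Out t v = Σ (C Aₛ) λ x → proj₁ x ≡ v × ¬ B u (F t x)
            Out-def : DefP (Nₛ ⊗ Vₛ n) (λ tv → Out (proj₁ tv) (proj₂ tv))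
            Out-def = def-∃ Aₛ (def-× (def-≡ (m-enc {T = Aₛ} v0) v1) (def-¬ (B-def (m-const u) (F-def u2 v0))))
            module R = Description {Nₛ} {Aₛ} (λ t z → IsLim n (Out t) decode z) (IsLim-def n Out-def (decode-def v0)) 1#
            c : N → C Aₛ
            c = R.the
            escape : ∀ t → ¬ (∀ x → B u (F t x)) → Σ (Vec N n) (Out t)
            escape t bad = by-contra λ m → bad λ x → by-contra λ ¬b → m (proj₁ x , x , refl , ¬b)
            c-lim : ∀ t → Σ (Vec N n) (Out t) → IsLim n (Out t) decode (c t)
            c-lim t o = case IsLim-exists n (fix₁ {P = Out} Out-def t) (decode-def m-id) o of λ
              { (z , q) → R.the-sat t z q λ z′ q′ → IsLim-unique n o q′ q }

      Sum : (C Aₛ → Set ℓ) → N → C Aₛ → Set ℓ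
      Sum W t z = Σ (C Aₛ) λ w → Σ (C Aₛ) λ x → W w × w · F t x ≡ z

      opaque
        Sum-subgroup : ∀ {W} t → D t → Subgroup W → Subgroup (Sum W t)
        Sum-subgroup {W} t Dt S = record
          { def = def-∃ Aₛ (def-∃ Aₛ (def-× (def-app S.def v1) (def-≡ (·-def v1 (F-def (m-const t) v0)) u2)))
          ; unit = 1# , 1# , S.unit , trans (G.identityˡ _) (hom-1# t Dt)
          ; product = λ { _ _ (w , x , Ww , refl) (w′ , x′ , Ww′ , refl) → w · w′ , x · x′ , S.product w w′ Ww Ww′ ,
              trans (cong ((w · w′) ·_) (hom t Dt x x′)) (interchange w w′ (F t x) (F t x′)) }
          ; inverse = λ { _ (w , x , Ww , refl) → inv w , inv x , S.inverse w Ww ,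
              trans (cong (inv w ·_) (hom-inv t Dt x)) (sym (inv-· w (F t x))) } }
          where module S = Subgroup S

        preimage-subgroup : ∀ {W} t → D t → Subgroup W → Subgroup (λ x → W (F t x))
        preimage-subgroup {W} t Dt S = record
          { def = def-app S.def (F-def (m-const t) m-id)
          ; unit = subst W (sym (hom-1# t Dt)) S.unit
          ; product = λ x y p q → subst W (sym (hom t Dt x y)) (S.product _ _ p q)
          ; inverse = λ x p → subst W (sym (hom-inv t Dt x)) (S.inverse _ p) }
          where module S = Subgroup S

        -- The pairs in `W` times `A` have dimension at least `k + d` and map onto the sum. A fibre
        -- embeds through its second component, and translation by one of its points moves it into
        -- the subgroup of all `x` with `W (F t x)`. Since this subgroup is proper, `full-subgroup`
        -- keeps its dimension below `d`, so at least `k + 1` remains for the sum.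
        Sum-dimension : ∀ {W} t → D t → Subgroup W → ¬ (∀ x → W (F t x)) → ∀ k → DimS Aₛ k W → DimS Aₛ (suc k) (Sum W t)
        Sum-dimension {W} t Dt S proper k δ = by-cases d refl
          where
            module S = Subgroup S
            P : Subgroup (λ x → W (F t x))
            P = preimage-subgroup t Dt S
            Pair : C Aₛ × C Aₛ → Set ℓ
            Pair wx = W (proj₁ wx) × Lift ℓ ⊤
            Value : C Aₛ × C Aₛ → C Aₛ → Set ℓ
            Value wx z = proj₁ wx · F t (proj₂ wx) ≡ z
            Pair-def : DefP (Aₛ ⊗ Aₛ) Pair
            Pair-def = def-× (def-app S.def u1) def-⊤
            Value-def : ∀ {S f g h} → DefM S Aₛ f → DefM S Aₛ g → DefM S Aₛ h → DefP S (λ s → f s · F t (g s) ≡ h s)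
            Value-def f g h = def-≡ (·-def f (F-def (m-const t) g)) h
            Fibre : C Aₛ → C Aₛ → Set ℓ
            Fibre z x = Σ (C Aₛ × C Aₛ) λ wx → (Pair wx × Value wx z) × proj₂ wx ≡ x
            difference : ∀ z x₁ x → Fibre z x₁ → Fibre z x → W (F t (inv x₁ · x))
            difference z x₁ x ((w₁ , _) , ((Ww₁ , _) , e₁) , refl) ((w , _) , ((Ww , _) , e) , refl) =
              subst W (trans (sym eq) (trans (cong (_· F t x) (sym (hom-inv t Dt x₁))) (sym (hom t Dt (inv x₁) x))))
                (S.product _ _ Ww₁ (S.inverse _ Ww))
              where
                part : ∀ w x → w · F t x ≡ z → F t x ≡ inv w · z
                part w x e = trans (sym (\\-leftDividesʳ w (F t x))) (cong (inv w ·_) e)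
                eq : inv (F t x₁) · F t x ≡ w₁ · inv w
                eq = trans (cong₂ (λ p q → inv p · q) (part w₁ x₁ e₁) (part w x e))
                  (trans (cong (_· (inv w · z)) (trans (inv-· (inv w₁) z) (cong (_· inv z) (⁻¹-involutive w₁))))
                  (trans (cong ((w₁ · inv z) ·_) (comm (inv w) z)) (trans (G.assoc w₁ (inv z) (z · inv w))
                    (cong (w₁ ·_) (\\-leftDividesʳ z (inv w))))))
            fibre-small : ∀ d′ → d ≡ suc d′ → ∀ z → ¬ DimS (Aₛ ⊗ Aₛ) (suc d′) (λ wx → Pair wx × Value wx z)
            fibre-small d′ e z ε = case Dim-nonempty n (suc d′) ε₂ of λ { (_ , x₁ , _ , fx₁) →
                proper (full-subgroup P (subst (λ j → DimS Aₛ j (λ x → W (F t x))) (sym e)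
                  (DimS-mono Aₛ (suc d′) (λ { y (x , fx , refl) → difference z x₁ x fx₁ fx })
                    (DimS-injection Aₛ Aₛ (suc d′) {Fibre z} {λ x y → inv x₁ · x ≡ y}
                      (def-∃ (Aₛ ⊗ Aₛ) (def-× (def-× (def-app Pair-def v0) (Value-def (m-∘ u1 v0) (m-∘ v0 v0) (m-const z))) (def-≡ (m-∘ v0 v0) u1)))
                      (def-≡ (·-def (m-const (inv x₁)) u1) v0)
                      (λ x _ → inv x₁ · x , refl)
                      (λ x x′ y _ _ p q → trans (sym (\\-leftDividesˡ x₁ x)) (trans (cong (x₁ ·_) (trans p (sym q))) (\\-leftDividesˡ x₁ x′)))
                      ε₂)))) }
              where
                ε₂ : DimS Aₛ (suc d′) (Fibre z)
                ε₂ = DimS-injection (Aₛ ⊗ Aₛ) Aₛ (suc d′) {λ wx → Pair wx × Value wx z} {λ wx x → proj₂ wx ≡ x}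
                  (def-× Pair-def (Value-def u1 v0 (m-const z))) (def-≡ (m-∘ v0 u1) v0)
                  (λ wx _ → proj₂ wx , refl)
                  (λ { (w , x) (w′ , x′) y (_ , p) (_ , q) refl refl → cong (_, x) (trans (sym (cancel w (F t x)))
                      (trans (cong (_· inv (F t x)) (trans p (sym q))) (cancel w′ (F t x)))) }) ε
                  where
                    cancel : ∀ w y → (w · y) · inv y ≡ w
                    cancel w y = trans (G.assoc w y (inv y)) (trans (cong (w ·_) (G.inverseʳ y)) (G.identityʳ w))
            by-cases : ∀ m → d ≡ m → DimS Aₛ (suc k) (Sum W t)
            -- In dimension zero a point is already of full dimension, so the subgroup could not be
            -- proper. Elsewhere `d` is a successor and the truncated subtraction is exact.
            by-cases zero    e = ⊥-elim (proper (full-subgroup P (subst (λ j → DimS Aₛ j (λ x → W (F t x))) (sym e)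
                                   (Dim-point (proj₁ 1#) (1# , refl , Subgroup.unit P)))))
            by-cases (suc d′) e = subst (λ j → DimS Aₛ j (Sum W t))
              (trans (cong (_∸ d′) (trans (cong (k +_) e) (+-suc k d′))) (m+n∸n≡m (suc k) d′))
              (DimS-mono Aₛ (k + d ∸ d′) (λ { z ((w , x) , (Ww , _) , v) → w , x , Ww , v })
                (DimS-image (Aₛ ⊗ Aₛ) Aₛ (k + d) d′ {Pair} {Value} Pair-def (Value-def (m-∘ u1 u1) (m-∘ v0 u1) v0)
                  (λ wx _ → _ , refl) (fibre-small d′ e) (DimS-× Aₛ Aₛ k d δ full)))

        -- The neighbourhood varies in the induction, because the recursive call needs a `v` that
        -- avoids the value `F t x` found at this stage.
        small-subgroups : ∀ k u → Σ (C Aₛ → Set ℓ) λ W → Subgroup W × (∀ x → W x → B u x) × DimS Aₛ k W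
        small-subgroups zero u = (_≡ 1#) , record
            { def = def-≡ m-id (m-const 1#) ; unit = refl
            ; product = λ { _ _ refl refl → G.identityˡ 1# } ; inverse = λ { _ refl → ε⁻¹≈ε } } ,
          (λ { _ refl → B-1# u }) , Dim-point (proj₁ 1#) (1# , refl , refl)
        small-subgroups (suc k) u = case B-mul u of λ { (u′ , mul) → case nontrivial (uniform u′) of λ { (t , Dt , small , x , Fx≢1) →
          case B-Hausdorff (F t x) Fx≢1 of λ { (u″ , out) → case B-∩ u′ u″ of λ { (v , both) → case small-subgroups k v of λ
            { (W , S , W⊆B , δ) → Sum W t , Sum-subgroup t Dt S ,
                (λ { _ (w , y , Ww , refl) → mul _ _ (proj₁ (both _ (W⊆B w Ww))) (small y) }) ,
                Sum-dimension t Dt S (λ h → out (proj₂ (both _ (W⊆B _ (h x))))) k δ } } } } }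

        -- A subset of the `n`-th power of `N` has dimension at most `n`, and any neighbourhood of
        -- the neutral element serves as the starting one.
        impossible : ⊥
        impossible = case around (κ i₀ 1#) of λ { (lo , hi , p , q) →
          case small-subgroups (suc n) ((lo , hi) , fromWitness (p , q)) of λ { (W , _ , _ , δ) → ¬Dim-suc n δ } }

  -- Modules and the orbit of a moved point

  module Action {G : DefinableGroup 𝓝} (M : DefinableModule 𝓝 G) (τ : GroupManifold 𝓝 (DefinableModule.A M))
                (compact : DefinablyCompact 𝓝 τ) (connG : DefinablyConnected 𝓝 G)
                (connA : DefinablyConnected 𝓝 (DefinableModule.A M)) where
    open DefinableModule M using (_▷_; γ; γ-cong; γ-homo; ▷-definable)
    open Subgroups (DefinableModule.A M) τ compact connA
    module GS = GroupSort G
    module GD = Decode G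
    private
      module IA = IsGroup (DefinableGroup.isGroup (DefinableModule.A M))
      nG : ℕ
      nG = DefinableGroup.dim G

    ·-comm : ∀ x y → x · y ≡ y · x
    ·-comm x y = El≡ (DefinableModule.comm M (out x) (out y))

    open Abelian ·-comm

    infixr 6 _▸_
    _▸_ : C GS.Gₛ → C Aₛ → C Aₛ
    g ▸ x = into (GS.out g ▷ out x)

    opaque
      ▸-cong : ∀ g {x y} → proj₁ x ≡ proj₁ y → proj₁ (g ▷ x) ≡ proj₁ (g ▷ y)
      ▸-cong g {x} {y} = DefinableAut.cong (γ g) {x} {y}

      ▸-· : ∀ g x y → g ▸ (x · y) ≡ (g ▸ x) · (g ▸ y)
      ▸-· g x y = El≡ (trans (▸-cong (GS.out g) {out (x · y)} {DefinableGroup._∙_ (DefinableModule.A M) (out x) (out y)} refl)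
        (trans (I.∙-homo (out x) (out y))
          (IA.∙-cong {GS.out g ▷ out x} {out (g ▸ x)} {GS.out g ▷ out y} {out (g ▸ y)} refl refl)))
        where
          open import Algebra.Morphism.Structures using (module GroupMorphisms)
          module I = GroupMorphisms.IsGroupIsomorphism (DefinableAut.isGroupIsomorphism (γ (GS.out g)))

      ▸-injective : ∀ g {x y} → g ▸ x ≡ g ▸ y → x ≡ y
      ▸-injective g {x} {y} e = El≡ (I.injective {out x} {out y} (cong proj₁ e))
        where
          open import Algebra.Morphism.Structures using (module GroupMorphisms)
          module I = GroupMorphisms.IsGroupIsomorphism (DefinableAut.isGroupIsomorphism (γ (GS.out g)))

      ▸-assoc : ∀ g h x → (g GS.· h) ▸ x ≡ g ▸ h ▸ x
      ▸-assoc g h x = El≡ (trans (γ-cong (GS.out (g GS.· h)) (DefinableGroup._∙_ G (GS.out g) (GS.out h)) refl (out x))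
        (trans (γ-homo (GS.out g) (GS.out h) (out x)) (▸-cong (GS.out g) {GS.out h ▷ out x} {out (h ▸ x)} refl)))

      -- `γ` is given as multiplicative only; the neutral element acts as an injective idempotent,
      -- hence as the identity.
      ▸-1# : ∀ x → GS.1# ▸ x ≡ x
      ▸-1# x = ▸-injective GS.1# (trans (sym (▸-assoc GS.1# GS.1# x)) (cong (_▸ x) (GS.G.identityˡ GS.1#)))

      ▸-inv : ∀ g x → GS.inv g ▸ g ▸ x ≡ x
      ▸-inv g x = trans (sym (▸-assoc (GS.inv g) g x)) (trans (cong (_▸ x) (GS.G.inverseˡ g)) (▸-1# x))

      ▸-def₀ : DefM (GS.Gₛ ⊗ Aₛ) Aₛ (λ gx → proj₁ gx ▸ proj₂ gx)
      ▸-def₀ = DefP-resp fwd bwd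
        (pull (s-∘ (s-enc {GS.Gₛ ⊗ (Aₛ ⊗ Aₛ)}) (s-, (s-∘ s-proj₁ s-proj₁) (s-, (s-∘ s-proj₂ s-proj₁) s-proj₂)))
              (Def→DefP (Definable⇒Def ▷-definable)))
        where
          fwd : ∀ s → Graph₂ 𝓝 (λ g x → proj₁ (g ▷ x)) (proj₁ (proj₁ (proj₁ s)) ++ (proj₁ (proj₂ (proj₁ s)) ++ proj₁ (proj₂ s))) →
                proj₁ (proj₁ s) ▸ proj₂ (proj₁ s) ≡ proj₂ s
          fwd ((g , x) , y) (g′ , x′ , e) with ++-injective (proj₁ g) (proj₁ g′) e
          ... | e₁ , e′ with ++-injective (proj₁ x) (proj₁ x′) e′
          ... | e₂ , e₃ = El≡ (trans (γ-cong (GS.out g) g′ e₁ (out x)) (trans (▸-cong g′ {out x} {x′} e₂) (sym e₃)))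
          bwd : ∀ s → proj₁ (proj₁ s) ▸ proj₂ (proj₁ s) ≡ proj₂ s →
                Graph₂ 𝓝 (λ g x → proj₁ (g ▷ x)) (proj₁ (proj₁ (proj₁ s)) ++ (proj₁ (proj₂ (proj₁ s)) ++ proj₁ (proj₂ s)))
          bwd ((g , x) , y) refl = GS.out g , out x , refl

    ▸-def : ∀ {S f g} → DefM S GS.Gₛ f → DefM S Aₛ g → DefM S Aₛ (λ s → f s ▸ g s)
    ▸-def = m-app₂ {h = _▸_} ▸-def₀

    opaque
      IsLim-· : ∀ m {X h h′ z z′} → Σ (Vec N m) X → IsLim m X h z → IsLim m X h′ z′ → IsLim m X (λ v → h v · h′ v) (z · z′)
      IsLim-· m {z = z} {z′} x p q u = case B-mul u of λ { (w , mul) →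
        Gen-mono m x (λ v _ (b , b′) → subst (B u) (trans (interchange (inv z) _ (inv z′) _) (cong (_· _) (sym (inv-· z z′)))) (mul _ _ b b′))
          (Gen-∩ m (p w) (q w)) }

    module Moved (a₀ : C Aₛ) (g₁ : C GS.Gₛ) (moved : ¬ g₁ ▸ a₀ ≡ a₀) where
      Orbit : Vec N n → Set ℓ
      Orbit v = Σ (C GS.Gₛ) λ g → proj₁ (g ▸ a₀) ≡ v

      opaque
        Orbit-def : DefP (Vₛ n) Orbit
        Orbit-def = def-∃ GS.Gₛ (def-≡ (m-enc {T = Aₛ} (▸-def v0 (m-const a₀))) u1)

        -- A finite orbit would give the stabiliser of `a₀` finite index, and connectedness of `G`
        -- would then put `g₁` into it.
        orbit-infinite : ¬ Listable Orbit
        orbit-infinite (vs , h) = moved (GD.connected connG {λ g → g ▸ a₀ ≡ a₀} (def-≡ (▸-def m-id (m-const a₀)) (m-const a₀)) (▸-1# a₀)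
            (λ g g′ p q → trans (▸-assoc g g′ a₀) (trans (cong (g ▸_) q) p))
            (λ g p → trans (cong (GS.inv g ▸_) (sym p)) (▸-inv g a₀))
            (proj₁ (reps vs) , λ g → Any-map (λ {r} e → trans (▸-assoc (GS.inv r) g a₀) (trans (cong (GS.inv r ▸_) (sym e)) (▸-inv r a₀)))
                                       (proj₂ (reps vs) g (h (proj₁ (g ▸ a₀)) (g , refl)))) g₁)
          where
            -- The list may contain vectors outside of the orbit; these yield no coset
            -- representative and are dropped.
            reps : ∀ vs → Σ (List (C GS.Gₛ)) λ rs → ∀ g → Any (proj₁ (g ▸ a₀) ≡_) vs → Any (λ r → r ▸ a₀ ≡ g ▸ a₀) rs
            reps [] = [] , λ _ ()
            reps (v ∷ vs) = case em {P = Orbit v} of λ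
              { (yes (r , e)) → r ∷ proj₁ (reps vs) , λ
                  { g (here e′) → here (El≡ (trans e (sym e′))) ; g (there z) → there (proj₂ (reps vs) g z) }
              ; (no ¬o) → proj₁ (reps vs) , λ
                  { g (here e′) → ⊥-elim (¬o (g , e′)) ; g (there z) → proj₂ (reps vs) g z } }

      -- Along a curve σ in the orbit, t ↦ lim { g ▸ x : g ▸ a₀ = σ t } is a definable family of
      -- endomorphisms, nonconstant because it sends a₀ to σ t; no choice of g is needed.
      module AlongCurve (a b : N) (ab : a < b) (σ : N → Vec N n) (dσ : DefM Nₛ (Vₛ n) σ)
        (inOrbit : ∀ t → a < t → t < b → Orbit (σ t)) (distinct : ∀ s t → a < s → s < t → t < b → ¬ σ s ≡ σ t) where
        D : N → Set ℓ
        D t = a < t × t < b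

        D-def : DefP Nₛ D
        D-def = ioo-def (m-const a) (m-const b) m-id

        Γ : N → Vec N nG → Set ℓ
        Γ t v = Σ (C GS.Gₛ) λ g → proj₁ g ≡ v × proj₁ (g ▸ a₀) ≡ σ t

        act : C Aₛ → Vec N nG → C Aₛ
        act x v = GD.decode v ▸ x

        opaque
          Γ-def : DefP (Nₛ ⊗ Vₛ nG) (λ tv → Γ (proj₁ tv) (proj₂ tv))
          Γ-def = def-∃ GS.Gₛ (def-× (def-≡ (m-enc {T = GS.Gₛ} v0) v1)
                    (def-≡ (m-enc {T = Aₛ} (▸-def v0 (m-const a₀))) (m-∘ dσ u2)))

          Γ-inhabited : ∀ t → D t → Σ (Vec N nG) (Γ t)
          Γ-inhabited t (at , tb) = let (g , e) = inOrbit t at tb in proj₁ g , g , refl , e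

          lim-def : DefP (Nₛ ⊗ Aₛ ⊗ Aₛ) (λ s → IsLim nG (Γ (proj₁ (proj₁ s))) (act (proj₂ (proj₁ s))) (proj₂ s))
          lim-def = IsLim-def {Nₛ ⊗ Aₛ} nG {λ tx → Γ (proj₁ tx)} {λ tx → act (proj₂ tx)}
            (def-app₂ {R = Γ} Γ-def u2 v0) (▸-def (GD.decode-def v0) v1)

        module LimH = Description {Nₛ ⊗ Aₛ} {Aₛ} (λ tx z → IsLim nG (Γ (proj₁ tx)) (act (proj₂ tx)) z) lim-def 1#

        H : N → C Aₛ → C Aₛ
        H t x = LimH.the (t , x)

        opaque
          H-lim : ∀ t → D t → ∀ x → IsLim nG (Γ t) (act x) (H t x)
          H-lim t Dt x = case IsLim-exists nG (fix₁ {P = Γ} Γ-def t) (▸-def (GD.decode-def m-id) (m-const x)) (Γ-inhabited t Dt) of λ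
            { (z , p) → LimH.the-sat (t , x) z p λ z′ p′ → IsLim-unique nG (Γ-inhabited t Dt) p′ p }

          H-· : ∀ t → D t → ∀ x y → H t (x · y) ≡ H t x · H t y
          H-· t Dt x y = IsLim-unique nG (Γ-inhabited t Dt) (H-lim t Dt (x · y))
            (IsLim-cong nG (Γ-inhabited t Dt) (λ v _ → sym (▸-· (GD.decode v) x y))
              (IsLim-· nG (Γ-inhabited t Dt) (H-lim t Dt x) (H-lim t Dt y)))

          -- All `g` in the fibre `Γ t` send `a₀` to the same point, so here the limit is taken of a
          -- constant.
          H-a₀ : ∀ t → D t → proj₁ (H t a₀) ≡ σ t
          H-a₀ t Dt@(at , tb) = case inOrbit t at tb of λ { (g , e) → trans (cong proj₁
            (IsLim-unique nG (Γ-inhabited t Dt) (H-lim t Dt a₀)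
              (IsLim-cong nG (Γ-inhabited t Dt) (λ { v (g′ , refl , e′) → El≡ (trans e (trans (sym e′)
                  (cong (λ h → proj₁ (h ▸ a₀)) (sym (GD.decode-proj₁ g′))))) })
                (IsLim-const nG (g ▸ a₀) (Γ-inhabited t Dt))))) e }

          H-def : ∀ {S f g} → DefM S Nₛ f → DefM S Aₛ g → DefM S Aₛ (λ s → H (f s) (g s))
          H-def f g = m-∘ LimH.the-def (m-, f g)

          Limit-def : DefP (Aₛ ⊗ Aₛ) (λ xz → Limit D (λ t → H t (proj₁ xz)) (proj₂ xz))
          Limit-def = def-∀ Uₛ (Initially-def (def-app D-def v0) (B-def v1 (·-def (inv-def v2) (H-def v0 u3))))

        module Lim∞ = Description {Aₛ} {Aₛ} (λ x z → Limit D (λ t → H t x) z) Limit-def 1#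

        H∞ : C Aₛ → C Aₛ
        H∞ = Lim∞.the

        F : N → C Aₛ → C Aₛ
        F t x = H t x · inv (H∞ x)

        opaque
          H∞-lim : ∀ x → Limit D (λ t → H t x) (H∞ x)
          H∞-lim x = case limit D-def (dense ab) (λ t → H t x) (H-def m-id (m-const x)) of λ
            { (z , p) → Lim∞.the-sat x z p λ z′ p′ → Limit-unique p′ p }

          H∞-· : ∀ x y → H∞ (x · y) ≡ H∞ x · H∞ y
          H∞-· x y = Limit-unique (H∞-lim (x · y)) λ u → case B-mul u of λ { (w , mul) →
            Initially-mono (λ t Dt (b , b′) → subst (B u)
                (trans (interchange (inv (H∞ x)) (H t x) (inv (H∞ y)) (H t y)) (cong₂ _·_ (sym (inv-· (H∞ x) (H∞ y))) (sym (H-· t Dt x y))))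
                (mul _ _ b b′))
              (Initially-∩ (H∞-lim x w) (H∞-lim y w)) }

          F-def₀ : DefM (Nₛ ⊗ Aₛ) Aₛ (λ tx → F (proj₁ tx) (proj₂ tx))
          F-def₀ = ·-def (H-def u1 v0) (inv-def (m-∘ Lim∞.the-def v0))

          F-· : ∀ t → D t → ∀ x y → F t (x · y) ≡ F t x · F t y
          F-· t Dt x y = trans (cong₂ (λ p q → p · inv q) (H-· t Dt x y) (H∞-· x y))
            (trans (cong ((H t x · H t y) ·_) (inv-· (H∞ x) (H∞ y))) (interchange (H t x) (H t y) (inv (H∞ x)) (inv (H∞ y))))

          F-pointwise : ∀ x u → Initially _<_ D λ t → B u (F t x)
          F-pointwise x u = Initially-mono (λ t _ → subst (B u) (·-comm (inv (H∞ x)) (H t x))) (H∞-lim x u)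

          -- `F t a₀` vanishes only where `σ t` is the code of `H∞ a₀`, hence for at most one `t`.
          -- If that happens at `e`, any smaller `t` will do.
          F-nontrivial : ∀ {P} → Initially _<_ D P → Σ N λ t → D t × P t × Σ (C Aₛ) λ x → ¬ F t x ≡ 1#
          F-nontrivial {P} (e , (ae , eb) , h) = case em {P = F e a₀ ≡ 1#} of λ
            { (no ¬p) → e , (ae , eb) , h e (ae , eb) <-irrefl , a₀ , ¬p
            ; (yes p) → case dense ae of λ { (t , at , te) →
                t , (at , <-trans te eb) , h t (at , <-trans te eb) (asym te) , a₀ ,
                λ q → distinct t e at te eb (trans (sym (hits t (at , <-trans te eb) q)) (hits e (ae , eb) p)) } }
            where
              hits : ∀ t → D t → F t a₀ ≡ 1# → proj₁ (H∞ a₀) ≡ σ t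
              hits t Dt p = trans (cong proj₁ (sym (x∙y⁻¹≈ε⇒x≈y (H t a₀) (H∞ a₀) p))) (H-a₀ t Dt)

        contradiction : ⊥
        contradiction = Shrinking.Family.impossible (DefinableModule.A M) τ compact connA ·-comm a b ab F F-def₀ F-· F-pointwise F-nontrivial

      absurd : ⊥
      absurd = case infinite⇒curve n Orbit-def orbit-infinite of λ
        { (a , b , ab , σ , dσ , inO , inj) → AlongCurve.contradiction a b ab σ dσ inO inj }

    trivial : IsTrivial 𝓝 M
    trivial g x = trans (γ-cong g (GS.out (GS.into g)) refl x)
      (trans (▸-cong (GS.out (GS.into g)) {x} {out (into x)} refl)
        (cong proj₁ (by-contra {P = GS.into g ▸ into x ≡ into x} λ m → Moved.absurd (into x) (GS.into g) m)))

theorem4p2 : (∀ {a} → ExcludedMiddle a) →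
    ∀ {ℓ} (L : Signature ℓ) (𝓝 : Structure L) → IsOMinimal 𝓝 →
    (G : DefinableGroup 𝓝) → Infinite 𝓝 G → DefinablyConnected 𝓝 G →
    (M : DefinableModule 𝓝 G) (τ : GroupManifold 𝓝 (DefinableModule.A M)) →
    DefinablyCompact 𝓝 τ → DefinablyConnected 𝓝 (DefinableModule.A M) →
    IsTrivial 𝓝 M
theorem4p2 em L 𝓝 om G _ connG M τ compact connA g x with em {P = Structure.Carrier 𝓝}
... | yes pt = Action.trivial em 𝓝 om pt M τ compact connG connA g x
-- There is no filler `pt` when `N` is empty, but then any two vectors of the same length are equal.
... | no ¬pt = vectors-equal _ _
  where
    vectors-equal : ∀ {n} (v w : Vec (Structure.Carrier 𝓝) n) → v ≡ w
    vectors-equal []      []      = refl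
    vectors-equal (a ∷ _) (_ ∷ _) = ⊥-elim (¬pt a)
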